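{- Let $r \geq 6$ and $n \geq 5r+18$ be integers. Then $$\sigma(K_{r+1} - (K_3 \cup P_3), n) = \begin{cases} (r-1)(2n-r) - 3(n-r) - 1, & \text{if } n-r \text{ is odd},\\ (r-1)(2n-r) - 3(n-r), & \text{if } n-r \text{ is even}.\end{cases}$$
   Context: All graphs are finite and simple. A non-increasing sequence $\pi=(d_1,\dots,d_n)$ of nonnegative integers is graphic if it is the degree sequence of a simple graph on $n$ vertices (a realization of $\pi$); $\sigma(\pi)=d_1+\dots+d_n$. For a graph $H$, $\pi$ is potentially $H$-graphic if some realization of $\pi$ contains $H$ as a (not necessarily induced) subgraph. $\sigma(H,n)$ denotes the minimum even integer $l$ such that every $n$-term graphic sequence $\pi$ with $\sigma(\pi)\geq l$ is potentially $H$-graphic. $K_m$ is the complete graph on $m$ vertices, $K_3$ is the triangle, $P_3$ is the path with $3$ edges (on $4$ vertices), and $K_3\cup P_3$ is their disjoint union (7 vertices, 6 edges). For a subgraph $H$ of $K_m$, $K_m - H$ is the graph obtained from $K_m$ by deleting the edges of $H$. -}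

module Defs where

open import Data.Nat using (ℕ; zero; suc; _+_; _*_; _∸_; _≤_)
open import Data.Nat.Divisibility using (_∣_)
open import Data.Bool using (Bool; true; false; if_then_else_; not; _∧_; _∨_)
open import Data.Fin using (Fin; toℕ)
import Data.Fin as F
open import Data.Product using (Σ; _×_; ∃)
open import Function.Definitions using (Injective)
open import Relation.Binary.PropositionalEquality using (_≡_; refl; cong; cong₂) renaming (sym to sym≡)
open import Data.Bool.Properties using (∨-comm)
open import Data.Empty using (⊥-elim)
open import Relation.Nullary using (¬_; yes; no)
open import Relation.Nullary.Decidable using (⌊_⌋)

sumF : ∀ {n} → (Fin n → ℕ) → ℕ
sumF {zero} f = 0
sumF {suc n} f = f F.zero + sumF (λ i → f (F.suc i))

record Graph (n : ℕ) : Set where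
  field
    adj   : Fin n → Fin n → Bool
    sym   : ∀ i j → adj i j ≡ adj j i
    irrefl : ∀ i → adj i i ≡ false
open Graph public

degree : ∀ {n} → Graph n → Fin n → ℕ
degree G i = sumF (λ j → if adj G i j then 1 else 0)

Seq : ℕ → Set
Seq n = Fin n → ℕ

NonIncreasing : ∀ {n} → Seq n → Set
NonIncreasing {n} d = ∀ (i j : Fin n) → toℕ i ≤ toℕ j → d j ≤ d i

Realizes : ∀ {n} → Graph n → Seq n → Set
Realizes {n} G d = ∀ (i : Fin n) → degree G i ≡ d i

Graphic : ∀ {n} → Seq n → Set
Graphic {n} d = NonIncreasing d × Σ (Graph n) (λ G → Realizes G d)

ContainsSubgraph : ∀ {m n} → Graph n → Graph m → Set
ContainsSubgraph {m} {n} G H =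
  Σ (Fin m → Fin n) (λ f → Injective _≡_ _≡_ f ×
     (∀ i j → adj H i j ≡ true → adj G (f i) (f j) ≡ true))

PotentiallyGraphic : ∀ {m n} → Graph m → Seq n → Set
PotentiallyGraphic {m} {n} H d =
  Σ (Graph n) (λ G → Realizes G d × ContainsSubgraph G H)

Even : ℕ → Set
Even l = 2 ∣ l

SigmaProperty : ∀ {m} → Graph m → ℕ → ℕ → Set
SigmaProperty H n l = ∀ (d : Seq n) → Graphic d → l ≤ sumF d → PotentiallyGraphic H d

IsSigma : ∀ {m} → Graph m → ℕ → ℕ → Set
IsSigma H n l = Even l × SigmaProperty H n l ×
  (∀ l' → Even l' → SigmaProperty H n l' → l ≤ l')

-- edges of K_3 ∪ P_3 on vertices 0..6: triangle 0-1-2, path 3-4-5-6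
removedEdge : ℕ → ℕ → Bool
removedEdge 0 1 = true
removedEdge 1 2 = true
removedEdge 0 2 = true
removedEdge 3 4 = true
removedEdge 4 5 = true
removedEdge 5 6 = true
removedEdge _ _ = false

removed : ℕ → ℕ → Bool
removed a b = removedEdge a b ∨ removedEdge b a

-- K_{r+1} - (K_3 ∪ P_3), vertices Fin (suc r), K_3 ∪ P_3 placed on vertices 0..6
-- (needs r + 1 ≥ 7)
KminusK3P3adj : ∀ r → Fin (suc r) → Fin (suc r) → Bool
KminusK3P3adj r i j = not ⌊ i F.≟ j ⌋ ∧ not (removed (toℕ i) (toℕ j))

private
  ≟-sym : ∀ {k} (i j : Fin k) → ⌊ i F.≟ j ⌋ ≡ ⌊ j F.≟ i ⌋
  ≟-sym i j with i F.≟ j | j F.≟ i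
  ... | yes _ | yes _ = refl
  ... | no _  | no _  = refl
  ... | yes p | no q  = ⊥-elim (q (sym≡ p))
  ... | no p  | yes q = ⊥-elim (p (sym≡ q))

  ≟-refl : ∀ {k} (i : Fin k) → ⌊ i F.≟ i ⌋ ≡ true
  ≟-refl i with i F.≟ i
  ... | yes _ = refl
  ... | no p = ⊥-elim (p refl)

KminusK3P3 : (r : ℕ) → Graph (suc r)
KminusK3P3 r = record
  { adj = KminusK3P3adj r
  ; sym = λ i j → cong₂ (λ a b → not a ∧ not b) (≟-sym i j) (∨-comm (removedEdge (toℕ i) (toℕ j)) (removedEdge (toℕ j) (toℕ i)))
  ; irrefl = λ i → cong (λ a → not a ∧ not (removed (toℕ i) (toℕ i))) (≟-refl i)
  }

{-# OPTIONS --safe #-}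

-- Write s = r - 3 and n = s + m.  H = K_{r+1} - (K_3 ∪ P_3) is contained in the join of K_s with K_{1,3} or
-- with P_3, and in the join of K_{s-1} with K_{2,3}.
--
-- Lower bound: in a realisation of the degree sequence of the join of K_s with a (near-)perfect matching, every
-- copy of H has four vertices outside the s dominating ones; these span at least three edges, but their
-- residual degrees add up to at most five.
--
-- Upper bound: place a wanted graph W on suitable vertices S of large degree and take a realisation with as many
-- W-edges as possible.  If a wanted edge uv is missing, pick unwanted edges ua and vb.  By 2-switches, two
-- vertices z, z′ outside S with z not in N[a] and z′ not in N[b] have neighbourhoods that are completely joined
-- to each other, and the smaller one is a clique; if both have degree above s, this already gives one of the
-- three joins.  So a missing edge leaves few vertices of degree above s.  When few vertices have degree at
-- least r, the degree sum rules this out.  Otherwise either all degrees are spread out, and it is ruled out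
-- again, or some vertex can be made adjacent to all vertices of degree above s, and removing it lowers s by one
-- without changing m.
module Submission where

open import Defs
open import Data.Nat using (ℕ; zero; suc; _+_; _*_; _∸_; _⊓_; _≤_; _<_; _<ᵇ_; z≤n; s≤s)
open import Data.Nat.Properties hiding (_≟_)
import Data.Nat.Properties as NP
open import Data.Nat.Divisibility using (_∣_; divides; ∣m∣n⇒∣m+n; ∣m+n∣m⇒∣n; m∣m*n; ∣1⇒≡1)
open import Data.Nat.Solver using (module +-*-Solver)
open import Data.Bool using (Bool; true; false; T; if_then_else_; not; _∧_; _∨_; _xor_)
open import Data.Bool.Properties using (∨-comm; ∧-comm; xor-comm; xor-same)
import Data.Bool.Properties as BP
open import Data.Fin using (Fin; zero; suc; toℕ; fromℕ; fromℕ<; inject₁; splitAt; _≟_; _↑ˡ_; _↑ʳ_; #_)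
import Data.Fin.Properties as FP
open import Data.Fin.Relation.Unary.Top using (view; ‵fromℕ; ‵inject₁)
open import Data.Vec using (Vec; []; _∷_; lookup; tabulate)
open import Data.Vec.Properties using (lookup∘tabulate)
open import Data.Product using (Σ; _×_; _,_; proj₁; proj₂; ∃)
open import Data.Sum using (_⊎_; inj₁; inj₂)
open import Data.Empty using (⊥; ⊥-elim)
open import Function.Definitions using (Injective)
open import Relation.Nullary using (¬_; yes; no; Dec)
open import Relation.Nullary.Decidable using (⌊_⌋; map′; _×-dec_; _→-dec_; decidable-stable)
open import Relation.Binary.PropositionalEquality using (_≡_; _≢_; refl; cong; cong₂; subst; subst₂; trans; module ≡-Reasoning) renaming (sym to ≡-sym)

-- The joins are chosen through their complements: a triangle, a path with three edges, and a
-- triangle with a disjoint edge all fit into K₃ ∪ P₃, and each join has `s + 4 = r + 1` vertices.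
-- The third one serves the case of only `s - 1` vertices of degree at least `r`, where the other
-- two lack a dominating vertex.
--
-- A maximal realisation enters only through contradictions, so the upper bound is obtained as a
-- refutation. It turns into an actual realisation at the very end, because potential
-- `H`-graphicness is decidable by finite search.
--
-- Removing a vertex lowers `r` and `n` together, so `r ≥ 6` is not inherited by the recursion. What
-- it carries is `m ≥ 4s + 33`, which is `n ≥ 5r + 18` rewritten, the separate bound `m ≥ 45`, which
-- is its value at `s = 3`, and the degree sum condition `σ ≥ s(s - 1) + 2sm + m + 2`. The vertex
-- set stays fixed throughout: a removed vertex is isolated, and only vertices of positive degree
-- count towards `s + m`.

private variable
  n k : ℕ

-- Counting

sum-cong : {f g : Fin n → ℕ} → (∀ i → f i ≡ g i) → sumF f ≡ sumF g
sum-cong {zero}  e = refl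
sum-cong {suc n} e = cong₂ _+_ (e zero) (sum-cong (λ i → e (suc i)))

sum-mono : {f g : Fin n → ℕ} → (∀ i → f i ≤ g i) → sumF f ≤ sumF g
sum-mono {zero}  e = z≤n
sum-mono {suc n} e = +-mono-≤ (e zero) (sum-mono (λ i → e (suc i)))

sum-mono-< : {f g : Fin n → ℕ} → (∀ i → f i ≤ g i) → ∀ j → f j < g j → sumF f < sumF g
sum-mono-< e zero    lt = +-mono-<-≤ lt (sum-mono (λ i → e (suc i)))
sum-mono-< e (suc j) lt = +-mono-≤-< (e zero) (sum-mono-< (λ i → e (suc i)) j lt)

interchange : ∀ a b c d → (a + b) + (c + d) ≡ (a + c) + (b + d)
interchange = solve 4 (λ a b c d → (a :+ b) :+ (c :+ d) := (a :+ c) :+ (b :+ d)) refl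
  where open +-*-Solver

sum-+ : (f g : Fin n → ℕ) → sumF (λ i → f i + g i) ≡ sumF f + sumF g
sum-+ {zero}  f g = refl
sum-+ {suc n} f g = trans (cong ((f zero + g zero) +_) (sum-+ (λ i → f (suc i)) (λ i → g (suc i))))
                          (interchange (f zero) (g zero) _ _)

sum-0 : sumF {n} (λ _ → 0) ≡ 0
sum-0 {zero}  = refl
sum-0 {suc n} = sum-0 {n}

sum-swap : (f : Fin n → Fin k → ℕ) → sumF (λ i → sumF (f i)) ≡ sumF (λ j → sumF (λ i → f i j))
sum-swap {zero} {k} f = ≡-sym (sum-0 {k})
sum-swap {suc n} f = trans (cong (sumF (f zero) +_) (sum-swap (λ i → f (suc i))))
                           (≡-sym (sum-+ (f zero) (λ j → sumF (λ i → f (suc i) j))))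

weight : Bool → ℕ → ℕ
weight b c = if b then c else 0

count : (Fin n → Bool) → ℕ
count P = sumF (λ i → if P i then 1 else 0)

_⊑_ : (P Q : Fin n → Bool) → Set
P ⊑ Q = ∀ i → P i ≡ true → Q i ≡ true

sum-weight : (P : Fin n → Bool) (c : ℕ) → sumF (λ i → weight (P i) c) ≡ count P * c
sum-weight {zero}  P c = refl
sum-weight {suc n} P c with P zero
... | true  = cong (c +_) (sum-weight (λ i → P (suc i)) c)
... | false = sum-weight (λ i → P (suc i)) c

bool-≤ : ∀ {a b : Bool} → (a ≡ true → b ≡ true) → (if a then 1 else 0) ≤ (if b then 1 else 0)
bool-≤ {false}         h = z≤n
bool-≤ {true}  {true}  h = s≤s z≤n
bool-≤ {true}  {false} h with () ← h refl

count-mono : {P Q : Fin n → Bool} → P ⊑ Q → count P ≤ count Q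
count-mono h = sum-mono (λ i → bool-≤ (h i))

count-cong : {P Q : Fin n → Bool} → (∀ i → P i ≡ Q i) → count P ≡ count Q
count-cong e = sum-cong (λ i → cong (λ b → if b then 1 else 0) (e i))

count-mono-< : {P Q : Fin n → Bool} → P ⊑ Q → ∀ j → Q j ≡ true → P j ≡ false → count P < count Q
count-mono-< {P = P} {Q} h j q p = sum-mono-< (λ i → bool-≤ (h i)) j lt
  where lt : (if P j then 1 else 0) < (if Q j then 1 else 0)
        lt rewrite q | p = s≤s z≤n

count-≤ : (P : Fin n → Bool) → count P ≤ n
count-≤ {zero}  P = z≤n
count-≤ {suc n} P with P zero
... | true  = s≤s (count-≤ (λ i → P (suc i)))
... | false = m≤n⇒m≤1+n (count-≤ (λ i → P (suc i)))

false≢true : ∀ {A : Set} {b : Bool} → b ≡ false → b ≡ true → A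
false≢true refl ()

≢true⇒false : ∀ {b} → ¬ (b ≡ true) → b ≡ false
≢true⇒false {false} h = refl
≢true⇒false {true}  h = ⊥-elim (h refl)

≢false⇒true : ∀ {b} → ¬ (b ≡ false) → b ≡ true
≢false⇒true {true}  h = refl
≢false⇒true {false} h = ⊥-elim (h refl)

true? : (b : Bool) → (b ≡ true) ⊎ (b ≡ false)
true? true  = inj₁ refl
true? false = inj₂ refl

all-or-counterexample : (P : Fin k → Bool) → (∀ a → P a ≡ true) ⊎ (∃ λ a → P a ≡ false)
all-or-counterexample {zero} P = inj₁ λ ()
all-or-counterexample {suc k} P with true? (P zero) | all-or-counterexample (λ a → P (suc a))
... | inj₂ e | _            = inj₂ (zero , e)
... | inj₁ _ | inj₂ (a , e) = inj₂ (suc a , e)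
... | inj₁ e | inj₁ h       = inj₁ λ { zero → e ; (suc a) → h a }

∧-intro : ∀ {a b} → a ≡ true → b ≡ true → a ∧ b ≡ true
∧-intro refl refl = refl

∧-elimˡ : ∀ {a b} → a ∧ b ≡ true → a ≡ true
∧-elimˡ {true} e = refl

∧-elimʳ : ∀ {a b} → a ∧ b ≡ true → b ≡ true
∧-elimʳ {true} e = e

∨-introˡ : ∀ {a b} → a ≡ true → a ∨ b ≡ true
∨-introˡ refl = refl

∨-introʳ : ∀ {a b} → b ≡ true → a ∨ b ≡ true
∨-introʳ {true}  e = refl
∨-introʳ {false} e = e

∨-elim : ∀ {a b} → a ∨ b ≡ true → (a ≡ true) ⊎ (b ≡ true)
∨-elim {true}  e = inj₁ refl
∨-elim {false} e = inj₂ e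

∨-false : ∀ {a b} → a ∨ b ≡ false → (a ≡ false) × (b ≡ false)
∨-false {false} e = refl , e

not-intro : ∀ {a} → a ≡ false → not a ≡ true
not-intro refl = refl

not-elim : ∀ {a} → not a ≡ true → a ≡ false
not-elim {false} e = refl

infix 4 _==_
_==_ : Fin n → Fin n → Bool
i == j = ⌊ i ≟ j ⌋

==⇒≡ : {i j : Fin n} → (i == j) ≡ true → i ≡ j
==⇒≡ {i = i} {j} e with i ≟ j
... | yes p = p

==-refl : (i : Fin n) → (i == i) ≡ true
==-refl i with i ≟ i
... | yes _ = refl
... | no ¬p = ⊥-elim (¬p refl)

≢⇒== : {i j : Fin n} → i ≢ j → (i == j) ≡ false
≢⇒== {i = i} {j} h with i ≟ j
... | yes p = ⊥-elim (h p)
... | no _  = refl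

==⇒≢ : {i j : Fin n} → (i == j) ≡ false → i ≢ j
==⇒≢ {i = i} e refl = false≢true e (==-refl i)

count-split : (P Q : Fin n → Bool) → count P ≡ count (λ i → P i ∧ Q i) + count (λ i → P i ∧ not (Q i))
count-split P Q = trans (sum-cong pt) (sum-+ (λ i → weight (P i ∧ Q i) 1) (λ i → weight (P i ∧ not (Q i)) 1))
  where pt : ∀ i → weight (P i) 1 ≡ weight (P i ∧ Q i) 1 + weight (P i ∧ not (Q i)) 1
        pt i with P i | Q i
        ... | true  | true  = refl
        ... | true  | false = refl
        ... | false | _     = refl

count-∨ : (P Q : Fin n → Bool) → count (λ i → P i ∨ Q i) ≤ count P + count Q
count-∨ P Q = ≤-trans (sum-mono pt) (≤-reflexive (sum-+ (λ i → weight (P i) 1) (λ i → weight (Q i) 1)))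
  where pt : ∀ i → weight (P i ∨ Q i) 1 ≤ weight (P i) 1 + weight (Q i) 1
        pt i with P i | Q i
        ... | true  | _     = s≤s z≤n
        ... | false | true  = s≤s z≤n
        ... | false | false = z≤n

sum-single : (j : Fin n) (c : ℕ) → sumF (λ i → weight (i == j) c) ≡ c
sum-single {suc n} zero    c = trans (cong (c +_) (sum-0 {n})) (+-identityʳ c)
sum-single {suc n} (suc j) c = trans (sum-cong pt) (sum-single j c)
  where pt : ∀ i → weight (suc i == suc j) c ≡ weight (i == j) c
        pt i with i ≟ j
        ... | yes _ = refl
        ... | no _  = refl

count-single : (j : Fin n) → count (λ i → i == j) ≡ 1
count-single j = sum-single j 1

count-insert : (P : Fin n → Bool) (j : Fin n) → P j ≡ false → count (λ i → P i ∨ (i == j)) ≡ suc (count P)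
count-insert P j e = trans (sum-cong pt) (trans (sum-+ (λ i → weight (P i) 1) (λ i → weight (i == j) 1))
    (trans (cong (count P +_) (count-single j)) (+-comm (count P) 1)))
  where pt : ∀ i → weight (P i ∨ (i == j)) 1 ≡ weight (P i) 1 + weight (i == j) 1
        pt i with i ≟ j
        pt i | yes refl rewrite e = refl
        pt i | no _ with P i
        ... | true  = refl
        ... | false = refl

count-remove : (P : Fin n → Bool) (j : Fin n) → P j ≡ true → suc (count (λ i → P i ∧ not (i == j))) ≡ count P
count-remove P j e = trans (+-comm 1 _) (trans (cong (count (λ i → P i ∧ not (i == j)) +_) (≡-sym (count-single j)))
    (trans (≡-sym (sum-+ (λ i → weight (P i ∧ not (i == j)) 1) (λ i → weight (i == j) 1))) (sum-cong pt)))
  where pt : ∀ i → weight (P i ∧ not (i == j)) 1 + weight (i == j) 1 ≡ weight (P i) 1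
        pt i with i ≟ j
        pt i | yes refl rewrite e = refl
        pt i | no _ with P i
        ... | true  = refl
        ... | false = refl

abstract
  -- Nearly every vertex picked in the switching arguments comes from this pigeonhole principle,
  -- with `Q` the set to choose from and `P` the set to avoid.
  excess : (P Q : Fin n → Bool) → count P < count Q → ∃ λ i → (Q i ≡ true) × (P i ≡ false)
  excess {zero} P Q ()
  excess {suc n} P Q lt with P zero in ep | Q zero in eq
  ... | false | true  = zero , eq , ep
  ... | true  | true  = let (i , q , p) = excess (λ i → P (suc i)) (λ i → Q (suc i)) (≤-pred lt) in suc i , q , p
  ... | false | false = let (i , q , p) = excess (λ i → P (suc i)) (λ i → Q (suc i)) lt in suc i , q , p
  ... | true  | false = let (i , q , p) = excess (λ i → P (suc i)) (λ i → Q (suc i)) (<-trans (n<1+n _) lt) in suc i , q , p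

  excess-≢ : (P Q : Fin n → Bool) (j : Fin n) → suc (count P) < count Q → ∃ λ i → (Q i ≡ true) × (P i ≡ false) × (i ≢ j)
  excess-≢ P Q j lt =
    let (i , q , p) = excess (λ i → P i ∨ (i == j)) Q
                        (≤-<-trans (≤-trans (count-∨ P (λ i → i == j))
                          (≤-reflexive (trans (cong (count P +_) (count-single j)) (+-comm (count P) 1)))) lt)
        (p₁ , p₂) = ∨-false p
    in i , q , p₁ , ==⇒≢ p₂

  enumerate : ∀ k (P : Fin n → Bool) → k ≤ count P →
    Σ (Fin k → Fin n) λ e → Injective _≡_ _≡_ e × (∀ i → P (e i) ≡ true)
  enumerate zero P le = (λ ()) , (λ {x} → ⊥-elim (FP.¬Fin0 x)) , λ ()
  enumerate {n} (suc k) P le with excess (λ _ → false) P (subst (_< count P) (≡-sym (sum-0 {n})) (≤-trans (s≤s z≤n) le))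
  ... | j , pj , _ with enumerate k (λ i → P i ∧ not (i == j)) (≤-pred (subst (suc k ≤_) (≡-sym (count-remove P j pj)) le))
  ... | e , inj , all = e' , inj' , all'
    where
      e' : Fin (suc k) → Fin n
      e' zero    = j
      e' (suc i) = e i
      ≢j : ∀ i → e i ≢ j
      ≢j i = ==⇒≢ (not-elim (∧-elimʳ {P (e i)} (all i)))
      inj' : Injective _≡_ _≡_ e'
      inj' {zero}  {zero}  eq = refl
      inj' {zero}  {suc y} eq = ⊥-elim (≢j y (≡-sym eq))
      inj' {suc x} {zero}  eq = ⊥-elim (≢j x eq)
      inj' {suc x} {suc y} eq = cong suc (inj eq)
      all' : ∀ i → P (e' i) ≡ true
      all' zero    = pj
      all' (suc i) = ∧-elimˡ (all i)

  between : ∀ k (P Q : Fin n → Bool) → P ⊑ Q → count P ≤ k → k ≤ count Q →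
    Σ (Fin n → Bool) λ S → P ⊑ S × S ⊑ Q × count S ≡ k
  between {n} k P Q PQ lo hi = go (k ∸ count P) P PQ (m∸n+n≡m lo)
    where
    go : ∀ j P → P ⊑ Q → j + count P ≡ k → Σ (Fin n → Bool) λ S → P ⊑ S × S ⊑ Q × count S ≡ k
    go zero    P PQ e = P , (λ _ p → p) , PQ , e
    go (suc j) P PQ e with excess P Q (≤-trans (s≤s (m≤n+m (count P) j)) (≤-trans (≤-reflexive e) hi))
    ... | x , q , p with go j (λ i → P i ∨ (i == x)) PQ' (trans (cong (j +_) (count-insert P x p)) (trans (+-suc j (count P)) e))
      where PQ' : (λ i → P i ∨ (i == x)) ⊑ Q
            PQ' i h with ∨-elim {P i} h
            ... | inj₁ y = PQ i y
            ... | inj₂ y rewrite ==⇒≡ {i = i} {x} y = q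
    ... | S , PS , SQ , c = S , (λ i p → PS i (∨-introˡ p)) , SQ , c

member : (Fin k → Fin n) → Fin n → Bool
member {zero}  y i = false
member {suc k} y i = (i == y zero) ∨ member (λ a → y (suc a)) i

member-intro : (y : Fin k → Fin n) (a : Fin k) → member y (y a) ≡ true
member-intro y zero    = ∨-introˡ (==-refl (y zero))
member-intro y (suc a) = ∨-introʳ {y (suc a) == y zero} (member-intro (λ a → y (suc a)) a)

member-elim : (y : Fin k → Fin n) (i : Fin n) → member y i ≡ true → ∃ λ a → i ≡ y a
member-elim {suc k} y i e with ∨-elim {i == y zero} e
... | inj₁ h = zero , ==⇒≡ h
... | inj₂ h = let (a , q) = member-elim (λ a → y (suc a)) i h in suc a , q

count-member : (y : Fin k → Fin n) → count (member y) ≤ k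
count-member {zero} {n} y = ≤-reflexive (sum-0 {n})
count-member {suc k} y = ≤-trans (count-∨ (λ i → i == y zero) (member (λ a → y (suc a))))
  (+-mono-≤ (≤-reflexive (count-single (y zero))) (count-member (λ a → y (suc a))))

count-injective : (f : Fin k → Fin n) → Injective _≡_ _≡_ f → (P : Fin k → Bool) (Q : Fin n → Bool) →
  (∀ a → P a ≡ true → Q (f a) ≡ true) → count P ≤ count Q
count-injective {zero} f inj P Q h = z≤n
count-injective {suc k} f inj P Q h with P zero in p
... | false = count-injective (λ a → f (suc a)) (λ e → FP.suc-injective (inj e)) (λ a → P (suc a)) Q (λ a → h (suc a))
... | true  = subst (suc (count (λ a → P (suc a))) ≤_) (count-remove Q (f zero) (h zero p))
    (s≤s (count-injective (λ a → f (suc a)) (λ e → FP.suc-injective (inj e)) (λ a → P (suc a)) _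
      (λ a pa → ∧-intro (h (suc a) pa) (not-intro (≢⇒== (λ e → FP.0≢1+n (≡-sym (inj e))))))))

-- Degree-preserving switches

Adj NonAdj : Graph n → Fin n → Fin n → Set
Adj G i j = adj G i j ≡ true
NonAdj G i j = adj G i j ≡ false

adj-sym : (G : Graph n) {i j : Fin n} → Adj G i j → Adj G j i
adj-sym G {i} {j} e = trans (sym G j i) e

nonadj-sym : (G : Graph n) {i j : Fin n} → NonAdj G i j → NonAdj G j i
nonadj-sym G {i} {j} e = trans (sym G j i) e

adj⇒≢ : (G : Graph n) {i j : Fin n} → Adj G i j → i ≢ j
adj⇒≢ G {i} e refl = false≢true (irrefl G i) e

SamePair : (i j p q : Fin n) → Set
SamePair i j p q = (i ≡ p × j ≡ q) ⊎ (i ≡ q × j ≡ p)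

samePair : (i j p q : Fin n) → Bool
samePair i j p q = ((i == p) ∧ (j == q)) ∨ ((i == q) ∧ (j == p))

samePair-elim : {i j p q : Fin n} → samePair i j p q ≡ true → SamePair i j p q
samePair-elim {i = i} {j} {p} {q} e with ∨-elim {(i == p) ∧ (j == q)} e
... | inj₁ h = inj₁ (==⇒≡ (∧-elimˡ h) , ==⇒≡ (∧-elimʳ {i == p} h))
... | inj₂ h = inj₂ (==⇒≡ (∧-elimˡ h) , ==⇒≡ (∧-elimʳ {i == q} h))

samePair-intro : {i j p q : Fin n} → SamePair i j p q → samePair i j p q ≡ true
samePair-intro {i = i} {j} (inj₁ (refl , refl)) = ∨-introˡ (∧-intro (==-refl i) (==-refl j))
samePair-intro {i = i} {j} (inj₂ (refl , refl)) = ∨-introʳ {(i == j) ∧ (j == i)} (∧-intro (==-refl i) (==-refl j))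

samePair-false : {i j p q : Fin n} → ¬ SamePair i j p q → samePair i j p q ≡ false
samePair-false h = ≢true⇒false (λ e → h (samePair-elim e))

samePair-sym : (i j p q : Fin n) → samePair i j p q ≡ samePair j i p q
samePair-sym i j p q with true? (samePair j i p q)
... | inj₁ e = trans (samePair-intro (swap (samePair-elim {i = j} {i} {p} {q} e))) (≡-sym e)
  where swap : SamePair j i p q → SamePair i j p q
        swap (inj₁ (a , b)) = inj₂ (b , a)
        swap (inj₂ (a , b)) = inj₁ (b , a)
... | inj₂ e = trans (samePair-false (λ h → false≢true e (samePair-intro (swap h)))) (≡-sym e)
  where swap : SamePair i j p q → SamePair j i p q
        swap (inj₁ (a , b)) = inj₂ (b , a)
        swap (inj₂ (a , b)) = inj₁ (b , a)

setEdge : (G : Graph n) (p q : Fin n) → p ≢ q → Bool → Graph n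
setEdge G p q p≢q b = record
  { adj = λ i j → if samePair i j p q then b else adj G i j
  ; sym = λ i j → cong₂ (λ c e → if c then b else e) (samePair-sym i j p q) (sym G i j)
  ; irrefl = irr }
  where
  irr : ∀ i → (if samePair i i p q then b else adj G i i) ≡ false
  irr i rewrite samePair-false {i = i} {i} {p} {q} (λ { (inj₁ (refl , e)) → p≢q e ; (inj₂ (refl , e)) → p≢q (≡-sym e) }) = irrefl G i

module _ (G : Graph n) {p q : Fin n} (ne : p ≢ q) (b : Bool) where

  setEdge-at : adj (setEdge G p q ne b) p q ≡ b
  setEdge-at rewrite samePair-intro {i = p} {q} {p} {q} (inj₁ (refl , refl)) = refl

  setEdge-off : ∀ {i j} → ¬ SamePair i j p q → adj (setEdge G p q ne b) i j ≡ adj G i j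
  setEdge-off h rewrite samePair-false h = refl

ends : (p q i : Fin n) → ℕ
ends p q i = weight (i == p) 1 + weight (i == q) 1

row-change : (P Q : Fin n → Bool) (q : Fin n) → P q ≡ false → Q q ≡ true → (∀ j → j ≢ q → Q j ≡ P j) → count Q ≡ suc (count P)
row-change P Q q p e h = trans (count-cong pt) (count-insert P q p)
  where pt : ∀ j → Q j ≡ P j ∨ (j == q)
        pt j with j ≟ q
        ... | yes refl = trans e (≡-sym (∨-introʳ {P j} refl))
        ... | no ne = trans (h j ne) (≡-sym (lemma (P j)))
          where lemma : ∀ b → b ∨ false ≡ b
                lemma true = refl
                lemma false = refl

two-graphs-degree : (G H : Graph n) {p q : Fin n} → p ≢ q → NonAdj G p q → Adj H p q →
  (∀ {i j} → ¬ SamePair i j p q → adj H i j ≡ adj G i j) → ∀ i → degree H i ≡ degree G i + ends p q i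
two-graphs-degree G H {p} {q} ne g h off i with i ≟ p | i ≟ q
... | yes refl | yes refl = ⊥-elim (ne refl)
... | yes refl | no _ = trans (row-change (adj G i) (adj H i) q g h (λ j j≢q → off (λ { (inj₁ (_ , e)) → j≢q e ; (inj₂ (e , _)) → ne e })))
                              (+-comm 1 (degree G i))
... | no _ | yes refl = trans (row-change (adj G i) (adj H i) p (nonadj-sym G g) (adj-sym H h)
                               (λ j j≢p → off (λ { (inj₁ (e , _)) → ne (≡-sym e) ; (inj₂ (_ , e)) → j≢p e })))
                              (+-comm 1 (degree G i))
... | no i≢p | no i≢q = trans (count-cong {P = adj H i} {Q = adj G i} (λ j → off (λ { (inj₁ (e , _)) → i≢p e ; (inj₂ (e , _)) → i≢q e }))) (≡-sym (+-identityʳ (degree G i)))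

degree-add : (G : Graph n) {p q : Fin n} (ne : p ≢ q) → NonAdj G p q → ∀ i → degree (setEdge G p q ne true) i ≡ degree G i + ends p q i
degree-add G ne g = two-graphs-degree G (setEdge G _ _ ne true) ne g (setEdge-at G ne true) (setEdge-off G ne true)

degree-del : (G : Graph n) {p q : Fin n} (ne : p ≢ q) → Adj G p q → ∀ i → degree G i ≡ degree (setEdge G p q ne false) i + ends p q i
degree-del G ne g = two-graphs-degree (setEdge G _ _ ne false) G ne (setEdge-at G ne false) g (λ h → ≡-sym (setEdge-off G ne false h))

infix 4 _~_
_~_ : Graph n → Graph n → Set
G ~ H = ∀ i → degree G i ≡ degree H i

-- Edges `px` and `qy` are traded for `pq` and `xy`. The fields are an interface that hides the four
-- single edge updates: apart from the traded pairs, edges and non-edges persist.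
record Switched (G : Graph n) (p x q y : Fin n) : Set where
  field
    result : Graph n
    same   : result ~ G
    newpq  : Adj result p q
    newxy  : Adj result x y
    keep   : ∀ {i j} → Adj G i j → ¬ SamePair i j p x → ¬ SamePair i j q y → Adj result i j
    keepN  : ∀ {i j} → NonAdj G i j → ¬ SamePair i j p q → ¬ SamePair i j x y → NonAdj result i j

abstract
  switch : (G : Graph n) (p x q y : Fin n) → Adj G p x → Adj G q y → NonAdj G p q → NonAdj G x y → p ≢ q → x ≢ y → Switched G p x q y
  switch {n} G p x q y px qy pq xy p≢q x≢y = record
    { result = G₄ ; same = deg
    ; newpq = trans (setEdge-off G₃ x≢y true pq∦xy) (setEdge-at G₂ p≢q true)
    ; newxy = setEdge-at G₃ x≢y true
    ; keep = λ {i} {j} e h₁ h₂ → trans (setEdge-off G₃ x≢y true (λ s → false≢true xy (move G s e)))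
        (trans (setEdge-off G₂ p≢q true (λ s → false≢true pq (move G s e))) (trans (setEdge-off G₁ q≢y false h₂) (trans (setEdge-off G p≢x false h₁) e)))
    ; keepN = λ {i} {j} e h₁ h₂ → trans (setEdge-off G₃ x≢y true h₂) (trans (setEdge-off G₂ p≢q true h₁)
        (trans (setEdge-off G₁ q≢y false (λ s → false≢true e (move′ G s qy))) (trans (setEdge-off G p≢x false (λ s → false≢true e (move′ G s px))) e)))
    }
    where
    p≢x : p ≢ x
    p≢x = adj⇒≢ G px
    q≢y : q ≢ y
    q≢y = adj⇒≢ G qy
    move : (G : Graph n) → ∀ {i j a b} → SamePair i j a b → Adj G i j → Adj G a b
    move G (inj₁ (refl , refl)) e = e
    move G (inj₂ (refl , refl)) e = adj-sym G e
    move′ : (G : Graph n) → ∀ {i j a b} → SamePair i j a b → Adj G a b → Adj G i j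
    move′ G (inj₁ (refl , refl)) e = e
    move′ G (inj₂ (refl , refl)) e = adj-sym G e
    G₁ G₂ G₃ G₄ : Graph n
    G₁ = setEdge G p x p≢x false
    G₂ = setEdge G₁ q y q≢y false
    G₃ = setEdge G₂ p q p≢q true
    G₄ = setEdge G₃ x y x≢y true
    qy∦px : ¬ SamePair q y p x
    qy∦px (inj₁ (e , _)) = p≢q (≡-sym e)
    qy∦px (inj₂ (refl , _)) = false≢true pq px
    pq∦xy : ¬ SamePair p q x y
    pq∦xy (inj₁ (e , _)) = p≢x e
    pq∦xy (inj₂ (refl , refl)) = false≢true pq px
    qy₁ : Adj G₁ q y
    qy₁ = trans (setEdge-off G p≢x false qy∦px) qy
    pq₂ : NonAdj G₂ p q
    pq₂ = trans (setEdge-off G₁ q≢y false (λ { (inj₁ (e , _)) → p≢q e ; (inj₂ (refl , _)) → false≢true pq (adj-sym G qy) }))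
         (trans (setEdge-off G p≢x false (λ { (inj₁ (_ , refl)) → false≢true pq px ; (inj₂ (e , _)) → p≢x e })) pq)
    xy₃ : NonAdj G₃ x y
    xy₃ = trans (setEdge-off G₂ p≢q true (λ { (inj₁ (e , _)) → p≢x (≡-sym e) ; (inj₂ (refl , refl)) → false≢true pq px }))
         (trans (setEdge-off G₁ q≢y false (λ { (inj₁ (refl , _)) → false≢true pq px ; (inj₂ (e , _)) → x≢y e }))
         (trans (setEdge-off G p≢x false (λ { (inj₁ (e , _)) → p≢x (≡-sym e) ; (inj₂ (_ , refl)) → false≢true pq (adj-sym G qy) })) xy))
    deg : G₄ ~ G
    -- The contributions of both removed edges are added on either side, so that gains and losses at
    -- `i` are compared without subtraction.
    deg i = +-cancelʳ-≡ (ends p x i + ends q y i) (degree G₄ i) (degree G i) (begin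
      degree G₄ i + (ends p x i + ends q y i)
        ≡⟨ cong (_+ (ends p x i + ends q y i)) (trans (degree-add G₃ x≢y xy₃ i) (cong (_+ ends x y i) (degree-add G₂ p≢q pq₂ i))) ⟩
      degree G₂ i + ends p q i + ends x y i + (ends p x i + ends q y i)
        ≡⟨ solve 5 (λ g P Q X Y → g :+ (P :+ Q) :+ (X :+ Y) :+ ((P :+ X) :+ (Q :+ Y)) := g :+ (Q :+ Y) :+ (P :+ X) :+ ((P :+ X) :+ (Q :+ Y))) refl
             (degree G₂ i) (weight (i == p) 1) (weight (i == q) 1) (weight (i == x) 1) (weight (i == y) 1) ⟩
      degree G₂ i + ends q y i + ends p x i + (ends p x i + ends q y i)
        ≡⟨ cong (_+ (ends p x i + ends q y i)) (≡-sym (trans (degree-del G p≢x px i) (cong (_+ ends p x i) (degree-del G₁ q≢y qy₁ i)))) ⟩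
      degree G i + (ends p x i + ends q y i) ∎)
      where open ≡-Reasoning
            open +-*-Solver

-- The joins to be found

Edgeless : ∀ k → Graph k
Edgeless k = record { adj = λ _ _ → false ; sym = λ _ _ → refl ; irrefl = λ _ → refl }

coneAdj : Graph k → Fin (suc k) → Fin (suc k) → Bool
coneAdj F zero    zero    = false
coneAdj F zero    (suc j) = true
coneAdj F (suc i) zero    = true
coneAdj F (suc i) (suc j) = adj F i j

Cone : Graph k → Graph (suc k)
Cone F = record { adj = coneAdj F ; sym = sy ; irrefl = ir }
  where
  sy : ∀ i j → coneAdj F i j ≡ coneAdj F j i
  sy zero    zero    = refl
  sy zero    (suc j) = refl
  sy (suc i) zero    = refl
  sy (suc i) (suc j) = sym F i j
  ir : ∀ i → coneAdj F i i ≡ false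
  ir zero    = refl
  ir (suc i) = irrefl F i

-- the path with consecutive vertices 2, 0, 1, 3
pathEdge : ℕ → ℕ → Bool
pathEdge 0 1 = true
pathEdge 0 2 = true
pathEdge 1 3 = true
pathEdge _ _ = false

P₃ : Graph 4
P₃ = record
  { adj = λ i j → pathEdge (toℕ i) (toℕ j) ∨ pathEdge (toℕ j) (toℕ i)
  ; sym = λ i j → ∨-comm (pathEdge (toℕ i) (toℕ j)) (pathEdge (toℕ j) (toℕ i))
  ; irrefl = λ { zero → refl ; (suc zero) → refl ; (suc (suc zero)) → refl ; (suc (suc (suc zero))) → refl } }

side : Fin 5 → Bool
side zero       = true
side (suc zero) = true
side _          = false

-- As in `P₃`, the two vertices of largest degree come first, which is the order in which
-- `enumerate-two` supplies them.
K₂₃ : Graph 5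
K₂₃ = record { adj = λ i j → side i xor side j ; sym = λ i j → xor-comm (side i) (side j) ; irrefl = λ i → xor-same (side i) }

-- The index is `s`, and a target has `s + 4` vertices; hence `K₂₃`, with five vertices, starts at
-- 1.
data Target : ℕ → {k : ℕ} → Graph k → Set where
  star : Target 0 (Cone (Edgeless 3))
  path : Target 0 P₃
  k23  : Target 1 K₂₃
  cone : ∀ {s} {F : Graph k} → Target s F → Target (suc s) (Cone F)

Good : ℕ → Graph n → Set
Good s G = Σ ℕ λ k → Σ (Graph k) λ F → Target s F × ContainsSubgraph G F

IsClique : Graph n → (Fin k → Fin n) → Set
IsClique G e = ∀ a b → a ≢ b → Adj G (e a) (e b)

module _ (G : Graph n) where

  cone-copy : {F : Graph k} (x : Fin n) (c : ContainsSubgraph G F) → (∀ i → Adj G x (proj₁ c i)) → ContainsSubgraph G (Cone F)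
  cone-copy {k} {F} x (f , inj , h) ax = f′ , inj′ , h′
    where
    f′ : Fin (suc k) → Fin n
    f′ zero    = x
    f′ (suc i) = f i
    inj′ : Injective _≡_ _≡_ f′
    inj′ {zero}  {zero}  e = refl
    inj′ {zero}  {suc j} e = ⊥-elim (adj⇒≢ G (ax j) e)
    inj′ {suc i} {zero}  e = ⊥-elim (adj⇒≢ G (ax i) (≡-sym e))
    inj′ {suc i} {suc j} e = cong suc (inj e)
    h′ : ∀ i j → coneAdj F i j ≡ true → Adj G (f′ i) (f′ j)
    h′ zero    (suc j) _ = ax j
    h′ (suc i) zero    _ = adj-sym G (ax i)
    h′ (suc i) (suc j) e = h i j e

  cones : ∀ j {s} {F : Graph k} → Target s F → (c : ContainsSubgraph G F) (e : Fin j → Fin n) → IsClique G e →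
    (∀ a i → Adj G (e a) (proj₁ c i)) → Good (j + s) G
  cones zero t c e cl h = _ , _ , t , c
  cones (suc j) {s} t c e cl h = subst (λ x → Good x G) (+-suc j s)
    (cones j (cone t) (cone-copy (e zero) c (h zero)) (λ a → e (suc a)) (λ a b ne → cl (suc a) (suc b) (λ q → ne (FP.suc-injective q)))
      λ { a zero → cl (suc a) zero (λ ()) ; a (suc i) → h (suc a) i })

  good-star : ∀ s (t u₁ u₂ u₃ : Fin n) (e : Fin s → Fin n) → u₁ ≢ u₂ → u₁ ≢ u₃ → u₂ ≢ u₃ →
    Adj G t u₁ → Adj G t u₂ → Adj G t u₃ → IsClique G e →
    (∀ a → Adj G (e a) t) → (∀ a → Adj G (e a) u₁) → (∀ a → Adj G (e a) u₂) → (∀ a → Adj G (e a) u₃) → Good s G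
  good-star s t u₁ u₂ u₃ e n₁₂ n₁₃ n₂₃ a₁ a₂ a₃ cl et e₁ e₂ e₃ =
    subst (λ x → Good x G) (+-identityʳ s)
      (cones s star (cone-copy t (u , inj , λ _ _ ()) (λ { zero → a₁ ; (suc zero) → a₂ ; (suc (suc zero)) → a₃ })) e cl
        λ { a zero → et a ; a (suc zero) → e₁ a ; a (suc (suc zero)) → e₂ a ; a (suc (suc (suc zero))) → e₃ a })
    where
    u : Fin 3 → Fin n
    u zero = u₁
    u (suc zero) = u₂
    u (suc (suc zero)) = u₃
    inj : Injective _≡_ _≡_ u
    inj {zero} {zero} _ = refl
    inj {zero} {suc zero} q = ⊥-elim (n₁₂ q)
    inj {zero} {suc (suc zero)} q = ⊥-elim (n₁₃ q)
    inj {suc zero} {zero} q = ⊥-elim (n₁₂ (≡-sym q))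
    inj {suc zero} {suc zero} _ = refl
    inj {suc zero} {suc (suc zero)} q = ⊥-elim (n₂₃ q)
    inj {suc (suc zero)} {zero} q = ⊥-elim (n₁₃ (≡-sym q))
    inj {suc (suc zero)} {suc zero} q = ⊥-elim (n₂₃ (≡-sym q))
    inj {suc (suc zero)} {suc (suc zero)} _ = refl

  good-path : ∀ s (p q x y : Fin n) (e : Fin s → Fin n) → p ≢ y → q ≢ x → x ≢ y →
    Adj G p q → Adj G p x → Adj G q y → IsClique G e →
    (∀ a → Adj G (e a) p) → (∀ a → Adj G (e a) q) → (∀ a → Adj G (e a) x) → (∀ a → Adj G (e a) y) → Good s G
  good-path s p q x y e py qx xy apq apx aqy cl ep eq ex ey =
    subst (λ x → Good x G) (+-identityʳ s) (cones s path (u , inj , h) e cl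
        λ { a zero → ep a ; a (suc zero) → eq a ; a (suc (suc zero)) → ex a ; a (suc (suc (suc zero))) → ey a })
    where
    u : Fin 4 → Fin n
    u zero = p
    u (suc zero) = q
    u (suc (suc zero)) = x
    u (suc (suc (suc zero))) = y
    inj : Injective _≡_ _≡_ u
    inj {zero} {zero} _ = refl
    inj {zero} {suc zero} r = ⊥-elim (adj⇒≢ G apq r)
    inj {zero} {suc (suc zero)} r = ⊥-elim (adj⇒≢ G apx r)
    inj {zero} {suc (suc (suc zero))} r = ⊥-elim (py r)
    inj {suc zero} {zero} r = ⊥-elim (adj⇒≢ G apq (≡-sym r))
    inj {suc zero} {suc zero} _ = refl
    inj {suc zero} {suc (suc zero)} r = ⊥-elim (qx r)
    inj {suc zero} {suc (suc (suc zero))} r = ⊥-elim (adj⇒≢ G aqy r)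
    inj {suc (suc zero)} {zero} r = ⊥-elim (adj⇒≢ G apx (≡-sym r))
    inj {suc (suc zero)} {suc zero} r = ⊥-elim (qx (≡-sym r))
    inj {suc (suc zero)} {suc (suc zero)} _ = refl
    inj {suc (suc zero)} {suc (suc (suc zero))} r = ⊥-elim (xy r)
    inj {suc (suc (suc zero))} {zero} r = ⊥-elim (py (≡-sym r))
    inj {suc (suc (suc zero))} {suc zero} r = ⊥-elim (adj⇒≢ G aqy (≡-sym r))
    inj {suc (suc (suc zero))} {suc (suc zero)} r = ⊥-elim (xy (≡-sym r))
    inj {suc (suc (suc zero))} {suc (suc (suc zero))} _ = refl
    h : ∀ i j → adj P₃ i j ≡ true → Adj G (u i) (u j)
    h zero (suc zero) _ = apq
    h zero (suc (suc zero)) _ = apx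
    h (suc zero) zero _ = adj-sym G apq
    h (suc zero) (suc (suc (suc zero))) _ = aqy
    h (suc (suc zero)) zero _ = adj-sym G apx
    h (suc (suc (suc zero))) (suc zero) _ = adj-sym G aqy
    h zero zero ()
    h zero (suc (suc (suc zero))) ()
    h (suc zero) (suc zero) ()
    h (suc zero) (suc (suc zero)) ()
    h (suc (suc zero)) (suc zero) ()
    h (suc (suc zero)) (suc (suc zero)) ()
    h (suc (suc zero)) (suc (suc (suc zero))) ()
    h (suc (suc (suc zero))) zero ()
    h (suc (suc (suc zero))) (suc (suc zero)) ()
    h (suc (suc (suc zero))) (suc (suc (suc zero))) ()

-- Realisations with a maximal number of wanted edges

<ᵇ-intro : ∀ {a b} → a < b → (a <ᵇ b) ≡ true
<ᵇ-intro {a} {b} lt with a <ᵇ b | <⇒<ᵇ lt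
... | true | _ = refl

<ᵇ-elim : ∀ {a b} → (a <ᵇ b) ≡ true → a < b
<ᵇ-elim {a} {b} e = <ᵇ⇒< a b (subst T (≡-sym e) _)

above : ℕ → Graph n → Fin n → Bool
above t G i = t <ᵇ degree G i

above-elim : (G : Graph n) {t : ℕ} {i : Fin n} → above t G i ≡ true → t < degree G i
above-elim G e = <ᵇ-elim e

above-intro : (G : Graph n) {t : ℕ} {i : Fin n} → t < degree G i → above t G i ≡ true
above-intro G lt = <ᵇ-intro lt

above-false : (G : Graph n) {t : ℕ} {i : Fin n} → above t G i ≡ false → degree G i ≤ t
above-false G {t} {i} e = ≮⇒≥ (λ lt → false≢true e (above-intro G lt))

module Wanted {N : ℕ} (W : Fin N → Fin N → Bool) where

  wt : Graph N → ℕ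
  wt G = sumF (λ i → count (λ j → adj G i j ∧ W i j))

  Max : Graph N → Set
  Max G = ∀ H → H ~ G → wt G < wt H → ⊥

  wt-mono : (G H : Graph N) → (∀ i j → W i j ≡ true → Adj G i j → Adj H i j) → wt G ≤ wt H
  wt-mono G H h = sum-mono (λ i → count-mono (λ j e → ∧-intro (h i j (∧-elimʳ {adj G i j} e) (∧-elimˡ e)) (∧-elimʳ {adj G i j} e)))

  wt-mono-< : (G H : Graph N) → (∀ i j → W i j ≡ true → Adj G i j → Adj H i j) →
    ∀ u v → W u v ≡ true → NonAdj G u v → Adj H u v → wt G < wt H
  wt-mono-< G H h u v w g e = sum-mono-< (λ i → count-mono (λ j → le i j)) u
    (count-mono-< (λ j → le u j) v (∧-intro e w) (cong (_∧ W u v) g))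
    where le : ∀ i j → adj G i j ∧ W i j ≡ true → adj H i j ∧ W i j ≡ true
          le i j e = ∧-intro (h i j (∧-elimʳ {adj G i j} e) (∧-elimˡ e)) (∧-elimʳ {adj G i j} e)

  wt-bound : (G : Graph N) → wt G ≤ sumF {N} (λ _ → N)
  wt-bound G = sum-mono (λ i → count-≤ (λ j → adj G i j ∧ W i j))

  -- the continuation only has to refute, so no maximal realisation needs to be computed
  maximise : (G : Graph N) → (∀ H → H ~ G → Max H → ⊥) → ⊥
  maximise G₀ k = go (sumF {N} (λ _ → N)) G₀ (λ _ → refl) (m≤n+m _ (wt G₀))
    where
    go : ∀ f G → G ~ G₀ → sumF {N} (λ _ → N) ≤ wt G + f → ⊥
    go zero    G eq le = k G eq (λ H _ lt → <⇒≱ lt (≤-trans (wt-bound H) (subst (_ ≤_) (+-identityʳ (wt G)) le)))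
    go (suc f) G eq le = k G eq (λ H eq′ lt → go f H (λ i → trans (eq′ i) (eq i))
      (≤-trans (subst (sumF {N} (λ _ → N) ≤_) (+-suc (wt G) f) le) (+-monoˡ-≤ f lt)))

-- Switches around a missing wanted edge

module Stuck {N : ℕ} (W : Fin N → Fin N → Bool) (W-sym : ∀ i j → W i j ≡ W j i) (W-irr : ∀ i → W i i ≡ false)
  (S : Fin N → Bool) (W-supp : ∀ {i j} → W i j ≡ true → S i ≡ true) where

  open Wanted W public

  outside : ∀ {i j} → S i ≡ false → W i j ≡ false
  outside s = ≢true⇒false (λ w → false≢true s (W-supp w))

  outsideʳ : ∀ {i j} → S j ≡ false → W i j ≡ false
  outsideʳ {i} {j} s = trans (W-sym i j) (outside s)

  ≢-pair : ∀ {i j p x} → W p x ≡ false → W i j ≡ true → ¬ SamePair i j p x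
  ≢-pair e w (inj₁ (refl , refl)) = false≢true e w
  ≢-pair {i} {j} e w (inj₂ (refl , refl)) = false≢true e (trans (W-sym j i) w)

  ∉≢∈ : ∀ {i j} → S i ≡ false → S j ≡ true → i ≢ j
  ∉≢∈ e f refl = false≢true e f

  module _ {G : Graph N} (max : Max G) {p x q y : Fin N} (sw : Switched G p x q y) (wpx : W p x ≡ false) (wqy : W q y ≡ false) where
    open Switched sw

    private
      kept : ∀ i j → W i j ≡ true → Adj G i j → Adj result i j
      kept i j w e = keep e (≢-pair wpx w) (≢-pair wqy w)

    -- A switch that gives up only unwanted edges does not lower the weight. So the result is
    -- maximal again, and by the same comparison it cannot have gained a wanted edge.
    switch-max : Max result
    switch-max H eq lt = max H (λ i → trans (eq i) (same i)) (≤-<-trans (wt-mono G result kept) lt)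

    switch-nonadj : ∀ {u v} → W u v ≡ true → NonAdj G u v → NonAdj result u v
    switch-nonadj {u} {v} w e = ≢true⇒false (λ h → max result same (wt-mono-< G result kept u v w e h))

  -- a wanted non-edge uv together with unwanted edges ua and vb that could be traded for it
  record Config (G : Graph N) (u v a b : Fin N) : Set where
    constructor config
    field
      wuv : W u v ≡ true
      nuv : NonAdj G u v
      ua  : Adj G u a
      wua : W u a ≡ false
      vb  : Adj G v b
      wvb : W v b ≡ false

    su : S u ≡ true
    su = W-supp wuv
    sv : S v ≡ true
    sv = W-supp (trans (W-sym v u) wuv)
    u≢v : u ≢ v
    u≢v refl = false≢true (W-irr u) wuv

  flip : ∀ {G u v a b} → Config G u v a b → Config G v u b a
  flip {G} {u} {v} (config w n e₁ w₁ e₂ w₂) = config (trans (W-sym v u) w) (nonadj-sym G n) e₂ w₂ e₁ w₁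

  -- Otherwise `ua` and `vb` could be traded for `uv` and `ab`, which gains a wanted edge and loses
  -- none.
  ends-adjacent : ∀ {G u v a b} → Max G → Config G u v a b → (a ≡ b) ⊎ Adj G a b
  ends-adjacent {G} {u} {v} {a} {b} max c with a ≟ b | true? (adj G a b)
  ... | yes e | _      = inj₁ e
  ... | no _  | inj₁ e = inj₂ e
  ... | no ne | inj₂ e = ⊥-elim (false≢true (switch-nonadj max sw wua wvb wuv nuv) (Switched.newpq sw))
    where open Config c
          sw = switch G u a v b ua vb nuv e u≢v ne

  -- If `z` is adjacent to `v`, it can replace `b` in the configuration, and `ends-adjacent` puts
  -- `z` into the closed neighbourhood of `a`, a contradiction. If it is not, and `by` is missing
  -- too, trading `vb` and `zy` for `vz` and `by` costs no wanted edge and creates that situation.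
  outside-neighbours : ∀ {G u v a b z y} → Max G → Config G u v a b → S z ≡ false → z ≢ a → NonAdj G a z → Adj G z y → (y ≡ b) ⊎ Adj G b y
  outside-neighbours {G} {u} {v} {a} {b} {z} {y} max c sz z≢a naz zy with y ≟ b | true? (adj G b y) | true? (adj G v z)
  ... | yes e | _      | _ = inj₁ e
  ... | no _  | inj₁ e | _ = inj₂ e
  ... | no _  | inj₂ _ | inj₁ vz with ends-adjacent {G} max (config (Config.wuv c) (Config.nuv c) (Config.ua c) (Config.wua c) vz (outsideʳ sz))
  ...   | inj₁ e = ⊥-elim (z≢a (≡-sym e))
  ...   | inj₂ e = false≢true naz e
  outside-neighbours {G} {u} {v} {a} {b} {z} {y} max c sz z≢a naz zy | no y≢b | inj₂ nby | inj₂ nvz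
    with ends-adjacent {Switched.result sw} (switch-max max sw wvb (outside sz)) (config wuv (switch-nonadj max sw wvb (outside sz) wuv nuv) ua′ wua (Switched.newpq sw) (outsideʳ sz))
    where
    open Config c
    sw : Switched G v b z y
    sw = switch G v b z y vb zy nvz nby (λ e → ∉≢∈ sz sv (≡-sym e)) (λ e → y≢b (≡-sym e))
    ua′ : Adj (Switched.result sw) u a
    ua′ = Switched.keep sw ua (λ { (inj₁ (e , _)) → u≢v e ; (inj₂ (e , refl)) → false≢true nuv ua })
            (λ { (inj₁ (e , _)) → ∉≢∈ sz su (≡-sym e) ; (inj₂ (_ , e)) → z≢a (≡-sym e) })
  ... | inj₁ e = ⊥-elim (z≢a (≡-sym e))
  ... | inj₂ e = false≢true (Switched.keepN sw naz
            (λ { (inj₁ (refl , _)) → false≢true nuv ua ; (inj₂ (e , _)) → z≢a (≡-sym e) })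
            (λ { (inj₁ (refl , refl)) → adj⇒≢ G zy refl ; (inj₂ (refl , refl)) → z≢b refl })) e
    where
    open Config c
    sw : Switched G v b z y
    sw = switch G v b z y vb zy nvz nby (λ e → ∉≢∈ sz sv (≡-sym e)) (λ e → y≢b (≡-sym e))
    z≢b : z ≢ b
    z≢b refl with ends-adjacent max c
    ... | inj₁ e = z≢a (≡-sym e)
    ... | inj₂ e = false≢true naz e

  record Pair (G : Graph N) (a b z z′ : Fin N) : Set where
    constructor mkPair
    field
      sz   : S z ≡ false
      sz′  : S z′ ≡ false
      z≢z′ : z ≢ z′
      z≢a  : z ≢ a
      naz  : NonAdj G a z
      z′≢b : z′ ≢ b
      nbz′ : NonAdj G b z′

  flipPair : ∀ {G a b z z′} → Pair G a b z z′ → Pair G b a z′ z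
  flipPair (mkPair a b c d e f g) = mkPair b a (λ q → c (≡-sym q)) f g d e

  module _ {G : Graph N} {u v a b z z′ : Fin N} (max : Max G) (c : Config G u v a b) (p : Pair G a b z z′) where
    open Config c
    open Pair p

    z≢b : z ≢ b
    z≢b refl with ends-adjacent max c
    ... | inj₁ e = z≢a (≡-sym e)
    ... | inj₂ e = false≢true naz e

    z′≢a : z′ ≢ a
    z′≢a refl with ends-adjacent max c
    ... | inj₁ e = z′≢b e
    ... | inj₂ e = false≢true nbz′ (adj-sym G e)

    nzz′ : NonAdj G z z′
    nzz′ = ≢true⇒false (λ e → case (outside-neighbours max c sz z≢a naz e))
      where case : (z′ ≡ b) ⊎ Adj G b z′ → ⊥
            case (inj₁ q) = z′≢b q
            case (inj₂ q) = false≢true nbz′ q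

    config-kept : ∀ {p x q y} (sw : Switched G p x q y) → W p x ≡ false → W q y ≡ false →
      ¬ SamePair u a p x → ¬ SamePair u a q y → ¬ SamePair v b p x → ¬ SamePair v b q y → Config (Switched.result sw) u v a b
    config-kept sw w₁ w₂ h₁ h₂ h₃ h₄ =
      config wuv (switch-nonadj max sw w₁ w₂ wuv nuv) (Switched.keep sw ua h₁ h₂) wua (Switched.keep sw vb h₃ h₄) wvb

    -- Otherwise trading `zx` and `z′x′` for `zz′` and `xx′` makes `z′` a neighbour of `z`, and
    -- `outside-neighbours` forces `z′` into the closed neighbourhood of `b`, which it avoids.
    neighbours-joined : ∀ {x x′} → Adj G z x → Adj G z′ x′ → (x ≡ x′) ⊎ Adj G x x′
    neighbours-joined {x} {x′} zx zx′ with x ≟ x′ | true? (adj G x x′)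
    ... | yes e | _ = inj₁ e
    ... | no _ | inj₁ e = inj₂ e
    ... | no ne | inj₂ nxx′ = ⊥-elim (fin (outside-neighbours (switch-max max sw (outside sz) (outside sz′)) c′ sz z≢a naz′ (Switched.newpq sw)))
      where
      sw : Switched G z x z′ x′
      sw = switch G z x z′ x′ zx zx′ nzz′ nxx′ z≢z′ ne
      c′ : Config (Switched.result sw) u v a b
      c′ = config-kept sw (outside sz) (outside sz′)
             (λ { (inj₁ (e , _)) → ∉≢∈ sz su (≡-sym e) ; (inj₂ (_ , e)) → z≢a (≡-sym e) })
             (λ { (inj₁ (e , _)) → ∉≢∈ sz′ su (≡-sym e) ; (inj₂ (_ , e)) → z′≢a (≡-sym e) })
             (λ { (inj₁ (e , _)) → ∉≢∈ sz sv (≡-sym e) ; (inj₂ (_ , e)) → z≢b (≡-sym e) })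
             (λ { (inj₁ (e , _)) → ∉≢∈ sz′ sv (≡-sym e) ; (inj₂ (_ , e)) → z′≢b (≡-sym e) })
      naz′ : NonAdj (Switched.result sw) a z
      naz′ = Switched.keepN sw naz
             (λ { (inj₁ (e , _)) → z≢a (≡-sym e) ; (inj₂ (e , _)) → z′≢a (≡-sym e) })
             (λ { (inj₁ (_ , refl)) → false≢true nzz′ (adj-sym G zx′) ; (inj₂ (_ , refl)) → adj⇒≢ G zx refl })
      fin : (z′ ≡ b) ⊎ Adj (Switched.result sw) b z′ → ⊥
      fin (inj₁ e) = z′≢b e
      fin (inj₂ e) = false≢true (Switched.keepN sw nbz′
             (λ { (inj₁ (e , _)) → z≢b (≡-sym e) ; (inj₂ (e , _)) → z′≢b (≡-sym e) })
             (λ { (inj₁ (_ , refl)) → adj⇒≢ G zx′ refl ; (inj₂ (_ , refl)) → false≢true nzz′ zx })) e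

  -- swapping one neighbour of z for one of z′ turns two nonadjacent neighbours of z into a pair forbidden by neighbours-joined
  module _ {G : Graph N} {u v a b z z′ : Fin N} (max : Max G) (c : Config G u v a b) (p : Pair G a b z z′)
           (le : degree G z ≤ degree G z′) where
    open Config c
    open Pair p

    private
      module _ {x₁ x₂ : Fin N} (e₁ : Adj G z x₁) (e₂ : Adj G z x₂) (ne : x₁ ≢ x₂) (nxx : NonAdj G x₁ x₂) where

        n₁ : NonAdj G z′ x₁
        n₁ = ≢true⇒false (λ e → case (neighbours-joined max c p e₂ e))
          where case : (x₂ ≡ x₁) ⊎ Adj G x₂ x₁ → ⊥
                case (inj₁ q) = ne (≡-sym q)
                case (inj₂ q) = false≢true nxx (adj-sym G q)

        n₂ : NonAdj G z′ x₂
        n₂ = ≢true⇒false (λ e → case (neighbours-joined max c p e₁ e))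
          where case : (x₁ ≡ x₂) ⊎ Adj G x₁ x₂ → ⊥
                case (inj₁ q) = ne q
                case (inj₂ q) = false≢true nxx q

        -- Both `x₁` and `x₂` are neighbours of `z` that `z′` misses. As `z′` has at least the
        -- degree of `z`, it has two neighbours that `z` misses, and one of them is not `a`.
        spare : ∃ λ y → Adj G z′ y × NonAdj G z y × (y ≢ a)
        spare = let (y , q , r , s) = excess-≢ (λ i → adj G z i ∧ adj G z′ i) (adj G z′) a
                       (≤-trans (subst (_≤ degree G z) (+-comm _ 2) two) le)
                in y , q , ≢true⇒false (λ h → false≢true r (∧-intro h q)) , s
          where
          common = λ i → adj G z i ∧ adj G z′ i
          two : count common + 2 ≤ degree G z
          two = subst (count common + 2 ≤_) (≡-sym (count-split (adj G z) (adj G z′)))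
                  (+-monoʳ-≤ (count common) (subst (2 ≤_) (count-remove rest x₁ r₁)
                    (s≤s (subst (1 ≤_) (count-remove rest′ x₂ r₂) (s≤s z≤n)))))
            where
            rest rest′ : Fin N → Bool
            rest i = adj G z i ∧ not (adj G z′ i)
            rest′ i = rest i ∧ not (i == x₁)
            r₁ : rest x₁ ≡ true
            r₁ = ∧-intro e₁ (not-intro n₁)
            r₂ : rest′ x₂ ≡ true
            r₂ = ∧-intro (∧-intro e₂ (not-intro n₂)) (not-intro (≢⇒== (λ q → ne (≡-sym q))))

        -- The switch makes `y` a neighbour of `z` and `x₁` a neighbour of `z′`. The pair survives
        -- because `y` is not `a` and `x₁` is not `b`.
        clash : x₁ ≢ b → ⊥
        clash x₁≢b with spare
        ... | y , z′y , nzy , y≢a = fin (neighbours-joined (switch-max max sw w₁ w₂) c′ p′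
                  (Switched.keep sw e₂ (λ { (inj₁ (_ , q)) → ne (≡-sym q) ; (inj₂ (q , _)) → adj⇒≢ G e₁ q })
                     (λ { (inj₁ (q , _)) → z≢y q ; (inj₂ (q , _)) → z≢z′ q }))
                  (adj-sym (Switched.result sw) (Switched.newxy sw)))
          where
          z≢y : z ≢ y
          z≢y refl = false≢true (nzz′ max c p) (adj-sym G z′y)
          x₁≢z′ : x₁ ≢ z′
          x₁≢z′ refl = false≢true (nzz′ max c p) e₁
          x₂≢z′ : x₂ ≢ z′
          x₂≢z′ refl = false≢true (nzz′ max c p) e₂
          w₁ : W z x₁ ≡ false
          w₁ = outside sz
          w₂ : W y z′ ≡ false
          w₂ = outsideʳ sz′
          sw : Switched G z x₁ y z′
          sw = switch G z x₁ y z′ e₁ (adj-sym G z′y) nzy (nonadj-sym G n₁) z≢y x₁≢z′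
          c′ : Config (Switched.result sw) u v a b
          c′ = config-kept max c p sw w₁ w₂
             (λ { (inj₁ (e , _)) → ∉≢∈ sz su (≡-sym e) ; (inj₂ (_ , e)) → z≢a (≡-sym e) })
             (λ { (inj₁ (_ , e)) → z′≢a max c p (≡-sym e) ; (inj₂ (e , _)) → ∉≢∈ sz′ su (≡-sym e) })
             (λ { (inj₁ (e , _)) → ∉≢∈ sz sv (≡-sym e) ; (inj₂ (_ , e)) → z≢b max c p (≡-sym e) })
             (λ { (inj₁ (_ , e)) → z′≢b (≡-sym e) ; (inj₂ (e , _)) → ∉≢∈ sz′ sv (≡-sym e) })
          p′ : Pair (Switched.result sw) a b z z′
          p′ = mkPair sz sz′ z≢z′ z≢a
             (Switched.keepN sw naz (λ { (inj₁ (e , _)) → z≢a (≡-sym e) ; (inj₂ (e , _)) → y≢a (≡-sym e) })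
                (λ { (inj₁ (_ , e)) → z≢z′ e ; (inj₂ (_ , e)) → adj⇒≢ G e₁ e }))
             z′≢b
             (Switched.keepN sw nbz′ (λ { (inj₁ (_ , e)) → adj⇒≢ G z′y e ; (inj₂ (_ , e)) → z≢z′ (≡-sym e) })
                (λ { (inj₁ (e , _)) → x₁≢b (≡-sym e) ; (inj₂ (e , _)) → z′≢b (≡-sym e) }))
          fin : (x₂ ≡ x₁) ⊎ Adj (Switched.result sw) x₂ x₁ → ⊥
          fin (inj₁ q) = ne (≡-sym q)
          fin (inj₂ q) = false≢true (Switched.keepN sw (nonadj-sym G nxx)
             (λ { (inj₁ (e , _)) → adj⇒≢ G e₂ (≡-sym e) ; (inj₂ (_ , e)) → adj⇒≢ G e₁ (≡-sym e) })
             (λ { (inj₁ (e , _)) → ne (≡-sym e) ; (inj₂ (e , _)) → x₂≢z′ e })) q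

    -- `clash` needs a first vertex other than `b`; of two distinct vertices at least one qualifies.
    nbhd-clique : ∀ {x₁ x₂} → Adj G z x₁ → Adj G z x₂ → x₁ ≢ x₂ → Adj G x₁ x₂
    nbhd-clique {x₁} {x₂} e₁ e₂ ne = ≢false⇒true λ nxx → case nxx (x₁ ≟ b)
      where
      case : NonAdj G x₁ x₂ → Dec (x₁ ≡ b) → ⊥
      case nxx (yes refl) = clash e₂ e₁ (λ q → ne (≡-sym q)) (nonadj-sym G nxx) (λ q → ne (≡-sym q))
      case nxx (no x₁≢b)  = clash e₁ e₂ ne nxx x₁≢b

    -- The clique is taken among the neighbours of `z`. If `z` misses `b`, then `s + 1` of them are
    -- adjacent to `z`, to `b` and to a third vertex found from `z′`, and one of them is the centre
    -- of the star. If `z` sees `b`, then `s` others dominate either the path `z`, `b`, `y`, `z′` or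
    -- a star with centre `b` and leaves `z`, `y₁`, `y₂`.
    good-ordered : ∀ s → s < degree G z → s < degree G z′ → Good s G
    good-ordered s hz hz′ with true? (adj G z b)
    ... | inj₂ nzb = case (all-or-counterexample (λ i → adj G z′ (e i)))
      where
      listing = enumerate (suc s) (adj G z) hz
      e = proj₁ listing
      inj = proj₁ (proj₂ listing)
      ze : ∀ i → Adj G z (e i)
      ze = proj₂ (proj₂ listing)
      cl : ∀ i j → i ≢ j → Adj G (e i) (e j)
      cl i j ne = nbhd-clique (ze i) (ze j) (λ q → ne (inj q))
      eb : ∀ i → Adj G (e i) b
      eb i with outside-neighbours max c sz z≢a naz (ze i)
      ... | inj₁ q = false≢true nzb (subst (Adj G z) q (ze i))
      ... | inj₂ q = adj-sym G q
      finish : ∀ y → y ≢ z → y ≢ b → (∀ i → Adj G (e i) y) → Good s G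
      finish y y≢z y≢b ey = good-star G s (e zero) z y b (λ i → e (suc i)) (λ q → y≢z (≡-sym q)) (z≢b max c p) y≢b
        (adj-sym G (ze zero)) (ey zero) (eb zero) (λ i j ne → cl (suc i) (suc j) (λ q → ne (FP.suc-injective q)))
        (λ i → cl (suc i) zero (λ ())) (λ i → adj-sym G (ze (suc i))) (λ i → ey (suc i)) (λ i → eb (suc i))
      case : (∀ i → Adj G z′ (e i)) ⊎ (∃ λ i → NonAdj G z′ (e i)) → Good s G
      case (inj₁ h) = finish z′ (λ q → z≢z′ (≡-sym q)) z′≢b (λ i → adj-sym G (h i))
      case (inj₂ (j , nj)) with excess (λ i → adj G z′ i ∧ member e i) (adj G z′)
        (<-≤-trans (count-mono-< (λ i h → ∧-elimʳ {adj G z′ i} h) (e j) (member-intro e j) (cong (_∧ member e (e j)) nj))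
          (≤-trans (count-member e) hz′))
      ... | y , z′y , out = finish y (λ { refl → false≢true (nzz′ max c p) (adj-sym G z′y) }) (λ { refl → false≢true nbz′ (adj-sym G z′y) }) ey
        where
        ey : ∀ i → Adj G (e i) y
        ey i with neighbours-joined max c p (ze i) z′y
        ... | inj₁ refl = false≢true out (∧-intro z′y (member-intro e i))
        ... | inj₂ q = q
    ... | inj₁ zb = case (all-or-counterexample (λ i → adj G z′ (e i)))
      where
      listing = enumerate s (λ i → adj G z i ∧ not (i == b)) (≤-pred (subst (suc s ≤_) (≡-sym (count-remove (adj G z) b zb)) hz))
      e = proj₁ listing
      inj = proj₁ (proj₂ listing)
      ze : ∀ i → Adj G z (e i)
      ze i = ∧-elimˡ (proj₂ (proj₂ listing) i)
      e≢b : ∀ i → e i ≢ b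
      e≢b i = ==⇒≢ (not-elim (∧-elimʳ {adj G z (e i)} (proj₂ (proj₂ listing) i)))
      cl : ∀ i j → i ≢ j → Adj G (e i) (e j)
      cl i j ne = nbhd-clique (ze i) (ze j) (λ q → ne (inj q))
      eb : ∀ i → Adj G (e i) b
      eb i = nbhd-clique (ze i) zb (e≢b i)
      module _ {y} (z′y : Adj G z′ y) where
        y≢z : y ≢ z
        y≢z refl = false≢true (nzz′ max c p) (adj-sym G z′y)
        by : Adj G b y
        by with neighbours-joined max c p zb z′y
        ... | inj₁ refl = false≢true nbz′ (adj-sym G z′y)
        ... | inj₂ q = q
        ey : member e y ≡ false → ∀ i → Adj G (e i) y
        ey out i with neighbours-joined max c p (ze i) z′y
        ... | inj₁ refl = false≢true out (member-intro e i)
        ... | inj₂ q = q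
      few : ∀ j → NonAdj G z′ (e j) → suc (count (λ i → adj G z′ i ∧ member e i)) < degree G z′
      few j nj = ≤-trans (s≤s (count-mono-< (λ i h → ∧-elimʳ {adj G z′ i} h) (e j) (member-intro e j) (cong (_∧ member e (e j)) nj)))
                   (≤-trans (s≤s (count-member e)) hz′)
      case : (∀ i → Adj G z′ (e i)) ⊎ (∃ λ i → NonAdj G z′ (e i)) → Good s G
      case (inj₁ h) with excess (member e) (adj G z′) (≤-<-trans (count-member e) hz′)
      ... | y , z′y , out = good-path G s b y z z′ e (λ q → z′≢b (≡-sym q)) (y≢z z′y) z≢z′ (by z′y) (adj-sym G zb) (adj-sym G z′y) cl
              eb (ey z′y out) (λ i → adj-sym G (ze i)) (λ i → adj-sym G (h i))
      case (inj₂ (j , nj)) with excess (λ i → adj G z′ i ∧ member e i) (adj G z′) (<-trans (n<1+n _) (few j nj))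
      ... | y₁ , z′y₁ , out₁ with excess-≢ (λ i → adj G z′ i ∧ member e i) (adj G z′) y₁ (few j nj)
      ... | y₂ , z′y₂ , out₂ , y₂≢y₁ = good-star G s b z y₁ y₂ e (λ q → y≢z z′y₁ (≡-sym q)) (λ q → y≢z z′y₂ (≡-sym q)) (λ q → y₂≢y₁ (≡-sym q))
              (adj-sym G zb) (by z′y₁) (by z′y₂) cl eb (λ i → adj-sym G (ze i)) (ey z′y₁ (notIn z′y₁ out₁)) (ey z′y₂ (notIn z′y₂ out₂))
        where
        notIn : ∀ {y} → Adj G z′ y → adj G z′ y ∧ member e y ≡ false → member e y ≡ false
        notIn a h = ≢true⇒false (λ m → false≢true h (∧-intro a m))

  good-pair : ∀ {G u v a b z z′} s → Max G → Config G u v a b → Pair G a b z z′ → s < degree G z → s < degree G z′ → Good s G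
  good-pair {G} {z = z} {z′} s max c p hz hz′ with ≤-total (degree G z) (degree G z′)
  ... | inj₁ le = good-ordered max c p le s hz hz′
  ... | inj₂ le = good-ordered max (flip c) (flipPair p) le s hz′ hz

  good-config : ∀ {G u v a b} s D → Max G → Config G u v a b → degree G a ≤ D → degree G b ≤ D →
    count S + suc D < count (above s G) → Good s G
  good-config {G} {u} {v} {a} {b} s D max c da db lots =
    let (z , hz , z∉ , _) = escape a u ua su da z₀
        (z′ , hz′ , z′∉ , z′≢z) = escape b v vb sv db z
    in good-pair s max c (mkPair (sOf a u z∉) (sOf b v z′∉) (λ q → z′≢z (≡-sym q)) (neOf a u z∉) (naOf a u ua su z∉) (neOf b v z′∉) (naOf b v vb sv z′∉))
         (above-elim G hz) (above-elim G hz′)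
    where
    open Config c
    -- The first choice has no earlier vertex to avoid, so a vertex that is blocked anyway is
    -- passed.
    z₀ = a
    blocked : Fin N → Fin N → Fin N → Bool
    blocked a u i = S i ∨ ((adj G a i ∧ not (i == u)) ∨ (i == a))
    escape : ∀ a u → Adj G u a → S u ≡ true → degree G a ≤ D → ∀ z₀ →
      ∃ λ z → (above s G z ≡ true) × (blocked a u z ≡ false) × (z ≢ z₀)
    escape a u ua su da z₀ = excess-≢ (blocked a u) (above s G) z₀ (≤-<-trans (s≤s le) (subst (_< count (above s G)) (+-suc (count S) D) lots))
      where
      -- The neighbour `u` of `a` already lies in `S`; leaving it out makes up for counting `a`
      -- itself. The extra unit in `suc D` pays for avoiding one earlier choice.
      le : count (blocked a u) ≤ count S + D
      le = ≤-trans (count-∨ S _) (+-monoʳ-≤ (count S) (≤-trans (count-∨ _ (λ i → i == a))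
             (≤-trans (≤-reflexive (trans (cong (count (λ i → adj G a i ∧ not (i == u)) +_) (count-single a)) (trans (+-comm _ 1) (count-remove (adj G a) u (adj-sym G ua))))) da)))
    sOf : ∀ a u {z} → blocked a u z ≡ false → S z ≡ false
    sOf a u h = proj₁ (∨-false h)
    neOf : ∀ a u {z} → blocked a u z ≡ false → z ≢ a
    neOf a u {z} h = ==⇒≢ (proj₂ (∨-false {adj G a z ∧ not (z == u)} (proj₂ (∨-false {S z} h))))
    naOf : ∀ a u → Adj G u a → S u ≡ true → ∀ {z} → blocked a u z ≡ false → NonAdj G a z
    naOf a u ua su {z} h = ≢true⇒false (λ q → false≢true (proj₁ (∨-false {adj G a z ∧ not (z == u)} (proj₂ (∨-false {S z} h))))
      (∧-intro q (not-intro (≢⇒== (∉≢∈ (sOf a u h) su)))))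

any : (Fin k → Bool) → Bool
any {zero}  P = false
any {suc k} P = P zero ∨ any (λ a → P (suc a))

any-intro : (P : Fin k → Bool) (a : Fin k) → P a ≡ true → any P ≡ true
any-intro P zero    e = ∨-introˡ e
any-intro P (suc a) e = ∨-introʳ {P zero} (any-intro (λ a → P (suc a)) a e)

any-elim : (P : Fin k → Bool) → any P ≡ true → ∃ λ a → P a ≡ true
any-elim {suc k} P e with ∨-elim {P zero} e
... | inj₁ h = zero , h
... | inj₂ h = let (a , q) = any-elim (λ a → P (suc a)) h in suc a , q

count-image : (P : Fin k → Bool) (y : Fin k → Fin n) → count (λ i → any (λ b → P b ∧ (i == y b))) ≤ count P
count-image {zero} {n} P y = ≤-reflexive (sum-0 {n})
count-image {suc k} P y with P zero
... | false = count-image (λ a → P (suc a)) (λ a → y (suc a))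
... | true  = ≤-trans (count-∨ (λ i → i == y zero) _)
                (+-mono-≤ (≤-reflexive (count-single (y zero))) (count-image (λ a → P (suc a)) (λ a → y (suc a))))

bool-ext : ∀ {a b} → (a ≡ true → b ≡ true) → (b ≡ true → a ≡ true) → a ≡ b
bool-ext {true}  {true}  f g = refl
bool-ext {true}  {false} f g with () ← f refl
bool-ext {false} {true}  f g with () ← g refl
bool-ext {false} {false} f g = refl

-- the wanted graph is the join of a clique on X with the copy y of F₀
module Split {N k₀ : ℕ} (s D : ℕ) (G₀ : Graph N) (X : Fin N → Bool) (y : Fin k₀ → Fin N) (F₀ : Graph k₀)
  (y-inj : Injective _≡_ _≡_ y) (y∉X : ∀ a → X (y a) ≡ false) (size : count X + k₀ ≡ s + 4)
  (X-deg : ∀ x → X x ≡ true → s + 2 < degree G₀ x) where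

  S : Fin N → Bool
  S i = X i ∨ member y i

  inner : Fin N → Fin N → Bool
  inner i j = any (λ a → (i == y a) ∧ any (λ b → adj F₀ a b ∧ (j == y b)))

  W : Fin N → Fin N → Bool
  W i j = (not (i == j) ∧ ((X i ∧ S j) ∨ (S i ∧ X j))) ∨ inner i j

  inner-intro : ∀ a b → Adj F₀ a b → inner (y a) (y b) ≡ true
  inner-intro a b e = any-intro (λ a′ → (y a == y a′) ∧ any (λ b′ → adj F₀ a′ b′ ∧ (y b == y b′))) a
    (∧-intro (==-refl (y a)) (any-intro (λ b′ → adj F₀ a b′ ∧ (y b == y b′)) b (∧-intro e (==-refl (y b)))))

  inner-elim : ∀ {i j} → inner i j ≡ true → ∃ λ a → ∃ λ b → i ≡ y a × j ≡ y b × Adj F₀ a b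
  inner-elim {i} {j} h with any-elim (λ a → (i == y a) ∧ any (λ b → adj F₀ a b ∧ (j == y b))) h
  ... | a , q with any-elim (λ b → adj F₀ a b ∧ (j == y b)) (∧-elimʳ {i == y a} q)
  ... | b , r = a , b , ==⇒≡ (∧-elimˡ q) , ==⇒≡ (∧-elimʳ {adj F₀ a b} r) , ∧-elimˡ r

  W-XS : ∀ {x v} → X x ≡ true → S v ≡ true → x ≢ v → W x v ≡ true
  W-XS {x} {v} p q ne = ∨-introˡ (∧-intro (not-intro (≢⇒== ne)) (∨-introˡ (∧-intro p q)))

  W-SX : ∀ {v x} → S v ≡ true → X x ≡ true → v ≢ x → W v x ≡ true
  W-SX {v} {x} q p ne = ∨-introˡ (∧-intro (not-intro (≢⇒== ne)) (∨-introʳ {X v ∧ S x} (∧-intro q p)))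

  W-inner : ∀ a b → Adj F₀ a b → W (y a) (y b) ≡ true
  W-inner a b e = ∨-introʳ {not (y a == y b) ∧ ((X (y a) ∧ S (y b)) ∨ (S (y a) ∧ X (y b)))} (inner-intro a b e)

  data WView (i j : Fin N) : Set where
    xs : X i ≡ true → S j ≡ true → i ≢ j → WView i j
    sx : S i ≡ true → X j ≡ true → i ≢ j → WView i j
    inn : ∀ a b → i ≡ y a → j ≡ y b → Adj F₀ a b → WView i j

  W-view : ∀ {i j} → W i j ≡ true → WView i j
  W-view {i} {j} h with ∨-elim {not (i == j) ∧ ((X i ∧ S j) ∨ (S i ∧ X j))} h
  ... | inj₂ q = let (a , b , r , t , e) = inner-elim q in inn a b r t e
  ... | inj₁ q with ∨-elim {X i ∧ S j} (∧-elimʳ {not (i == j)} q)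
  ... | inj₁ r = xs (∧-elimˡ r) (∧-elimʳ {X i} r) (==⇒≢ (not-elim (∧-elimˡ q)))
  ... | inj₂ r = sx (∧-elimˡ r) (∧-elimʳ {S i} r) (==⇒≢ (not-elim (∧-elimˡ q)))

  S-y : ∀ a → S (y a) ≡ true
  S-y a = ∨-introʳ {X (y a)} (member-intro y a)

  W-flip : ∀ {i j} → W i j ≡ true → W j i ≡ true
  W-flip h with W-view h
  ... | xs p q ne = W-SX q p (λ e → ne (≡-sym e))
  ... | sx p q ne = W-XS q p (λ e → ne (≡-sym e))
  ... | inn a b refl refl e = W-inner b a (adj-sym F₀ e)

  W-sym : ∀ i j → W i j ≡ W j i
  W-sym i j = bool-ext W-flip W-flip

  W-irr : ∀ i → W i i ≡ false
  W-irr i = ≢true⇒false case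
    where case : W i i ≡ true → ⊥
          case h with W-view h
          ... | xs _ _ ne = ne refl
          ... | sx _ _ ne = ne refl
          ... | inn a b refl q e = adj⇒≢ F₀ e (y-inj q)

  W-supp : ∀ {i j} → W i j ≡ true → S i ≡ true
  W-supp h with W-view h
  ... | xs p _ _ = ∨-introˡ p
  ... | sx p _ _ = p
  ... | inn a b refl _ _ = S-y a

  open Stuck W W-sym W-irr S W-supp public

  count-S : count S ≤ s + 4
  count-S = ≤-trans (count-∨ X (member y)) (≤-trans (+-monoʳ-≤ (count X) (count-member y)) (≤-reflexive size))

  Saturated : Graph N → Fin N → Set
  Saturated G u = ∀ v → Adj G u v → W u v ≡ true

  saturated? : (G : Graph N) (u : Fin N) → Saturated G u ⊎ ∃ λ a → Adj G u a × W u a ≡ false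
  saturated? G u with all-or-counterexample (λ a → not (adj G u a) ∨ W u a)
  ... | inj₁ h = inj₁ (λ v e → case v e (∨-elim {not (adj G u v)} (h v)))
    where case : ∀ v → Adj G u v → (not (adj G u v) ≡ true) ⊎ (W u v ≡ true) → W u v ≡ true
          case v e (inj₁ q) = false≢true (not-elim q) e
          case v e (inj₂ q) = q
  ... | inj₂ (a , h) = let (p , q) = ∨-false {not (adj G u a)} h in inj₂ (a , ≢false⇒true (λ e → false≢true p (not-intro e)) , q)

  count-Wy : ∀ a → count (W (y a)) ≤ count X + degree F₀ a
  count-Wy a = ≤-trans (count-mono sub) (≤-trans (count-∨ X _) (+-monoʳ-≤ (count X) (count-image (adj F₀ a) y)))
    where
    sub : W (y a) ⊑ (λ i → X i ∨ any (λ b → adj F₀ a b ∧ (i == y b)))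
    sub i h with W-view h
    ... | xs p _ _ = false≢true (y∉X a) p
    ... | sx _ p _ = ∨-introˡ p
    ... | inn a′ b q refl e = ∨-introʳ {X i} (any-intro _ b (∧-intro (subst (λ c → Adj F₀ c b) (≡-sym (y-inj q)) e) (==-refl (y b))))

  module Settled (G : Graph N) (eq : G ~ G₀) where

    -- A saturated `x` has all its neighbours in `S` without `x` and `v`, hence at most `s + 2` of
    -- them, too few for a vertex of `X`.
    X-unsaturated : ∀ {x v} → X x ≡ true → S v ≡ true → x ≢ v → NonAdj G x v → Saturated G x → ⊥
    X-unsaturated {x} {v} px sv ne nxv sat = <⇒≱ (≤-trans (s≤s (X-deg x px)) (s≤s (≤-reflexive (≡-sym (eq x)))))
        (≤-pred (≤-pred (≤-trans (s≤s (s≤s (s≤s (count-mono sub)))) (≤-trans (s≤s (≤-reflexive eq₂)) (≤-trans (s≤s count-S) (≤-reflexive (cong suc (trans (+-suc s 3) (cong suc (+-suc s 2))))))))))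
      where
      sub : adj G x ⊑ (λ i → (S i ∧ not (i == x)) ∧ not (i == v))
      sub i e = ∧-intro (∧-intro (W-supp (W-flip (sat i e))) (not-intro (≢⇒== (λ q → adj⇒≢ G e (≡-sym q)))))
                        (not-intro (≢⇒== (λ { refl → false≢true nxv e })))
      eq₂ : suc (suc (count (λ i → (S i ∧ not (i == x)) ∧ not (i == v)))) ≡ count S
      eq₂ = trans (cong suc (count-remove (λ i → S i ∧ not (i == x)) v (∧-intro sv (not-intro (≢⇒== (λ q → ne (≡-sym q)))))))
                  (count-remove S x (∨-introˡ px))

    y-deficient : ∀ {a v} → W (y a) v ≡ true → NonAdj G (y a) v → Saturated G (y a) → degree G₀ (y a) < count X + degree F₀ a
    y-deficient {a} {v} w nv sat = subst (_< count X + degree F₀ a) (eq (y a)) (<-≤-trans (count-mono-< sat v w nv) (count-Wy a))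

    module _ (small : ∀ v → X v ≡ false → degree G₀ v ≤ D) (lots : s + 4 + suc D < count (above s G₀))
             (max : Max G) (bad : ¬ Good s G) where

      -- Every edge from `S` to `X` is wanted, so an unwanted neighbour lies outside `X`.
      unwanted-small : ∀ {u a} → S u ≡ true → Adj G u a → W u a ≡ false → degree G a ≤ D
      unwanted-small {u} {a} su e w = subst (_≤ D) (≡-sym (eq a)) (small a (≢true⇒false (λ xa → false≢true w (W-SX su xa (adj⇒≢ G e)))))

      -- A missing wanted edge with an unwanted edge at either end is a `Config`, and `good-config`
      -- would produce one of the joins.
      settled : ∀ {u v} → W u v ≡ true → Adj G u v ⊎ Saturated G u ⊎ Saturated G v
      settled {u} {v} w with true? (adj G u v) | saturated? G u | saturated? G v
      ... | inj₁ e | _ | _ = inj₁ e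
      ... | inj₂ _ | inj₁ h | _ = inj₂ (inj₁ h)
      ... | inj₂ _ | inj₂ _ | inj₁ h = inj₂ (inj₂ h)
      ... | inj₂ e | inj₂ (a , ua , wa) | inj₂ (b , vb , wb) =
        ⊥-elim (bad (good-config {G} s D max (config w e ua wa vb wb) (unwanted-small (W-supp w) ua wa) (unwanted-small (W-supp (W-flip w)) vb wb)
          (≤-<-trans (+-monoˡ-≤ (suc D) count-S) (subst (s + 4 + suc D <_) (count-cong (λ i → cong (s <ᵇ_) (≡-sym (eq i)))) lots))))

      X-clique : ∀ {x x′} → X x ≡ true → X x′ ≡ true → x ≢ x′ → Adj G x x′
      X-clique {x} {x′} p q ne = ≢false⇒true λ nxx → case nxx (settled (W-XS p (∨-introˡ q) ne))
        where
        case : NonAdj G x x′ → Adj G x x′ ⊎ Saturated G x ⊎ Saturated G x′ → ⊥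
        case n (inj₁ e) = false≢true n e
        case n (inj₂ (inj₁ h)) = X-unsaturated p (∨-introˡ q) ne n h
        case n (inj₂ (inj₂ h)) = X-unsaturated q (∨-introˡ p) (λ e → ne (≡-sym e)) (nonadj-sym G n) h

      X-join : ∀ {x} a → X x ≡ true → Adj G x (y a) ⊎ (Saturated G (y a) × NonAdj G (y a) x)
      X-join {x} a p with true? (adj G x (y a))
      ... | inj₁ e = inj₁ e
      ... | inj₂ n with settled (W-XS p (S-y a) (λ { refl → false≢true (y∉X a) p }))
      ...   | inj₁ e = inj₁ e
      ...   | inj₂ (inj₁ h) = ⊥-elim (X-unsaturated p (S-y a) (λ { refl → false≢true (y∉X a) p }) n h)
      ...   | inj₂ (inj₂ h) = inj₂ (h , nonadj-sym G n)

      -- `rich` rules out a saturated `y a` with a missing wanted edge: its degree would be smaller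
      -- than the number of its wanted edges.
      module _ (rich : ∀ a → count X + degree F₀ a ≤ degree G₀ (y a)) where

        full-join : ∀ {x} a → X x ≡ true → Adj G x (y a)
        full-join {x} a p with X-join a p
        ... | inj₁ e = e
        ... | inj₂ (h , n) = ⊥-elim (<⇒≱ (y-deficient {a} {x} (W-SX (S-y a) p (λ { refl → false≢true (y∉X a) p })) n h) (rich a))

        full-inner : ∀ a b → Adj F₀ a b → Adj G (y a) (y b)
        full-inner a b e = ≢false⇒true λ n → case n (settled (W-inner a b e))
          where
          case : NonAdj G (y a) (y b) → Adj G (y a) (y b) ⊎ Saturated G (y a) ⊎ Saturated G (y b) → ⊥
          case n (inj₁ q) = false≢true n q
          case n (inj₂ (inj₁ h)) = <⇒≱ (y-deficient (W-inner a b e) n h) (rich a)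
          case n (inj₂ (inj₂ h)) = <⇒≱ (y-deficient (W-flip (W-inner a b e)) (nonadj-sym G n) h) (rich b)

        copy : ContainsSubgraph G F₀
        copy = y , y-inj , full-inner

-- Few vertices of large degree

-- The two vertices of `P` are put first because they take the places of largest degree in `P₃` or
-- `K₂₃`.
enumerate-two : ∀ b (P Q : Fin n → Bool) → P ⊑ Q → 2 ≤ count P → 2 + b ≤ count Q →
  Σ (Fin (2 + b) → Fin n) λ y → Injective _≡_ _≡_ y × P (y zero) ≡ true × P (y (suc zero)) ≡ true × (∀ a → Q (y a) ≡ true)
enumerate-two {n} b P Q PQ two many = y , inj , p∈ zero , p∈ (suc zero) , y∈
  where
  listing = enumerate 2 P two
  p : Fin 2 → Fin n
  p = proj₁ listing
  p-inj : Injective _≡_ _≡_ p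
  p-inj = proj₁ (proj₂ listing)
  p∈ : ∀ a → P (p a) ≡ true
  p∈ = proj₂ (proj₂ listing)
  R : Fin n → Bool
  R i = Q i ∧ not (member p i)
  enough : b ≤ count R
  enough = +-cancelˡ-≤ 2 b (count R) (≤-trans many (≤-trans (≤-reflexive (count-split Q (member p)))
    (+-monoˡ-≤ (count R) (≤-trans (count-mono (λ i h → ∧-elimʳ {Q i} h)) (count-member p)))))
  rest = enumerate b R enough
  q : Fin b → Fin n
  q = proj₁ rest
  q≢p : ∀ i a → q i ≢ p a
  q≢p i a e = false≢true (not-elim (∧-elimʳ {Q (q i)} (proj₂ (proj₂ rest) i))) (subst (λ j → member p j ≡ true) (≡-sym e) (member-intro p a))
  y : Fin (2 + b) → Fin n
  y zero          = p zero
  y (suc zero)    = p (suc zero)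
  y (suc (suc i)) = q i
  inj : Injective _≡_ _≡_ y
  inj {zero}        {zero}        e = refl
  inj {zero}        {suc zero}    e = ⊥-elim (FP.0≢1+n (p-inj e))
  inj {zero}        {suc (suc j)} e = ⊥-elim (q≢p j zero (≡-sym e))
  inj {suc zero}    {zero}        e = ⊥-elim (FP.0≢1+n (≡-sym (p-inj e)))
  inj {suc zero}    {suc zero}    e = refl
  inj {suc zero}    {suc (suc j)} e = ⊥-elim (q≢p j (suc zero) (≡-sym e))
  inj {suc (suc i)} {zero}        e = ⊥-elim (q≢p i zero e)
  inj {suc (suc i)} {suc zero}    e = ⊥-elim (q≢p i (suc zero) e)
  inj {suc (suc i)} {suc (suc j)} e = cong (λ a → suc (suc a)) (proj₁ (proj₂ rest) e)
  y∈ : ∀ a → Q (y a) ≡ true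
  y∈ zero          = PQ _ (p∈ zero)
  y∈ (suc zero)    = PQ _ (p∈ (suc zero))
  y∈ (suc (suc i)) = ∧-elimˡ (proj₂ (proj₂ rest) i)

private
  1+s : ∀ s → suc s ≡ s + 1
  1+s s = +-comm 1 s
  2+s : ∀ s → suc (suc s) ≡ s + 2
  2+s s = +-comm 2 s
  3+s : ∀ s → suc (suc (suc s)) ≡ s + 3
  3+s s = +-comm 3 s

-- Completing a clique to one of the joins

module CliqueSet {N : ℕ} (s : ℕ) (G : Graph N) (X : Fin N → Bool)
  (cl : ∀ {x x′} → X x ≡ true → X x′ ≡ true → x ≢ x′ → Adj G x x′) where

  private
    ≢-mem : ∀ {j} (e : Fin j → Fin N) {x} → member e x ≡ false → ∀ i → e i ≢ x
    ≢-mem e out i refl = false≢true out (member-intro e i)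

    ∉X : ∀ {y x} → X y ≡ false → X x ≡ true → y ≢ x
    ∉X p q refl = false≢true p q

  star-in : ∀ (e : Fin (suc s) → Fin N) → Injective _≡_ _≡_ e → (∀ i → X (e i) ≡ true) → ∀ u₁ u₂ u₃ →
    u₁ ≢ u₂ → u₁ ≢ u₃ → u₂ ≢ u₃ → (∀ i → Adj G (e i) u₁) → (∀ i → Adj G (e i) u₂) → (∀ i → Adj G (e i) u₃) → Good s G
  star-in e inj e∈ u₁ u₂ u₃ n₁₂ n₁₃ n₂₃ a₁ a₂ a₃ =
    good-star G s (e zero) u₁ u₂ u₃ (λ i → e (suc i)) n₁₂ n₁₃ n₂₃ (a₁ zero) (a₂ zero) (a₃ zero)
      (λ i j ne → ecl (suc i) (suc j) (λ q → ne (FP.suc-injective q))) (λ i → ecl (suc i) zero (λ ()))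
      (λ i → a₁ (suc i)) (λ i → a₂ (suc i)) (λ i → a₃ (suc i))
    where
    ecl : ∀ i j → i ≢ j → Adj G (e i) (e j)
    ecl i j ne = cl (e∈ i) (e∈ j) (λ q → ne (inj q))

  good-0 : count X ≡ s + 4 → Good s G
  good-0 e with enumerate (suc (suc (suc (suc s)))) X (≤-reflexive (trans (+-comm 4 s) (≡-sym e)))
  ... | x , inj , x∈ = star-in (λ i → x (suc (suc (suc i)))) (λ q → FP.suc-injective (FP.suc-injective (FP.suc-injective (inj q))))
      (λ i → x∈ (suc (suc (suc i)))) (x zero) (x (suc zero)) (x (suc (suc zero)))
      (λ q → FP.0≢1+n (inj q)) (λ q → FP.0≢1+n (inj q)) (λ q → FP.0≢1+n (FP.suc-injective (inj q)))
      (λ i → ecl _ _ (λ ())) (λ i → ecl _ _ (λ ())) (λ i → ecl _ _ (λ ()))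
    where
    ecl : ∀ i j → i ≢ j → Adj G (x i) (x j)
    ecl i j ne = cl (x∈ i) (x∈ j) (λ q → ne (inj q))

  good-1 : count X ≡ s + 3 → ∀ y → X y ≡ false → s < count (λ i → X i ∧ adj G y i) → Good s G
  good-1 c y y∉ big with enumerate (suc s) (λ i → X i ∧ adj G y i) big
  ... | e , inj , e∈ with excess (member e) X (≤-<-trans (count-member e) (≤-trans (n≤1+n _) (≤-reflexive (trans (3+s s) (≡-sym c)))))
  ... | x₁ , x₁∈ , out₁ with excess-≢ (member e) X x₁ (≤-<-trans (s≤s (count-member e)) (≤-reflexive (trans (3+s s) (≡-sym c))))
  ... | x₂ , x₂∈ , out₂ , ne = star-in e inj (λ i → ∧-elimˡ (e∈ i)) y x₁ x₂ (∉X y∉ x₁∈) (∉X y∉ x₂∈) (λ q → ne (≡-sym q))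
      (λ i → adj-sym G (∧-elimʳ {X (e i)} (e∈ i))) (λ i → cl (∧-elimˡ (e∈ i)) x₁∈ (≢-mem e out₁ i)) (λ i → cl (∧-elimˡ (e∈ i)) x₂∈ (≢-mem e out₂ i))

  -- Two subsets with at least `s + 1` elements of a set of size `s + 2` share at least `s`. If they
  -- share more, a common neighbour is the centre of a star with leaves `y`, `z` and another clique
  -- vertex. Otherwise the `s` common neighbours dominate a path from `y` to `z` through one private
  -- neighbour of each.
  good-2 : count X ≡ s + 2 → ∀ y z → X y ≡ false → X z ≡ false → y ≢ z →
    s < count (λ i → X i ∧ adj G y i) → s < count (λ i → X i ∧ adj G z i) → Good s G
  good-2 c y z y∉ z∉ y≢z bigy bigz with s <? count P
    where P = λ i → (X i ∧ adj G y i) ∧ adj G z i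
  ... | yes big with enumerate (suc s) (λ i → (X i ∧ adj G y i) ∧ adj G z i) big
  ...   | e , inj , e∈ with excess (member e) X (≤-<-trans (count-member e) (≤-reflexive (trans (2+s s) (≡-sym c))))
  ...   | x₁ , x₁∈ , out₁ = star-in e inj e∈X y z x₁ y≢z (∉X y∉ x₁∈) (∉X z∉ x₁∈)
      (λ i → adj-sym G (∧-elimʳ {X (e i)} (∧-elimˡ (e∈ i)))) (λ i → adj-sym G (∧-elimʳ {X (e i) ∧ adj G y (e i)} (e∈ i)))
      (λ i → cl (e∈X i) x₁∈ (≢-mem e out₁ i))
    where e∈X : ∀ i → X (e i) ≡ true
          e∈X i = ∧-elimˡ {X (e i)} (∧-elimˡ (e∈ i))
  good-2 c y z y∉ z∉ y≢z bigy bigz | no few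
    with excess (λ i → (X i ∧ adj G y i) ∧ adj G z i) (λ i → X i ∧ adj G z i) (≤-<-trans (≮⇒≥ few) bigz)
       | excess (λ i → (X i ∧ adj G y i) ∧ adj G z i) (λ i → X i ∧ adj G y i) (≤-<-trans (≮⇒≥ few) bigy)
       | enumerate s (λ i → (X i ∧ adj G y i) ∧ adj G z i) enough
    where
    enough : s ≤ count (λ i → (X i ∧ adj G y i) ∧ adj G z i)
    enough = ≤-pred (+-cancelʳ-≤ (suc s) (suc s) _ (≤-trans (+-mono-≤ bigy bigz) (≤-trans (≤-reflexive total) (≤-trans (+-monoʳ-≤ A atMost) (≤-reflexive alg)))))
      where
      A B : ℕ
      A = count (λ i → (X i ∧ adj G y i) ∧ adj G z i)
      B = count (λ i → (X i ∧ adj G y i) ∧ not (adj G z i))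
      C : ℕ
      C = count (λ i → X i ∧ adj G z i)
      total : count (λ i → X i ∧ adj G y i) + C ≡ A + (B + C)
      total = trans (cong (_+ C) (count-split (λ i → X i ∧ adj G y i) (adj G z))) (+-assoc A B C)
      atMost : B + C ≤ s + 2
      atMost = ≤-trans (+-monoˡ-≤ C (count-mono (λ i h → ∧-intro (∧-elimˡ {X i} (∧-elimˡ h)) (∧-elimʳ {X i ∧ adj G y i} h))))
                 (≤-reflexive (trans (+-comm _ C) (trans (≡-sym (count-split X (adj G z))) c)))
      alg : A + (s + 2) ≡ suc A + suc s
      alg = solve 2 (λ A s → A :+ (s :+ con 2) := con 1 :+ A :+ (con 1 :+ s)) refl A s
        where open +-*-Solver
  ... | x₀ , q₀ , out₀ | x₁ , q₁ , out₁ | e , inj , e∈ =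
    good-path G s x₁ x₀ y z e (λ q → ∉X z∉ (∧-elimˡ q₁) (≡-sym q)) (λ q → ∉X y∉ (∧-elimˡ q₀) (≡-sym q)) y≢z
      (cl (∧-elimˡ q₁) (∧-elimˡ q₀) (λ { refl → n₀ (∧-elimʳ {X x₁} q₁) })) (adj-sym G (∧-elimʳ {X x₁} q₁)) (adj-sym G (∧-elimʳ {X x₀} q₀))
      (λ i j ne → cl (e∈X i) (e∈X j) (λ q → ne (inj q)))
      (λ i → cl (e∈X i) (∧-elimˡ q₁) (λ { refl → n₁ (ez i) })) (λ i → cl (e∈X i) (∧-elimˡ q₀) (λ { refl → n₀ (ey i) }))
      (λ i → adj-sym G (ey i)) (λ i → adj-sym G (ez i))
    where
    e∈X : ∀ i → X (e i) ≡ true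
    e∈X i = ∧-elimˡ {X (e i)} (∧-elimˡ (e∈ i))
    ey : ∀ i → Adj G y (e i)
    ey i = ∧-elimʳ {X (e i)} (∧-elimˡ (e∈ i))
    ez : ∀ i → Adj G z (e i)
    ez i = ∧-elimʳ {X (e i) ∧ adj G y (e i)} (e∈ i)
    n₀ : Adj G y x₀ → ⊥
    n₀ h = false≢true out₀ (∧-intro (∧-intro (∧-elimˡ {X x₀} q₀) h) (∧-elimʳ {X x₀} q₀))
    n₁ : Adj G z x₁ → ⊥
    n₁ h = false≢true out₁ (∧-intro q₁ h)

  good-3 : count X ≡ s + 1 → ∀ (y : Fin 3 → Fin N) → Injective _≡_ _≡_ y →
    (∀ a → s < count (λ i → X i ∧ adj G (y a) i)) → Good s G
  good-3 c y y-inj big with enumerate (suc s) X (≤-reflexive (trans (1+s s) (≡-sym c)))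
  ... | e , inj , e∈ = star-in e inj e∈ (y zero) (y (suc zero)) (y (suc (suc zero)))
      (λ q → FP.0≢1+n (y-inj q)) (λ q → FP.0≢1+n (y-inj q)) (λ q → FP.0≢1+n (FP.suc-injective (y-inj q)))
      (to zero) (to (suc zero)) (to (suc (suc zero)))
    where
    to : ∀ a i → Adj G (e i) (y a)
    to a i = adj-sym G (≢false⇒true λ n → <⇒≱ (<-≤-trans (count-mono-< (λ j h → ∧-elimˡ h) (e i) (e∈ i)
      (≢true⇒false (λ h → false≢true n (∧-elimʳ {X (e i)} h)))) (≤-reflexive (trans c (≡-sym (1+s s))))) (big a))

NoGood : ℕ → Graph n → Set
NoGood s G₀ = ∀ G → G ~ G₀ → ¬ Good s G

module FewLarge {N : ℕ} (s : ℕ) (G₀ : Graph N) (bad : NoGood s G₀) (lots : 2 * s + 8 ≤ count (above s G₀)) where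

  X Y : Fin N → Bool
  X = above (s + 2) G₀
  Y i = above s G₀ i ∧ not (X i)

  X-deg : ∀ x → X x ≡ true → s + 2 < degree G₀ x
  X-deg x = above-elim G₀

  small : ∀ v → X v ≡ false → degree G₀ v ≤ s + 2
  small v = above-false G₀

  -- The origin of `2s + 8`: `good-config` needs more than `(s + 4) + (s + 3)` vertices above `s`
  -- when `S` has `s + 4` vertices and the degrees outside `X` are at most `D = s + 2`.
  lots′ : s + 4 + suc (s + 2) < count (above s G₀)
  lots′ = ≤-trans (≤-reflexive (solve 1 (λ s → con 1 :+ (s :+ con 4 :+ (con 1 :+ (s :+ con 2))) := con 2 :* s :+ con 8) refl s)) lots
    where open +-*-Solver

  count-Y : ∀ τ k → count X ≡ τ → τ + k ≤ 2 * s + 8 → k ≤ count Y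
  count-Y τ k e le = +-cancelˡ-≤ τ k (count Y) (≤-trans le (≤-trans lots (≤-trans (≤-reflexive (count-split (above s G₀) X))
    (+-monoˡ-≤ (count Y) (≤-trans (count-mono (λ i h → ∧-elimʳ {above s G₀ i} h)) (≤-reflexive e))))))

  Y-deg : ∀ {i} → Y i ≡ true → s < degree G₀ i
  Y-deg h = above-elim G₀ (∧-elimˡ h)

  Y∉X : ∀ {i} → Y i ≡ true → X i ≡ false
  Y∉X {i} h = not-elim (∧-elimʳ {above s G₀ i} h)

  module _ {k₀ : ℕ} (F₀ : Graph k₀) (y : Fin k₀ → Fin N) (y-inj : Injective _≡_ _≡_ y) (y∈ : ∀ a → Y (y a) ≡ true)
           (size : count X + k₀ ≡ s + 4) where

    open Split s (s + 2) G₀ X y F₀ y-inj (λ a → Y∉X (y∈ a)) size X-deg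

    listing : ∀ G → G ~ G₀ → Max G → Σ (Fin (count X) → Fin N) λ e → IsClique G e × Injective _≡_ _≡_ e × (∀ i → X (e i) ≡ true)
    listing G eq max = let (e , inj , e∈) = enumerate (count X) X ≤-refl in
      e , (λ i j ne → Settled.X-clique G eq small lots′ max (bad G eq) (e∈ i) (e∈ j) (λ q → ne (inj q))) , inj , e∈

    -- When `X` has at most `s` vertices, the part of the target outside the clique has to be built
    -- from vertices outside `X`; they have enough degree for all their wanted edges, so the whole
    -- wanted graph appears.
    few-full : ∀ {t} → Target t F₀ → count X + t ≡ s → (∀ a → count X + degree F₀ a ≤ degree G₀ (y a)) → ⊥
    few-full t e rich = maximise G₀ λ G eq max → let (x , cl , _ , x∈) = listing G eq max in
      bad G eq (subst (λ u → Good u G) e (cones G (count X) t (Settled.copy G eq small lots′ max (bad G eq) rich) x cl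
        (λ i a → Settled.full-join G eq small lots′ max (bad G eq) rich a (x∈ i))))

  module _ {k₀ : ℕ} (y : Fin k₀ → Fin N) (y-inj : Injective _≡_ _≡_ y) (y∈ : ∀ a → Y (y a) ≡ true)
           (size : count X + k₀ ≡ s + 4) where

    open Split s (s + 2) G₀ X y (Edgeless k₀) y-inj (λ a → Y∉X (y∈ a)) size X-deg

    -- A vertex `y a` either sees all of `X`, which has more than `s` elements, or is saturated. In
    -- the second case all of its more than `s` neighbours lie in `X`, because the inner graph has
    -- no edges.
    common : ∀ G → G ~ G₀ → Max G → s < count X → ∀ a → s < count (λ i → X i ∧ adj G (y a) i)
    common G eq max big a with all-or-counterexample (λ i → not (X i) ∨ adj G (y a) i)
    ... | inj₁ h = ≤-trans big (count-mono (λ i xi → ∧-intro xi (case i xi (∨-elim {not (X i)} (h i)))))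
      where case : ∀ i → X i ≡ true → (not (X i) ≡ true) ⊎ Adj G (y a) i → Adj G (y a) i
            case i xi (inj₁ q) = false≢true (not-elim q) xi
            case i xi (inj₂ q) = q
    ... | inj₂ (x , h) = case (Settled.X-join G eq small lots′ max (bad G eq) a x∈)
      where
      x∈ : X x ≡ true
      x∈ = ≢false⇒true (λ e → false≢true (proj₁ (∨-false {not (X x)} h)) (not-intro e))
      sub : Saturated G (y a) → adj G (y a) ⊑ (λ i → X i ∧ adj G (y a) i)
      sub sat i e with W-view (sat i e)
      ... | xs p _ _ = false≢true (Y∉X (y∈ a)) p
      ... | sx _ p _ = ∧-intro p e
      case : Adj G x (y a) ⊎ (Saturated G (y a) × NonAdj G (y a) x) → s < count (λ i → X i ∧ adj G (y a) i)
      case (inj₁ e) = false≢true (proj₂ (∨-false {not (X x)} h)) (adj-sym G e)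
      case (inj₂ (sat , _)) = ≤-trans (Y-deg (y∈ a)) (≤-trans (≤-reflexive (≡-sym (eq (y a)))) (count-mono (sub sat)))

    X-cl : ∀ G → G ~ G₀ → Max G → ∀ {x x′} → X x ≡ true → X x′ ≡ true → x ≢ x′ → Adj G x x′
    X-cl G eq max = Settled.X-clique G eq small lots′ max (bad G eq)

    edgeless-split : s < count X → (∀ G → G ~ G₀ → (∀ {x x′} → X x ≡ true → X x′ ≡ true → x ≢ x′ → Adj G x x′) →
      (∀ a → s < count (λ i → X i ∧ adj G (y a) i)) → ⊥) → ⊥
    edgeless-split big k = maximise G₀ (λ G eq max → k G eq (X-cl G eq max) (common G eq max big))

  choose : ∀ τ k → count X ≡ τ → τ + k ≤ 2 * s + 8 → Σ (Fin k → Fin N) λ y → Injective _≡_ _≡_ y × (∀ a → Y (y a) ≡ true)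
  choose τ k e le = enumerate k Y (count-Y τ k e le)

  private
    room : s + 4 ≤ 2 * s + 8
    room = ≤-trans (m≤n+m (s + 4) (s + 4)) (≤-reflexive (solve 1 (λ s → (s :+ con 4) :+ (s :+ con 4) := con 2 :* s :+ con 8) refl s))
      where open +-*-Solver

    room′ : ∀ {t} → t ≡ s + 4 → t ≤ 2 * s + 8
    room′ e = ≤-trans (≤-reflexive e) room

  τ=s+3 : count X ≡ s + 3 → ⊥
  τ=s+3 e with choose (s + 3) 1 e (room′ (+-assoc s 3 1))
  ... | y , inj , y∈ = edgeless-split y inj y∈ (trans (cong (_+ 1) e) (+-assoc s 3 1)) (≤-trans (m≤m+n (suc s) 2) (≤-reflexive (trans (≡-sym (+-suc s 2)) (≡-sym e))))
      λ G eq cl big → bad G eq (CliqueSet.good-1 s G X cl e (y zero) (Y∉X (y∈ zero)) (big zero))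

  τ=s+2 : count X ≡ s + 2 → ⊥
  τ=s+2 e with choose (s + 2) 2 e (room′ (+-assoc s 2 2))
  ... | y , inj , y∈ = edgeless-split y inj y∈ (trans (cong (_+ 2) e) (+-assoc s 2 2)) (≤-trans (m≤m+n (suc s) 1) (≤-reflexive (trans (≡-sym (+-suc s 1)) (≡-sym e))))
      λ G eq cl big → bad G eq (CliqueSet.good-2 s G X cl e (y zero) (y (suc zero)) (Y∉X (y∈ zero)) (Y∉X (y∈ (suc zero)))
        (λ q → FP.0≢1+n (inj q)) (big zero) (big (suc zero)))

  τ=s+1 : count X ≡ s + 1 → ⊥
  τ=s+1 e with choose (s + 1) 3 e (room′ (+-assoc s 1 3))
  ... | y , inj , y∈ = edgeless-split y inj y∈ (trans (cong (_+ 3) e) (+-assoc s 1 3)) (≤-reflexive (trans (1+s s) (≡-sym e)))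
      λ G eq cl big → bad G eq (CliqueSet.good-3 s G X cl e y inj big)

  module _ (two : 2 ≤ count (λ i → above (s + 1) G₀ i ∧ not (X i))) where

    private
      mid⊑ : (λ i → above (s + 1) G₀ i ∧ not (X i)) ⊑ Y
      mid⊑ i h = ∧-intro (above-intro G₀ (≤-<-trans (m≤m+n s 1) (above-elim G₀ (∧-elimˡ h)))) (∧-elimʳ {above (s + 1) G₀ i} h)

      mid-deg : ∀ {i} → (above (s + 1) G₀ i ∧ not (X i)) ≡ true → s + 2 ≤ degree G₀ i
      mid-deg h = ≤-trans (≤-reflexive (+-suc s 1)) (above-elim G₀ (∧-elimˡ h))

      Y-deg′ : ∀ {i} → Y i ≡ true → s + 1 ≤ degree G₀ i
      Y-deg′ h = ≤-trans (≤-reflexive (≡-sym (1+s s))) (Y-deg h)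

    -- The two vertices of degree exactly `s + 2` become the inner vertices of the path; its ends
    -- make do with degree `s + 1`.
    τ=s : count X ≡ s → ⊥
    τ=s e with enumerate-two 2 _ Y mid⊑ two (count-Y s 4 e room)
    ... | y , inj , y₀ , y₁ , y∈ = few-full P₃ y inj y∈ (cong (_+ 4) e) path (trans (+-identityʳ (count X)) e)
        λ { zero → ≤-trans (≤-reflexive (cong (_+ 2) e)) (mid-deg y₀) ; (suc zero) → ≤-trans (≤-reflexive (cong (_+ 2) e)) (mid-deg y₁)
          ; (suc (suc zero)) → ≤-trans (≤-reflexive (cong (_+ 1) e)) (Y-deg′ (y∈ (suc (suc zero))))
          ; (suc (suc (suc zero))) → ≤-trans (≤-reflexive (cong (_+ 1) e)) (Y-deg′ (y∈ (suc (suc (suc zero))))) }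

    -- With `s - 1` dominating vertices, the smaller side of `K₂₃` requires degree
    -- `(s - 1) + 3 = s + 2` and the larger side `(s - 1) + 2 = s + 1`. These are just the degrees
    -- at hand.
    τ+1=s : count X + 1 ≡ s → ⊥
    τ+1=s e with enumerate-two 3 _ Y mid⊑ two (count-Y (count X) 5 refl (room′ size))
      where size : count X + 5 ≡ s + 4
            size = trans (≡-sym (+-assoc (count X) 1 4)) (cong (_+ 4) e)
    ... | y , inj , y₀ , y₁ , y∈ = few-full K₂₃ y inj y∈ size k23 e
        λ { zero → ≤-trans three (mid-deg y₀) ; (suc zero) → ≤-trans three (mid-deg y₁)
          ; (suc (suc zero)) → ≤-trans two′ (Y-deg′ (y∈ (suc (suc zero))))
          ; (suc (suc (suc zero))) → ≤-trans two′ (Y-deg′ (y∈ (suc (suc (suc zero)))))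
          ; (suc (suc (suc (suc zero)))) → ≤-trans two′ (Y-deg′ (y∈ (suc (suc (suc (suc zero)))))) }
      where
      size : count X + 5 ≡ s + 4
      size = trans (≡-sym (+-assoc (count X) 1 4)) (cong (_+ 4) e)
      three : count X + 3 ≤ s + 2
      three = ≤-reflexive (trans (≡-sym (+-assoc (count X) 1 2)) (cong (_+ 2) e))
      two′ : count X + 2 ≤ s + 1
      two′ = ≤-reflexive (trans (≡-sym (+-assoc (count X) 1 1)) (cong (_+ 1) e))

-- Degree sums

sum-weights₂ : (f : Fin n → ℕ) (P Q : Fin n → Bool) (c d : ℕ) →
  sumF (λ i → f i + (weight (P i) c + weight (Q i) d)) ≡ sumF f + (count P * c + count Q * d)
sum-weights₂ f P Q c d = trans (sum-+ f _) (cong (sumF f +_) (trans (sum-+ (λ i → weight (P i) c) (λ i → weight (Q i) d))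
  (cong₂ _+_ (sum-weight P c) (sum-weight Q d))))

sum-weights₁ : (f : Fin n → ℕ) (P : Fin n → Bool) (c : ℕ) → sumF (λ i → f i + weight (P i) c) ≡ sumF f + count P * c
sum-weights₁ f P c = trans (sum-+ f _) (cong (sumF f +_) (sum-weight P c))

-- The easy half of the Erdős-Gallai theorem for an arbitrary vertex set, with the full degrees
-- outside `X` instead of their minimum with the size of `X`. The vertices of `X` send at most
-- `|X| - 1` edges each into `X`, and their other edges are counted from outside.
erdős-gallai : (G : Graph n) (X : Fin n → Bool) →
  sumF (degree G) + count X ≤ count X * count X + 2 * sumF (λ i → weight (not (X i)) (degree G i))
erdős-gallai {n} G X = begin
  sumF (degree G) + count X
    ≡⟨ ≡-sym (trans (sum-+ (degree G) (λ i → weight (X i) 1)) refl) ⟩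
  sumF (λ i → degree G i + weight (X i) 1)
    ≤⟨ sum-mono pt ⟩
  sumF (λ i → (weight (X i) τ + cross i) + low i)
    ≡⟨ trans (sum-+ (λ i → weight (X i) τ + cross i) low) (cong (_+ sumF low) (trans (sum-+ (λ i → weight (X i) τ) cross) (cong (_+ sumF cross) (sum-weight X τ)))) ⟩
  τ * τ + sumF cross + sumF low
    ≤⟨ +-monoˡ-≤ (sumF low) (+-monoʳ-≤ (τ * τ) crossing) ⟩
  τ * τ + sumF low + sumF low
    ≡⟨ solve 2 (λ t l → t :+ l :+ l := t :+ con 2 :* l) refl (τ * τ) (sumF low) ⟩
  τ * τ + 2 * sumF low ∎
  where
  open ≤-Reasoning
  open +-*-Solver
  τ = count X
  low : Fin n → ℕ
  low i = weight (not (X i)) (degree G i)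
  edge : Fin n → Fin n → Bool
  edge i j = X i ∧ (adj G i j ∧ not (X j))
  cross : Fin n → ℕ
  cross i = count (edge i)
  pt : ∀ i → degree G i + weight (X i) 1 ≤ (weight (X i) τ + cross i) + low i
  pt i with X i in e
  ... | false = subst (_≤ count {n} (λ _ → false) + degree G i) (≡-sym (+-identityʳ (degree G i))) (m≤n+m (degree G i) _)
  ... | true  = ≤-trans (≤-reflexive (trans (cong (_+ 1) (count-split (adj G i) X)) (solve 2 (λ a b → a :+ b :+ con 1 := con 1 :+ a :+ b) refl (count (λ j → adj G i j ∧ X j)) (count (λ j → adj G i j ∧ not (X j))))))
      (≤-trans (+-monoˡ-≤ (count (λ j → adj G i j ∧ not (X j))) (count-mono-< (λ j h → ∧-elimʳ {adj G i j} h) i e (cong (_∧ X i) (irrefl G i))))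
        (≤-reflexive (≡-sym (+-identityʳ _))))
  crossing : sumF cross ≤ sumF low
  crossing = ≤-trans (≤-reflexive (sum-swap (λ i j → weight (edge i j) 1))) (sum-mono pt′)
    where
    pt′ : ∀ j → count (λ i → edge i j) ≤ low j
    pt′ j with X j
    ... | true  = ≤-trans (count-mono {Q = λ _ → false} (λ i h → false≢true {b = X i ∧ (adj G i j ∧ false)} (and-false (X i) (adj G i j)) h)) (≤-reflexive (sum-0 {n}))
      where and-false : ∀ a b → a ∧ (b ∧ false) ≡ false
            and-false true true = refl
            and-false true false = refl
            and-false false b = refl
    ... | false = count-mono (λ i h → adj-sym G (∧-elimˡ {adj G i j} (∧-elimʳ {X i} h)))

-- Polynomial inequalities between the counts

module Arithmetic where
  open +-*-Solver

  -- If the claim fails, writing `s = τ + 2 + i` and `m = 5 + j` turns the contradiction into a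
  -- polynomial identity with the remainder `2i + (i + 1)j`. The other estimates substitute in the
  -- same manner.
  large-count : ∀ s m τ σ → 5 ≤ m → s * s + 2 * (s * m) + m + 2 ≤ σ + s →
    σ + τ * (s + 3) ≤ τ * (s + m) + (s + m) * (s + 2) → s ≤ τ + 1
  large-count s m τ σ le dense bound with s ≤? τ + 1
  ... | yes p = p
  ... | no ¬p with m≤n⇒∃[o]m+o≡n (≰⇒> ¬p) | m≤n⇒∃[o]m+o≡n le
  ... | i , refl | j , refl = ⊥-elim (<⇒≱ big (≤-trans (+-monoˡ-≤ (τ * (s + 3)) dense)
        (≤-trans (≤-reflexive (solve 3 (λ a b c → a :+ b :+ c := a :+ c :+ b) refl σ s (τ * (s + 3)))) (+-monoˡ-≤ s bound))))
    where
    big : τ * (s + m) + (s + m) * (s + 2) + s < s * s + 2 * (s * m) + m + 2 + τ * (s + 3)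
    big = ≤-trans (m≤m+n _ (2 * i + (i + 1) * j)) (≤-reflexive (solve 3 (λ τ i j → let s = con 1 :+ (τ :+ con 1) :+ i ; m = con 5 :+ j in
            con 1 :+ (τ :* (s :+ m) :+ (s :+ m) :* (s :+ con 2) :+ s) :+ (con 2 :* i :+ (i :+ con 1) :* j)
            := s :* s :+ con 2 :* (s :* m) :+ m :+ con 2 :+ τ :* (s :+ con 3)) refl τ i j))

  medium-count : ∀ s m τ σ g → 2 ≤ m → τ ≤ s → s * s + 2 * (s * m) + m + 2 ≤ σ + s →
    σ + τ * (s + 3) ≤ τ * (s + m) + ((s + m) * (s + 1) + g * 1) → τ + 2 ≤ g
  medium-count s m τ σ g le τ≤s dense bound with m≤n⇒∃[o]m+o≡n τ≤s | m≤n⇒∃[o]m+o≡n le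
  ... | i , refl | j , refl = ≤-trans (m≤m+n (τ + 2) (i * j)) (+-cancelˡ-≤ (τ * (s + m) + (s + m) * (s + 1) + s) _ _
        (≤-trans (≤-reflexive alg) (≤-trans (+-monoˡ-≤ (τ * (s + 3)) dense)
          (≤-trans (≤-reflexive (solve 3 (λ a b c → a :+ b :+ c := a :+ c :+ b) refl σ s (τ * (s + 3))))
            (≤-trans (+-monoˡ-≤ s bound) (≤-reflexive (solve 4 (λ a b g s → a :+ (b :+ g :* con 1) :+ s := a :+ b :+ s :+ g) refl (τ * (s + m)) ((s + m) * (s + 1)) g s)))))))
    where
    alg : (τ * (s + m) + (s + m) * (s + 1) + s) + (τ + 2 + i * j) ≡ s * s + 2 * (s * m) + m + 2 + τ * (s + 3)
    alg = solve 3 (λ τ i j → let s = τ :+ i ; m = con 2 :+ j in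
          (τ :* (s :+ m) :+ (s :+ m) :* (s :+ con 1) :+ s) :+ (τ :+ con 2 :+ i :* j)
          := s :* s :+ con 2 :* (s :* m) :+ m :+ con 2 :+ τ :* (s :+ con 3)) refl τ i j

  -- The Erdős-Gallai inequality for the `τ` vertices of degree above `s + 2`, where each other
  -- vertex has degree at most `s`, or at most `s + 2` if it is among the `h` vertices above `s`.
  EGBound : (s m τ h : ℕ) → Set
  EGBound s m τ h = s * s + 2 * (s * m) + m + 2 + τ + 2 * (τ * (s + 2)) ≤ τ * τ + 2 * ((s + m) * s + h * 2) + s

  -- with τ = s + i the bound reads 4 h ≥ m + 2 + 5 τ - s - i²
  high-count : ∀ s m τ h e → EGBound s m τ h →
    s * s + 2 * (s * m) + m + 2 + τ + 2 * (τ * (s + 2)) ≡ (τ * τ + 2 * ((s + m) * s) + s) + (8 * s + 29) + e → 2 * s + 8 ≤ h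
  high-count s m τ h e bound p with 2 * s + 8 ≤? h
  ... | yes q = q
  ... | no ¬q = ⊥-elim (<⇒≱ (≤-trans (s≤s (*-monoʳ-≤ 4 (≤-pred (≤-trans (≰⇒> ¬q) (≤-reflexive (solve 1 (λ s → con 2 :* s :+ con 8 := con 1 :+ (con 2 :* s :+ con 7)) refl s))))))
            (≤-reflexive (solve 1 (λ s → con 1 :+ con 4 :* (con 2 :* s :+ con 7) := con 8 :* s :+ con 29) refl s))) r)
    where
    R = τ * τ + 2 * ((s + m) * s) + s
    r : 8 * s + 29 ≤ 4 * h
    r = ≤-trans (m≤m+n _ e) (+-cancelˡ-≤ R _ _ (≤-trans (≤-reflexive (≡-sym (trans p (+-assoc R _ e)))) (≤-trans bound
          (≤-reflexive (solve 4 (λ a b s h → a :+ con 2 :* (b :+ h :* con 2) :+ s := a :+ con 2 :* b :+ s :+ con 4 :* h) refl (τ * τ) ((s + m) * s) s h)))))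

  -- The tight case, which uses `n ≥ 5r + 18` in full: for `m = 4s + 33` the bound reads
  -- `4h ≥ 8s + 29`, just beyond `4(2s + 7)`.
  high-count-pred : ∀ s m τ h → 4 * s + 33 ≤ m → τ + 1 ≡ s → EGBound s m τ h → 2 * s + 8 ≤ h
  high-count-pred s m τ h le refl bound with m≤n⇒∃[o]m+o≡n le
  ... | j , refl = high-count s m τ h j bound (solve 2 (λ τ j → let s = τ :+ con 1 ; m = con 4 :* s :+ con 33 :+ j in
          s :* s :+ con 2 :* (s :* m) :+ m :+ con 2 :+ τ :+ con 2 :* (τ :* (s :+ con 2)) := τ :* τ :+ con 2 :* ((s :+ m) :* s) :+ s :+ (con 8 :* s :+ con 29) :+ j) refl τ j)

  high-count-add : ∀ s m i h → 4 * s + 33 ≤ m → i ≤ 3 → EGBound s m (s + i) h → 2 * s + 8 ≤ h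
  high-count-add s m i h le i≤ bound with m≤n⇒∃[o]m+o≡n le | m≤n⇒∃[o]m+o≡n i≤
  -- For `τ = s + i` the surplus over `8s + 29` is `j + 6 + 5i - i²`; with `k = 3 - i` this is
  -- `j + 6 + (2 + k)i`, free of subtraction.
  ... | j , refl | k , e = high-count s m (s + i) h (j + 6 + (2 + k) * i) bound (alg i k e)
    where
    alg : ∀ i k → i + k ≡ 3 → s * s + 2 * (s * m) + m + 2 + (s + i) + 2 * ((s + i) * (s + 2)) ≡ ((s + i) * (s + i) + 2 * ((s + m) * s) + s) + (8 * s + 29) + (j + 6 + (2 + k) * i)
    alg 0 k e = solve 3 (λ s j k → let τ = s :+ con 0 ; m = con 4 :* s :+ con 33 :+ j in
          s :* s :+ con 2 :* (s :* m) :+ m :+ con 2 :+ τ :+ con 2 :* (τ :* (s :+ con 2)) := τ :* τ :+ con 2 :* ((s :+ m) :* s) :+ s :+ (con 8 :* s :+ con 29) :+ (j :+ con 6 :+ (con 2 :+ k) :* con 0)) refl s j k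
    alg 1 2 refl = solve 2 (λ s j → let τ = s :+ con 1 ; m = con 4 :* s :+ con 33 :+ j in
          s :* s :+ con 2 :* (s :* m) :+ m :+ con 2 :+ τ :+ con 2 :* (τ :* (s :+ con 2)) := τ :* τ :+ con 2 :* ((s :+ m) :* s) :+ s :+ (con 8 :* s :+ con 29) :+ (j :+ con 6 :+ (con 2 :+ con 2) :* con 1)) refl s j
    alg 2 1 refl = solve 2 (λ s j → let τ = s :+ con 2 ; m = con 4 :* s :+ con 33 :+ j in
          s :* s :+ con 2 :* (s :* m) :+ m :+ con 2 :+ τ :+ con 2 :* (τ :* (s :+ con 2)) := τ :* τ :+ con 2 :* ((s :+ m) :* s) :+ s :+ (con 8 :* s :+ con 29) :+ (j :+ con 6 :+ (con 2 :+ con 1) :* con 2)) refl s j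
    alg 3 0 refl = solve 2 (λ s j → let τ = s :+ con 3 ; m = con 4 :* s :+ con 33 :+ j in
          s :* s :+ con 2 :* (s :* m) :+ m :+ con 2 :+ τ :+ con 2 :* (τ :* (s :+ con 2)) := τ :* τ :+ con 2 :* ((s :+ m) :* s) :+ s :+ (con 8 :* s :+ con 29) :+ (j :+ con 6 :+ (con 2 :+ con 0) :* con 3)) refl s j

  -- The number of vertices above `s` is `h = s + 4 + k`. The long hypothesis bounds the degrees by
  -- `h - 2` on the top `s + 4` vertices, by `D` on the other `k` and by `s` elsewhere. Inserting
  -- the largest `D` and `k` leaves `(s + 1)m` below a quadratic in `s`.
  many-count : ∀ s m D k σ → 45 ≤ m → 4 * s + 33 ≤ m → 1 ≤ s → D ≤ 2 * s + 4 → k ≤ suc D → s * s + 2 * (s * m) + m + 2 ≤ σ + s →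
    σ + ((s + 4) * (D + 2) + (s + 4 + k) * s) ≤ (s + 4) * (s + 4 + k) + ((s + 4 + k) * D + (s + m) * s) → ⊥
  many-count s m D k σ m₁ m₂ s₁ Dle kle dense bound = <⇒≱ (final s m m₁ m₂ s₁) clean
    where
    step₁ : σ + (2 * s + 8) ≤ 4 * (s + 4 + k) + k * D + (s + m) * s
    step₁ = +-cancelʳ-≤ ((s + 4) * D + (s + 4 + k) * s) _ _ (≤-trans (≤-reflexive (solve 4 (λ σ s D k →
        σ :+ (con 2 :* s :+ con 8) :+ ((s :+ con 4) :* D :+ (s :+ con 4 :+ k) :* s) := σ :+ ((s :+ con 4) :* (D :+ con 2) :+ (s :+ con 4 :+ k) :* s)) refl σ s D k))
        (≤-trans bound (≤-reflexive (solve 4 (λ s D k n → (s :+ con 4) :* (s :+ con 4 :+ k) :+ ((s :+ con 4 :+ k) :* D :+ n :* s)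
           := con 4 :* (s :+ con 4 :+ k) :+ k :* D :+ n :* s :+ ((s :+ con 4) :* D :+ (s :+ con 4 :+ k) :* s)) refl s D k (s + m)))))
    k≤ : k ≤ 2 * s + 5
    k≤ = ≤-trans kle (≤-trans (s≤s Dle) (≤-reflexive (≡-sym (+-suc (2 * s) 4))))
    step₂ : σ + (2 * s + 8) ≤ 4 * (s + 4 + (2 * s + 5)) + (2 * s + 5) * (2 * s + 4) + (s + m) * s
    step₂ = ≤-trans step₁ (+-monoˡ-≤ ((s + m) * s) (+-mono-≤ (*-monoʳ-≤ 4 (+-monoʳ-≤ (s + 4) k≤)) (*-mono-≤ k≤ Dle)))
    clean : (s + 1) * m ≤ 4 * (s * s) + 29 * s + 46
    clean = +-cancelʳ-≤ (s * s + s * m + 2 * s + 10) _ _ (≤-trans (≤-reflexive (solve 2 (λ s m → (s :+ con 1) :* m :+ (s :* s :+ s :* m :+ con 2 :* s :+ con 10)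
        := s :* s :+ con 2 :* (s :* m) :+ m :+ con 2 :+ (con 2 :* s :+ con 8)) refl s m)) (≤-trans (+-monoˡ-≤ (2 * s + 8) dense)
        (≤-trans (≤-reflexive (solve 3 (λ σ s c → σ :+ s :+ c := σ :+ c :+ s) refl σ s (2 * s + 8))) (≤-trans (+-monoˡ-≤ s step₂)
        (≤-reflexive (solve 2 (λ s m → con 4 :* (s :+ con 4 :+ (con 2 :* s :+ con 5)) :+ (con 2 :* s :+ con 5) :* (con 2 :* s :+ con 4) :+ (s :+ m) :* s :+ s
          := con 4 :* (s :* s) :+ con 29 :* s :+ con 46 :+ (s :* s :+ s :* m :+ con 2 :* s :+ con 10)) refl s m))))))
    final : ∀ s m → 45 ≤ m → 4 * s + 33 ≤ m → 1 ≤ s → 4 * (s * s) + 29 * s + 46 < (s + 1) * m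
    -- Here `2m ≥ 80` is required, while `4s + 33 = 37` would yield only 74. This is where `m ≥ 45`
    -- is used.
    final 1 m m₁ m₂ s₁ = ≤-trans (m≤m+n 80 10) (*-monoʳ-≤ 2 m₁)
    final (suc (suc s)) m m₁ m₂ s₁ = ≤-trans (≤-trans (m≤m+n _ (8 * s + 2)) (≤-reflexive (solve 1 (λ t → let s = con 2 :+ t in
        con 1 :+ (con 4 :* (s :* s) :+ con 29 :* s :+ con 46) :+ (con 8 :* t :+ con 2) := (s :+ con 1) :* (con 4 :* s :+ con 33)) refl s))) (*-monoʳ-≤ (suc (suc s) + 1) m₂)

-- The bound `s + m` concerns vertices of positive degree only, since removed vertices stay behind
-- isolated. In `dense` the term `s` on the right stands for the subtraction in `s(s - 1)`.
module Counting {N : ℕ} (s m : ℕ) (G : Graph N) (act : count (above 0 G) ≤ s + m)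
  (dense : s * s + 2 * (s * m) + m + 2 ≤ sumF (degree G) + s) where

  open +-*-Solver

  σ : ℕ
  σ = sumF (degree G)

  X : Fin N → Bool
  X = above (s + 2) G

  active : ∀ {i t} → t < degree G i → above 0 G i ≡ true
  active lt = above-intro G (≤-<-trans z≤n lt)

  degree-< : ∀ i → above 0 G i ≡ true → degree G i < s + m
  degree-< i e = ≤-trans (count-mono-< (λ j h → above-intro G (subst (0 <_) (count-remove (adj G j) i (adj-sym G h)) (s≤s z≤n))) i e (irrefl G i)) act

  inactive : ∀ i → above 0 G i ≡ false → degree G i ≡ 0
  inactive i e = n≤0⇒n≡0 (above-false G e)

  module _ (c : ℕ) (R : Fin N → Bool) (small : ∀ i → above 0 G i ≡ true → X i ≡ false → degree G i ≤ c + weight (R i) 1)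
           (at-X : ∀ i → X i ≡ true → s + 3 ≤ suc c + weight (R i) 1) where

    -- A vertex by vertex estimate: degrees in `X` are below `s + m`, the others at most `c`, plus
    -- one on `R`. The set `R` is empty for `large-lower` and consists of the vertices above `s + 1`
    -- for `medium-lower`.
    trivial-bound : σ + count X * (s + 3) ≤ count X * (s + m) + ((s + m) * c + count R * 1)
    trivial-bound = ≤-trans (≤-reflexive (≡-sym (sum-weights₁ (degree G) X (s + 3)))) (≤-trans (sum-mono pt)
       (≤-trans (≤-reflexive (trans (sum-weights₂ (λ i → weight (X i) (s + m)) (above 0 G) R c 1) (cong (_+ (count (above 0 G) * c + count R * 1)) (sum-weight X (s + m)))))
         (+-monoʳ-≤ (count X * (s + m)) (+-monoˡ-≤ (count R * 1) (*-monoˡ-≤ c act)))))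
      where
      pt : ∀ i → degree G i + weight (X i) (s + 3) ≤ weight (X i) (s + m) + (weight (above 0 G i) c + weight (R i) 1)
      pt i with true? (above 0 G i) | true? (X i)
      ... | inj₂ a | inj₁ x = false≢true a (active (above-elim G x))
      ... | inj₂ a | inj₂ x rewrite x | inactive i a = z≤n
      ... | inj₁ a | inj₂ x rewrite a | x = ≤-trans (≤-reflexive (+-identityʳ _)) (small i a x)
      ... | inj₁ a | inj₁ x with at-X i x
      ... | q rewrite a | x = ≤-pred (≤-trans (+-mono-≤ (degree-< i a) q) (≤-reflexive (+-suc (s + m) _)))

  large-lower : 5 ≤ m → s ≤ count X + 1
  large-lower le = Arithmetic.large-count s m (count X) σ le dense (≤-trans bound (≤-reflexive
      (trans (cong (λ z → count X * (s + m) + ((s + m) * (s + 2) + z * 1)) (sum-0 {N})) (cong (count X * (s + m) +_) (+-identityʳ _)))))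
    where
    bound : σ + count X * (s + 3) ≤ count X * (s + m) + ((s + m) * (s + 2) + count {N} (λ _ → false) * 1)
    bound = trivial-bound (s + 2) (λ _ → false) (λ i _ x → ≤-trans (above-false G x) (m≤m+n (s + 2) 0))
              (λ i _ → ≤-reflexive (trans (+-suc s 2) (≡-sym (+-identityʳ _))))

  medium-lower : 2 ≤ m → count X ≤ s → count X + 2 ≤ count (above (s + 1) G)
  medium-lower le τ≤s = Arithmetic.medium-count s m (count X) σ (count (above (s + 1) G)) le τ≤s dense (trivial-bound (s + 1) (above (s + 1) G) sm atX)
    where
    sm : ∀ i → above 0 G i ≡ true → X i ≡ false → degree G i ≤ s + 1 + weight (above (s + 1) G i) 1
    sm i _ x with true? (above (s + 1) G i)
    ... | inj₁ e rewrite e = ≤-trans (above-false G x) (≤-reflexive (≡-sym (+-assoc s 1 1)))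
    ... | inj₂ e rewrite e = ≤-trans (above-false G e) (m≤m+n (s + 1) 0)
    atX : ∀ i → X i ≡ true → s + 3 ≤ suc (s + 1) + weight (above (s + 1) G i) 1
    atX i x rewrite above-intro G {s + 1} {i} (≤-<-trans (+-monoʳ-≤ s (s≤s z≤n)) (above-elim G x)) =
      ≤-reflexive (solve 1 (λ s → s :+ con 3 := con 1 :+ (s :+ con 1) :+ con 1) refl s)

  h : ℕ
  h = count (above s G)

  eg-bound : Arithmetic.EGBound s m (count X) h
  eg-bound = ≤-trans (+-monoˡ-≤ (2 * (τ * (s + 2))) (+-monoˡ-≤ τ dense))
     (≤-trans (≤-reflexive (solve 4 (λ a b c d → a :+ b :+ c :+ d := a :+ c :+ (d :+ b)) refl σ s τ (2 * (τ * (s + 2)))))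
     (≤-trans (+-monoˡ-≤ (2 * (τ * (s + 2)) + s) (erdős-gallai G X))
     (≤-trans (≤-reflexive (solve 4 (λ a b c d → a :+ con 2 :* b :+ (con 2 :* c :+ d) := a :+ con 2 :* (b :+ c) :+ d) refl (τ * τ) B (τ * (s + 2)) s))
       (+-monoˡ-≤ s (+-monoʳ-≤ (τ * τ) (*-monoʳ-≤ 2 low-bound))))))
    where
    τ = count X
    B = sumF (λ i → weight (not (X i)) (degree G i))
    low-bound : B + τ * (s + 2) ≤ (s + m) * s + h * 2
    low-bound = ≤-trans (≤-reflexive (≡-sym (sum-weights₁ (λ i → weight (not (X i)) (degree G i)) X (s + 2)))) (≤-trans (sum-mono pt)
       (≤-trans (≤-reflexive (trans (sum-weights₁ (λ i → weight (above 0 G i) s) (above s G) 2) (cong (_+ h * 2) (sum-weight (above 0 G) s))))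
         (+-monoˡ-≤ (h * 2) (*-monoˡ-≤ s act))))
      where
      pt : ∀ i → weight (not (X i)) (degree G i) + weight (X i) (s + 2) ≤ weight (above 0 G i) s + weight (above s G i) 2
      pt i with true? (above 0 G i) | true? (X i)
      ... | inj₂ a | inj₁ x = false≢true a (active (above-elim G x))
      ... | inj₂ a | inj₂ x rewrite x | inactive i a = z≤n
      ... | inj₁ a | inj₁ x rewrite a | x | above-intro G {s} {i} (≤-<-trans (m≤m+n s 2) (above-elim G x)) = ≤-refl
      ... | inj₁ a | inj₂ x with true? (above s G i)
      ...   | inj₁ e rewrite a | x | e = ≤-trans (≤-reflexive (+-identityʳ _)) (above-false G x)
      ...   | inj₂ e rewrite a | x | e = ≤-trans (≤-reflexive (+-identityʳ _)) (≤-trans (above-false G e) (m≤m+n s 0))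

  high-lower-pred : 4 * s + 33 ≤ m → count X + 1 ≡ s → 2 * s + 8 ≤ h
  high-lower-pred le e = Arithmetic.high-count-pred s m (count X) h le e eg-bound

  high-lower : 4 * s + 33 ≤ m → ∀ i → i ≤ 3 → count X ≡ s + i → 2 * s + 8 ≤ h
  high-lower le i i≤ e = Arithmetic.high-count-add s m i h le i≤ (subst (λ τ → Arithmetic.EGBound s m τ h) e eg-bound)

  high-many : 45 ≤ m → 4 * s + 33 ≤ m → 1 ≤ s → (∀ i → 2 + degree G i ≤ h) → ∀ D (S : Fin N → Bool) → D ≤ 2 * s + 4 → count S ≡ s + 4 →
    S ⊑ above s G → (∀ i → S i ≡ false → degree G i ≤ D) → s + 4 + suc D < h
  high-many m₁ m₂ s₁ spread D S Dle cS S⊑ out with s + 4 + suc D <? h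
  ... | yes p = p
  ... | no ¬p with m≤n⇒∃[o]m+o≡n (subst (_≤ h) cS (count-mono S⊑))
  ... | k , e = ⊥-elim (Arithmetic.many-count s m D k σ m₁ m₂ s₁ Dle (+-cancelˡ-≤ (s + 4) k (suc D) (subst (_≤ s + 4 + suc D) (≡-sym e) (≮⇒≥ ¬p))) dense
        (subst₂ (λ c h → σ + (c * (D + 2) + h * s) ≤ c * h + (h * D + (s + m) * s)) cS (≡-sym e) bound))
    where
    bound : σ + (count S * (D + 2) + h * s) ≤ count S * h + (h * D + (s + m) * s)
    bound = ≤-trans (≤-reflexive (≡-sym (sum-weights₂ (degree G) S (above s G) (D + 2) s))) (≤-trans (sum-mono pt)
       (≤-trans (≤-reflexive (trans (sum-weights₂ (λ i → weight (S i) h) (above s G) (above 0 G) D s) (cong (_+ (h * D + count (above 0 G) * s)) (sum-weight S h))))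
         (+-monoʳ-≤ (count S * h) (+-monoʳ-≤ (h * D) (*-monoˡ-≤ s act)))))
      where
      pt : ∀ i → degree G i + (weight (S i) (D + 2) + weight (above s G i) s) ≤ weight (S i) h + (weight (above s G i) D + weight (above 0 G i) s)
      pt i with true? (above 0 G i) | true? (above s G i) | true? (S i)
      ... | inj₂ a | inj₁ x | _ = false≢true a (active (above-elim G x))
      ... | _ | inj₂ x | inj₁ y = false≢true x (S⊑ i y)
      ... | inj₂ a | inj₂ x | inj₂ y rewrite x | y | inactive i a = z≤n
      ... | inj₁ a | inj₁ x | inj₁ y rewrite a | x | y = ≤-trans (≤-reflexive (solve 3 (λ d D s → d :+ (D :+ con 2 :+ s) := con 2 :+ d :+ (D :+ s)) refl (degree G i) D s))
                                                                (+-monoˡ-≤ (D + s) (spread i))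
      ... | inj₁ a | inj₁ x | inj₂ y rewrite a | x | y = +-monoˡ-≤ s (out i y)
      ... | inj₁ a | inj₂ x | inj₂ y rewrite a | x | y = ≤-trans (≤-reflexive (+-identityʳ _)) (above-false G x)

-- Many vertices of large degree

any-false : (P : Fin k → Bool) → any P ≡ false → ∀ a → P a ≡ false
any-false P h a = ≢true⇒false (λ e → false≢true h (any-intro P a e))

clique-or-gap : (G : Graph n) (A : Fin n → Bool) →
  (∀ {x x′} → A x ≡ true → A x′ ≡ true → x ≢ x′ → Adj G x x′) ⊎
  (∃ λ x → ∃ λ x′ → A x ≡ true × A x′ ≡ true × x ≢ x′ × NonAdj G x x′)
clique-or-gap G A with true? (any (λ i → any (λ j → (A i ∧ A j) ∧ (not (i == j) ∧ not (adj G i j)))))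
... | inj₁ h =
  let (i , h₁) = any-elim _ h
      (j , h₂) = any-elim _ h₁
      both = ∧-elimˡ {A i ∧ A j} h₂
      apart = ∧-elimʳ {A i ∧ A j} h₂
  in inj₂ (i , j , ∧-elimˡ both , ∧-elimʳ {A i} both , ==⇒≢ (not-elim (∧-elimˡ apart)) , not-elim (∧-elimʳ {not (i == j)} apart))
... | inj₂ h = inj₁ λ {x} {x′} a a′ ne → ≢false⇒true λ n → false≢true (any-false _ (any-false _ h x) x′)
      (∧-intro (∧-intro a a′) (∧-intro (not-intro (≢⇒== ne)) (not-intro n)))

-- A discrete intermediate value argument: raising the degree threshold, the count has to fall below
-- `c` within `f` steps.
threshold : (G : Graph n) (c f t : ℕ) → c ≤ count (above t G) → count (above (f + t) G) < c →
  ∃ λ t′ → t ≤ t′ × c ≤ count (above t′ G) × count (above (suc t′) G) < c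
threshold G c zero    t lo hi = ⊥-elim (<⇒≱ hi lo)
threshold G c (suc f) t lo hi with count (above (suc t) G) <? c
... | yes p = t , ≤-refl , lo , p
... | no ¬p = let (t′ , le , p , q) = threshold G c f (suc t) (≮⇒≥ ¬p) (subst (λ z → count (above z G) < c) (≡-sym (+-suc f t)) hi)
              in t′ , ≤-trans (n≤1+n t) le , p , q

-- `S` holds `s + 4` vertices of largest degree, with ties at `D` broken arbitrarily.
record TopSet (s : ℕ) (G : Graph n) : Set where
  field
    S    : Fin n → Bool
    D    : ℕ
    size : count S ≡ s + 4
    low  : s + 3 ≤ D
    top  : ∀ x → S x ≡ true → D ≤ degree G x
    out  : ∀ x → S x ≡ false → degree G x ≤ D

topSet : ∀ s (G : Graph n) → s + 4 ≤ count (above (s + 2) G) → TopSet s G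
topSet {n} s G big with threshold G (s + 4) n (s + 2) big (≤-trans (s≤s none) (≤-trans (s≤s z≤n) (m≤n+m 4 s)))
  where
  none : count (above (n + (s + 2)) G) ≤ 0
  none = ≤-trans (count-mono {Q = λ _ → false} (λ i e → ⊥-elim (<⇒≱ (above-elim G e) (≤-trans (count-≤ (adj G i)) (m≤m+n n (s + 2)))))) (≤-reflexive (sum-0 {n}))
... | t , le , lo , hi with between (s + 4) (above (suc t) G) (above t G) (λ i e → above-intro G (<-trans (n<1+n t) (above-elim G e))) (<⇒≤ hi) lo
... | S , ⊑S , S⊑ , c = record { S = S ; D = suc t ; size = c ; low = ≤-trans (≤-reflexive (+-suc s 2)) (s≤s le)
      ; top = λ x e → above-elim G (S⊑ x e) ; out = λ x e → above-false G (≢true⇒false (λ h → false≢true e (⊑S x h))) }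

module Top {N : ℕ} (s : ℕ) (G₀ : Graph N) (bad : NoGood s G₀) (ts : TopSet s G₀) where
  open TopSet ts renaming (S to X)

  y : Fin 0 → Fin N
  y ()

  X-deg : ∀ x → X x ≡ true → s + 2 < degree G₀ x
  X-deg x e = ≤-trans (≤-trans (≤-reflexive (≡-sym (+-suc s 2))) low) (top x e)

  open Split s D G₀ X y (Edgeless 0) (λ {i} → ⊥-elim (FP.¬Fin0 i)) (λ ()) (trans (+-identityʳ (count X)) size) X-deg

  finish : (∀ G → G ~ G₀ → Max G → ∀ {x x′} → X x ≡ true → X x′ ≡ true → x ≢ x′ → Adj G x x′) → ⊥
  finish cl = maximise G₀ λ G eq max → bad G eq (CliqueSet.good-0 s G X (cl G eq max) size)

  spread : s + 4 + suc D < count (above s G₀) → ⊥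
  spread lots = finish λ G eq max → Settled.X-clique G eq out lots max (bad G eq)

  -- the unwanted neighbourhoods of a missing pair are complete to each other; by outside-neighbours one of them is a clique
  concentrated : 2 * s + 5 ≤ D → ⊥
  concentrated big = finish λ G eq max {u} {v} xu xv ne → ≢false⇒true (gap G eq max xu xv ne)
    where
    module _ (G : Graph N) (eq : G ~ G₀) (max : Max G) where
      A : Fin N → Fin N → Bool
      A u i = adj G u i ∧ not (X i)

      A∉S : ∀ {u i} → A u i ≡ true → S i ≡ false
      A∉S {u} {i} h = trans (cong (_∨ false) (not-elim (∧-elimʳ {adj G u i} h))) refl

      -- The origin of `2s + 5`: at most `s + 2` neighbours of `u` lie in `X`, since `u` and `v` do
      -- not count, and `s + 3` more are wanted outside.
      A-big : ∀ {u v} → X u ≡ true → X v ≡ true → u ≢ v → NonAdj G u v → s + 3 ≤ count (A u)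
      A-big {u} {v} xu xv ne n = +-cancelˡ-≤ (s + 2) _ _ (≤-trans (≤-reflexive (solve 1 (λ s → s :+ con 2 :+ (s :+ con 3) := con 2 :* s :+ con 5) refl s))
          (≤-trans big (≤-trans (top u xu) (≤-trans (≤-reflexive (trans (≡-sym (eq u)) (count-split (adj G u) X))) (+-monoˡ-≤ (count (A u)) inside)))))
        where
        open +-*-Solver
        inside : count (λ i → adj G u i ∧ X i) ≤ s + 2
        inside = ≤-pred (≤-pred (≤-trans (s≤s (s≤s (count-mono {Q = λ i → (X i ∧ not (i == u)) ∧ not (i == v)} λ i h →
            ∧-intro (∧-intro (∧-elimʳ {adj G u i} h) (not-intro (≢⇒== (λ { refl → adj⇒≢ G (∧-elimˡ {adj G u i} h) refl }))))
                    (not-intro (≢⇒== (λ { refl → false≢true n (∧-elimˡ {adj G u i} h) }))))))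
          (≤-reflexive (trans (cong suc (count-remove (λ i → X i ∧ not (i == u)) v (∧-intro xv (not-intro (≢⇒== (λ q → ne (≡-sym q)))))))
            (trans (count-remove X u xu) (trans size (solve 1 (λ s → s :+ con 4 := con 2 :+ (s :+ con 2)) refl s)))))))

      -- A clique on `s + 3` neighbours of `u` would form, together with `u`, a complete graph on
      -- `s + 4` vertices.
      not-clique : ∀ {u v} → X u ≡ true → X v ≡ true → u ≢ v → NonAdj G u v →
        ∃ λ x → ∃ λ x′ → A u x ≡ true × A u x′ ≡ true × x ≢ x′ × NonAdj G x x′
      not-clique {u} xu xv ne n with clique-or-gap G (A u)
      ... | inj₂ g = g
      ... | inj₁ cl with between (s + 3) (λ _ → false) (A u) (λ _ ()) (≤-trans (≤-reflexive (sum-0 {N})) z≤n) (A-big xu xv ne n)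
      ... | B , _ , B⊑ , c = ⊥-elim (bad G eq (CliqueSet.good-1 s G B (λ p q → cl (B⊑ _ p) (B⊑ _ q)) c u
              (≢true⇒false (λ h → adj⇒≢ G (∧-elimˡ (B⊑ u h)) refl))
              (≤-trans (≤-trans (m≤m+n (suc s) 2) (≤-reflexive (trans (≡-sym (+-suc s 2)) (≡-sym c)))) (count-mono (λ i h → ∧-intro h (∧-elimˡ (B⊑ i h)))))))

      gap : ∀ {u v} → X u ≡ true → X v ≡ true → u ≢ v → NonAdj G u v → ⊥
      gap {u} {v} xu xv ne n with not-clique xu xv ne n | not-clique xv xu (λ q → ne (≡-sym q)) (nonadj-sym G n)
      ... | a₁ , a₂ , p₁ , p₂ , a≢ , na | b₁ , b₂ , q₁ , q₂ , b≢ , nb = fin (outside-neighbours max (cfg p₁ q₁) (A∉S p₂) (λ q → a≢ (≡-sym q)) na a₂b₂)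
        where
        cfg : ∀ {a b} → A u a ≡ true → A v b ≡ true → Config G u v a b
        cfg p q = config (W-XS xu (∨-introˡ xv) ne) n (∧-elimˡ p) (outsideʳ (A∉S p)) (∧-elimˡ q) (outsideʳ (A∉S q))
        a₂b₂ : Adj G a₂ b₂
        a₂b₂ with ends-adjacent max (cfg p₂ q₂)
        ... | inj₂ e = e
        ... | inj₁ refl with ends-adjacent max (cfg p₁ q₂)
        ...   | inj₁ e = ⊥-elim (a≢ e)
        ...   | inj₂ e = false≢true na e
        fin : (b₂ ≡ b₁) ⊎ Adj G b₁ b₂ → ⊥
        fin (inj₁ e) = b≢ (≡-sym e)
        fin (inj₂ e) = false≢true nb e

-- Stripping a vertex

swap : Fin n → Fin n → Fin n → Fin n
swap x y i = if i == x then y else (if i == y then x else i)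

swap-x : (x y : Fin n) → swap x y x ≡ y
swap-x x y rewrite ==-refl x = refl

swap-y : (x y : Fin n) → swap x y y ≡ x
swap-y x y with y ≟ x
... | yes refl = refl
... | no _ rewrite ==-refl y = refl

swap-other : {x y i : Fin n} → i ≢ x → i ≢ y → swap x y i ≡ i
swap-other {x = x} {y} {i} p q rewrite ≢⇒== p | ≢⇒== q = refl

swap-involutive : (x y i : Fin n) → swap x y (swap x y i) ≡ i
swap-involutive x y i = case (i ≟ x) (i ≟ y)
  where
  case : Dec (i ≡ x) → Dec (i ≡ y) → swap x y (swap x y i) ≡ i
  case (yes refl) _ = trans (cong (swap i y) (swap-x i y)) (swap-y i y)
  case (no _) (yes refl) = trans (cong (swap x i) (swap-y x i)) (swap-x x i)
  case (no p) (no q) = trans (cong (swap x y) (swap-other p q)) (swap-other p q)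

swap-injective : (x y : Fin n) → Injective _≡_ _≡_ (swap x y)
swap-injective x y {i} {j} e = trans (≡-sym (swap-involutive x y i)) (trans (cong (swap x y) e) (swap-involutive x y j))

count-swap : (x y : Fin n) (P : Fin n → Bool) → count (λ i → P (swap x y i)) ≡ count P
count-swap x y P = ≤-antisym (count-injective (swap x y) (swap-injective x y) _ P (λ _ e → e))
  (count-injective (swap x y) (swap-injective x y) P _ (λ i e → trans (cong P (swap-involutive x y i)) e))

-- x takes over the private neighbours B of y, and y receives equally many private neighbours A′ of x in return
module Exchange {N : ℕ} (G : Graph N) (x y : Fin N) (x≢y : x ≢ y) (le : degree G y ≤ degree G x) where

  private
    A₀ B₀ A B : Fin N → Bool
    A₀ i = adj G x i ∧ not (adj G y i)
    B₀ i = adj G y i ∧ not (adj G x i)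
    A i = A₀ i ∧ not (i == y)
    B i = B₀ i ∧ not (i == x)

    B₀≤A₀ : count B₀ ≤ count A₀
    B₀≤A₀ = +-cancelˡ-≤ (count (λ i → adj G x i ∧ adj G y i)) _ _ (≤-trans (≤-reflexive (trans (cong (_+ count B₀) (count-cong (λ i → ∧-comm (adj G x i) (adj G y i))))
      (≡-sym (count-split (adj G y) (adj G x))))) (≤-trans le (≤-reflexive (count-split (adj G x) (adj G y)))))

    -- If `xy` is an edge, then `y` lies in `A₀` and `x` in `B₀`, so both counts drop by one; if
    -- not, `A₀` loses nothing.
    B≤A : count B ≤ count A
    B≤A with true? (adj G x y)
    ... | inj₁ e = ≤-pred (subst₂ _≤_ (≡-sym (count-remove B₀ x (∧-intro (adj-sym G e) (not-intro (irrefl G x)))))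
                                      (≡-sym (count-remove A₀ y (∧-intro e (not-intro (irrefl G y))))) B₀≤A₀)
    ... | inj₂ e = ≤-trans (count-mono {P = B} {Q = B₀} (λ i h → ∧-elimˡ h)) (≤-trans B₀≤A₀
                     (count-mono {P = A₀} {Q = A} (λ i h → ∧-intro h (not-intro (≢⇒== (λ { refl → false≢true e (∧-elimˡ {adj G x i} h) }))))))

    chosen = between (count B) (λ _ → false) A (λ _ ()) (≤-trans (≤-reflexive (sum-0 {N})) z≤n) B≤A
    A′ : Fin N → Bool
    A′ = proj₁ chosen
    A′⊑A : A′ ⊑ A
    A′⊑A = proj₁ (proj₂ (proj₂ chosen))
    A′≡B : count A′ ≡ count B
    A′≡B = proj₂ (proj₂ (proj₂ chosen))

    D : Fin N → Bool
    D i = A′ i ∨ B i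

    A′-view : ∀ {i} → A′ i ≡ true → Adj G x i × NonAdj G y i × i ≢ y
    A′-view {i} h = let a = A′⊑A i h ; b = ∧-elimˡ {A₀ i} a in ∧-elimˡ b , not-elim (∧-elimʳ {adj G x i} b) , ==⇒≢ (not-elim (∧-elimʳ {A₀ i} a))

    B-view : ∀ {i} → B i ≡ true → Adj G y i × NonAdj G x i × i ≢ x
    B-view {i} h = let b = ∧-elimˡ {B₀ i} h in ∧-elimˡ b , not-elim (∧-elimʳ {adj G y i} b) , ==⇒≢ (not-elim (∧-elimʳ {B₀ i} h))

    D≢x : ∀ {i} → D i ≡ true → i ≢ x
    D≢x {i} h with ∨-elim {A′ i} h
    ... | inj₁ a = λ e → adj⇒≢ G (proj₁ (A′-view a)) (≡-sym e)
    ... | inj₂ b = proj₂ (proj₂ (B-view b))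

    D≢y : ∀ {i} → D i ≡ true → i ≢ y
    D≢y {i} h with ∨-elim {A′ i} h
    ... | inj₁ a = proj₂ (proj₂ (A′-view a))
    ... | inj₂ b = λ e → adj⇒≢ G (proj₁ (B-view b)) (≡-sym e)

    Dx : D x ≡ false
    Dx = ≢true⇒false (λ h → D≢x h refl)
    Dy : D y ≡ false
    Dy = ≢true⇒false (λ h → D≢y h refl)

    -- The new adjacency of `i` and `j` is the old one with `x` and `y` interchanged as seen from
    -- the vertices of `D`. In this form symmetry and irreflexivity are inherited from `G`.
    via : Fin N → Fin N → Fin N
    via j i = if D j then swap x y i else i

    via-in : ∀ {j} i → D j ≡ true → via j i ≡ swap x y i
    via-in i e rewrite e = refl
    via-out : ∀ {j} i → D j ≡ false → via j i ≡ i
    via-out i e rewrite e = refl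

    via-fix : ∀ j {i} → i ≢ x → i ≢ y → via j i ≡ i
    via-fix j p q with D j
    ... | true  = swap-other p q
    ... | false = refl

    adj′ : Fin N → Fin N → Bool
    adj′ i j = adj G (via j i) (via i j)

  exchanged : Graph N
  exchanged = record { adj = adj′ ; sym = λ i j → sym G (via j i) (via i j) ; irrefl = λ i → irrefl G (via i i) }

  private
    row-x : ∀ j → adj′ x j ≡ (if D j then adj G y j else adj G x j)
    row-x j rewrite via-out {x} j Dx with D j
    ... | true  rewrite swap-x x y = refl
    ... | false = refl

    row-y : ∀ j → adj′ y j ≡ (if D j then adj G x j else adj G y j)
    row-y j rewrite via-out {y} j Dy with D j
    ... | true  rewrite swap-y x y = refl
    ... | false = refl

    mix : (P Q R : Fin N → Bool) → (∀ j → P j ≡ (if D j then R j else Q j)) → count (λ j → D j ∧ R j) ≡ count (λ j → D j ∧ Q j) → count P ≡ count Q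
    mix P Q R e c = trans (trans (count-split P D) (cong₂ _+_ (trans (count-cong p₁) c) (count-cong p₂)))
      (trans (cong (_+ count (λ j → Q j ∧ not (D j))) (count-cong (λ j → ∧-comm (D j) (Q j)))) (≡-sym (count-split Q D)))
      where
      p₁ : ∀ j → P j ∧ D j ≡ D j ∧ R j
      p₁ j with true? (D j)
      ... | inj₁ h rewrite e j | h = ∧-comm (R j) true
      ... | inj₂ h rewrite h = ∧-comm (P j) false
      p₂ : ∀ j → P j ∧ not (D j) ≡ Q j ∧ not (D j)
      p₂ j with true? (D j)
      ... | inj₁ h rewrite h = trans (∧-comm (P j) false) (∧-comm false (Q j))
      ... | inj₂ h rewrite e j | h = refl

    Dx-count : count (λ j → D j ∧ adj G x j) ≡ count A′
    Dx-count = count-cong (λ j → bool-ext (f j) (λ a → ∧-intro (∨-introˡ a) (proj₁ (A′-view a))))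
      where f : ∀ j → D j ∧ adj G x j ≡ true → A′ j ≡ true
            f j h with ∨-elim {A′ j} (∧-elimˡ h)
            ... | inj₁ a = a
            ... | inj₂ b = false≢true (proj₁ (proj₂ (B-view b))) (∧-elimʳ {D j} h)

    Dy-count : count (λ j → D j ∧ adj G y j) ≡ count B
    Dy-count = count-cong (λ j → bool-ext (f j) (λ b → ∧-intro (∨-introʳ {A′ j} b) (proj₁ (B-view b))))
      where f : ∀ j → D j ∧ adj G y j ≡ true → B j ≡ true
            f j h with ∨-elim {A′ j} (∧-elimˡ h)
            ... | inj₂ b = b
            ... | inj₁ a = false≢true (proj₁ (proj₂ (A′-view a))) (∧-elimʳ {D j} h)

  exchanged-~ : exchanged ~ G
  exchanged-~ i = case (i ≟ x) (i ≟ y) (true? (D i))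
    where
    case : Dec (i ≡ x) → Dec (i ≡ y) → (D i ≡ true) ⊎ (D i ≡ false) → degree exchanged i ≡ degree G i
    case (yes refl) _ _ = mix (adj′ x) (adj G x) (adj G y) row-x (trans Dy-count (trans (≡-sym A′≡B) (≡-sym Dx-count)))
    case (no _) (yes refl) _ = mix (adj′ y) (adj G y) (adj G x) row-y (trans Dx-count (trans A′≡B (≡-sym Dy-count)))
    case (no p) (no q) (inj₁ d) = trans (count-cong (λ j → cong₂ (adj G) (via-fix j p q) (via-in j d))) (count-swap x y (adj G i))
    case (no p) (no q) (inj₂ d) = count-cong (λ j → cong₂ (adj G) (via-fix j p q) (via-out j d))

  exchanged-x : ∀ {w} → w ≢ x → Adj G y w → Adj exchanged x w
  exchanged-x {w} w≢x yw = trans (row-x w) (case (true? (D w)))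
    where
    case : (D w ≡ true) ⊎ (D w ≡ false) → (if D w then adj G y w else adj G x w) ≡ true
    case (inj₁ d) rewrite d = yw
    case (inj₂ d) = trans (cong (λ b → if b then adj G y w else adj G x w) d) (≢false⇒true (λ n → false≢true d
      (∨-introʳ {A′ w} (∧-intro (∧-intro yw (not-intro n)) (not-intro (≢⇒== w≢x))))))

  exchanged-other : ∀ {i j} → i ≢ x → i ≢ y → j ≢ x → j ≢ y → adj exchanged i j ≡ adj G i j
  exchanged-other {i} {j} p q p′ q′ = cong₂ (adj G) (via-fix j p q) (via-fix i p′ q′)

replace : (Fin k → Fin n) → Fin k → Fin n → Fin k → Fin n
replace f i₀ x i = if i == i₀ then x else f i

exchange-copy : (G : Graph n) {F : Graph k} ((f , _) : ContainsSubgraph G F) (i₀ : Fin k) (x : Fin n) → (∀ i → f i ≢ x) →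
  degree G (f i₀) ≤ degree G x →
  Σ (Graph n) λ H → H ~ G × Σ (ContainsSubgraph H F) λ c → ∀ i → proj₁ c i ≡ replace f i₀ x i
exchange-copy {n} {k} G {F} (f , inj , h) i₀ x out le = exchanged , exchanged-~ , (f′ , inj′ , h′) , λ _ → refl
  where
  open Exchange G x (f i₀) (λ e → out i₀ (≡-sym e)) le
  f′ : Fin k → Fin n
  f′ = replace f i₀ x
  at : f′ i₀ ≡ x
  at rewrite ==-refl i₀ = refl
  off : ∀ {i} → i ≢ i₀ → f′ i ≡ f i
  off ne rewrite ≢⇒== ne = refl
  inj′ : Injective _≡_ _≡_ f′
  inj′ {i} {j} e with i ≟ i₀ | j ≟ i₀
  ... | yes refl | yes refl = refl
  ... | yes refl | no q = ⊥-elim (out j (≡-sym e))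
  ... | no p | yes refl = ⊥-elim (out i e)
  ... | no p | no q = inj e
  h′ : ∀ i j → Adj F i j → Adj exchanged (f′ i) (f′ j)
  h′ i j e = case (i ≟ i₀) (j ≟ i₀)
    where
    case : Dec (i ≡ i₀) → Dec (j ≡ i₀) → Adj exchanged (f′ i) (f′ j)
    case (yes refl) (yes refl) = ⊥-elim (adj⇒≢ F e refl)
    case (yes refl) (no q) = subst₂ (Adj exchanged) (≡-sym at) (≡-sym (off q)) (exchanged-x (out j) (h i j e))
    case (no p) (yes refl) = subst₂ (Adj exchanged) (≡-sym (off p)) (≡-sym at) (adj-sym exchanged (exchanged-x (out i) (adj-sym G (h i j e))))
    case (no p) (no q) = subst₂ (Adj exchanged) (≡-sym (off p)) (≡-sym (off q))
      (trans (exchanged-other (out i) (λ e → p (inj e)) (out j) (λ e → q (inj e))) (h i j e))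

target-size : ∀ {s} {F : Graph k} → Target s F → k ≡ s + 4
target-size star     = refl
target-size path     = refl
target-size k23      = refl
target-size (cone t) = cong suc (target-size t)

count-true : ∀ k → count {k} (λ _ → true) ≡ k
count-true zero    = refl
count-true (suc k) = cong suc (count-true k)

target-degree : ∀ {s} {F : Graph k} → Target s F → ∀ i → s < degree F i
target-degree star zero = s≤s z≤n
target-degree star (suc zero) = s≤s z≤n
target-degree star (suc (suc zero)) = s≤s z≤n
target-degree star (suc (suc (suc zero))) = s≤s z≤n
target-degree path zero = s≤s z≤n
target-degree path (suc zero) = s≤s z≤n
target-degree path (suc (suc zero)) = s≤s z≤n
target-degree path (suc (suc (suc zero))) = s≤s z≤n
target-degree k23 zero = s≤s (s≤s z≤n)
target-degree k23 (suc zero) = s≤s (s≤s z≤n)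
target-degree k23 (suc (suc zero)) = s≤s (s≤s z≤n)
target-degree k23 (suc (suc (suc zero))) = s≤s (s≤s z≤n)
target-degree k23 (suc (suc (suc (suc zero)))) = s≤s (s≤s z≤n)
target-degree {k = suc k} (cone {s = s} t) zero =
  ≤-trans (m≤n+m (suc (suc s)) 2) (≤-reflexive (trans (+-comm 4 s) (trans (≡-sym (target-size t)) (≡-sym (count-true k)))))
target-degree (cone t) (suc i) = s≤s (target-degree t i)

module Apex {N : ℕ} (v : Fin N) where

  -- Isolating the vertex instead of deleting it keeps the type of vertices, so realisations before
  -- and after can be compared without renumbering.
  isolate : Graph N → Graph N
  isolate G = record
    { adj = λ i j → adj G i j ∧ (not (i == v) ∧ not (j == v))
    ; sym = λ i j → cong₂ _∧_ (sym G i j) (∧-comm (not (i == v)) (not (j == v)))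
    ; irrefl = λ i → cong (_∧ (not (i == v) ∧ not (i == v))) (irrefl G i) }

  isolate-v : (G : Graph N) → degree (isolate G) v ≡ 0
  isolate-v G = trans (count-cong {Q = λ _ → false} pt) (sum-0 {N})
    where pt : ∀ j → adj (isolate G) v j ≡ false
          pt j rewrite ==-refl v = ∧-comm (adj G v j) false

  isolate-degree : (G : Graph N) → ∀ {x} → x ≢ v → degree G x ≡ degree (isolate G) x + weight (adj G v x) 1
  isolate-degree G {x} ne with true? (adj G v x)
  ... | inj₁ e rewrite e = trans (≡-sym (count-remove (adj G x) v (adj-sym G e))) (trans (cong suc (count-cong (λ j → cong (λ b → adj G x j ∧ (not b ∧ not (j == v))) (≡-sym (≢⇒== ne))))) (+-comm 1 _))
  ... | inj₂ e rewrite e = trans (count-cong pt) (≡-sym (+-identityʳ _))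
    where pt : ∀ j → adj G x j ≡ adj (isolate G) x j
          pt j rewrite ≢⇒== ne = bool-ext (λ h → ∧-intro h (not-intro (≢⇒== (λ { refl → false≢true e (adj-sym G h) })))) (λ h → ∧-elimˡ h)

  isolate-sum : (G : Graph N) → sumF (degree G) ≡ sumF (degree (isolate G)) + 2 * degree G v
  isolate-sum G = trans (sum-cong pt) (trans (sum-+ (λ x → degree (isolate G) x + weight (adj G v x) 1) (λ x → weight (x == v) (degree G v)))
      (trans (cong₂ _+_ (sum-+ (degree (isolate G)) (λ x → weight (adj G v x) 1)) (sum-single v (degree G v)))
        (solve 2 (λ a b → a :+ b :+ b := a :+ con 2 :* b) refl (sumF (degree (isolate G))) (degree G v))))
    where
    open +-*-Solver
    pt : ∀ x → degree G x ≡ (degree (isolate G) x + weight (adj G v x) 1) + weight (x == v) (degree G v)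
    pt x = case (x ≟ v)
      where
      case : Dec (x ≡ v) → degree G x ≡ (degree (isolate G) x + weight (adj G v x) 1) + weight (x == v) (degree G v)
      case (yes refl) rewrite isolate-v G | irrefl G x | ==-refl x = refl
      case (no ne) = trans (isolate-degree G ne) (trans (≡-sym (+-identityʳ _))
        (cong (λ b → (degree (isolate G) x + weight (adj G v x) 1) + weight b (degree G v)) (≡-sym (≢⇒== ne))))

  module _ (H : Graph N) (P : Fin N → Bool) (Pv : P v ≡ false) where

    attach : Graph N
    attach = record
      { adj = λ i j → adj H i j ∨ (((i == v) ∧ P j) ∨ ((j == v) ∧ P i))
      ; sym = λ i j → cong₂ _∨_ (sym H i j) (∨-comm ((i == v) ∧ P j) ((j == v) ∧ P i))
      ; irrefl = irr }
      where
      irr : ∀ i → adj H i i ∨ (((i == v) ∧ P i) ∨ ((i == v) ∧ P i)) ≡ false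
      irr i rewrite irrefl H i with i ≟ v
      ... | no _ = refl
      ... | yes refl rewrite Pv = refl

    attach-keep : ∀ {i j} → Adj H i j → Adj attach i j
    attach-keep e = ∨-introˡ e

    attach-new : ∀ {j} → P j ≡ true → Adj attach v j
    attach-new {j} e = ∨-introʳ {adj H v j} (∨-introˡ (∧-intro (==-refl v) e))

    module _ (alone : degree H v ≡ 0) where

      nonadj : ∀ j → NonAdj H v j
      nonadj j = ≢true⇒false (λ e → <⇒≱ (subst (0 <_) (count-remove (adj H v) j e) (s≤s z≤n)) (≤-reflexive alone))

      attach-v : degree attach v ≡ count P
      attach-v = count-cong pt
        where
        pt : ∀ j → adj attach v j ≡ P j
        pt j rewrite nonadj j | ==-refl v | Pv with j == v | P j
        ... | true  | true  = refl
        ... | true  | false = refl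
        ... | false | true  = refl
        ... | false | false = refl

      attach-degree : ∀ {x} → x ≢ v → degree attach x ≡ degree H x + weight (P x) 1
      attach-degree {x} ne with true? (P x)
      ... | inj₁ e = trans (count-cong pt) (trans (count-insert (adj H x) v (nonadj-sym H (nonadj x))) (trans (+-comm 1 _) (cong (λ b → degree H x + weight b 1) (≡-sym e))))
        where pt : ∀ j → adj attach x j ≡ adj H x j ∨ (j == v)
              pt j rewrite ≢⇒== ne | e = cong (adj H x j ∨_) (∧-comm (j == v) true)
      ... | inj₂ e = trans (count-cong pt) (trans (≡-sym (+-identityʳ _)) (cong (λ b → degree H x + weight b 1) (≡-sym e)))
        where pt : ∀ j → adj attach x j ≡ adj H x j
              pt j rewrite ≢⇒== ne | e | ∧-comm (j == v) false = bool-ext (λ h → case (∨-elim {adj H x j} h)) (λ h → ∨-introˡ h)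
                where case : Adj H x j ⊎ (false ≡ true) → Adj H x j
                      case (inj₁ q) = q

-- Making a vertex adjacent to all vertices above `s`

module HavelHakimi {N : ℕ} (s : ℕ) (G₀ : Graph N) (v : Fin N) (v-high : s < degree G₀ v) (sees : count (above s G₀) ≤ suc (degree G₀ v)) where

  hi : Fin N → Bool
  hi = above s G₀

  hv : hi v ≡ true
  hv = above-intro G₀ v-high

  private
    half : Fin N → Fin N → Bool
    half i j = (i == v) ∧ (hi j ∧ not (j == v))

    W : Fin N → Fin N → Bool
    W i j = half i j ∨ half j i

    half-elim : ∀ {i j} → half i j ≡ true → i ≡ v × hi j ≡ true × j ≢ v
    half-elim {i} {j} h = let q = ∧-elimʳ {i == v} h in ==⇒≡ (∧-elimˡ h) , ∧-elimˡ q , ==⇒≢ (not-elim (∧-elimʳ {hi j} q))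

    W-sym : ∀ i j → W i j ≡ W j i
    W-sym i j = ∨-comm (half i j) (half j i)

    W-irr : ∀ i → W i i ≡ false
    W-irr i = ≢true⇒false (λ h → case (∨-elim {half i i} h))
      where case : (half i i ≡ true) ⊎ (half i i ≡ true) → ⊥
            case (inj₁ q) = let (a , _ , b) = half-elim {i} {i} q in b a
            case (inj₂ q) = let (a , _ , b) = half-elim {i} {i} q in b a

    W-supp : ∀ {i j} → W i j ≡ true → hi i ≡ true
    W-supp {i} {j} h with ∨-elim {half i j} h
    ... | inj₁ q = let (a , _) = half-elim {i} {j} q in subst (λ i → hi i ≡ true) (≡-sym a) hv
    ... | inj₂ q = proj₁ (proj₂ (half-elim {j} {i} q))

    W-v : ∀ {w} → hi w ≡ true → w ≢ v → W v w ≡ true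
    W-v {w} h ne = ∨-introˡ (∧-intro (==-refl v) (∧-intro h (not-intro (≢⇒== ne))))

    W-off : ∀ {i j} → i ≢ v → j ≢ v → W i j ≡ false
    W-off {i} {j} p q = ≢true⇒false (λ h → case (∨-elim {half i j} h))
      where case : (half i j ≡ true) ⊎ (half j i ≡ true) → ⊥
            case (inj₁ r) = p (proj₁ (half-elim {i} {j} r))
            case (inj₂ r) = q (proj₁ (half-elim {j} {i} r))

    open Stuck W W-sym W-irr hi W-supp

    low : ∀ G {a} → Adj G v a → adj G v a ∧ hi a ≡ false → hi a ≡ false
    low G va out = ≢true⇒false (λ h → false≢true out (∧-intro va h))

    -- By `sees`, a missing high neighbour `w` leaves room for a low neighbour `a` of `v`. The
    -- degree of `w` exceeds that of `a`, and `v` is a neighbour of `a` only, so `w` has a neighbour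
    -- `y` other than `a` that `a` misses. Trading `va` and `wy` for `vw` and `ay` gains a wanted
    -- edge.
    no-gap : ∀ G → G ~ G₀ → Max G → ∀ w → hi w ≡ true → w ≢ v → NonAdj G v w → ⊥
    no-gap G eq max w hw w≢v n with excess (λ i → adj G v i ∧ hi i) (adj G v) few
      where
      few : count (λ i → adj G v i ∧ hi i) < degree G v
      few = ≤-pred (≤-trans (s≤s (s≤s (count-mono {Q = λ i → (hi i ∧ not (i == v)) ∧ not (i == w)} λ i h →
            ∧-intro (∧-intro (∧-elimʳ {adj G v i} h) (not-intro (≢⇒== (λ { refl → adj⇒≢ G (∧-elimˡ {adj G v i} h) refl }))))
                    (not-intro (≢⇒== (λ { refl → false≢true n (∧-elimˡ {adj G v i} h) }))))))
          (≤-trans (≤-reflexive (trans (cong suc (count-remove (λ i → hi i ∧ not (i == v)) w (∧-intro hw (not-intro (≢⇒== w≢v))))) (count-remove hi v hv)))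
            (≤-trans sees (s≤s (≤-reflexive (≡-sym (eq v)))))))
    ... | a , va , out with excess-≢ (λ i → adj G w i ∧ adj G a i) (adj G w) a few
      where
      few : suc (count (λ i → adj G w i ∧ adj G a i)) < degree G w
      few = ≤-<-trans (count-mono-< {Q = adj G a} (λ i h → ∧-elimʳ {adj G w i} h) v (adj-sym G va) (cong (_∧ adj G a v) (nonadj-sym G n)))
             (≤-<-trans (≤-reflexive (eq a)) (≤-<-trans (above-false G₀ (low G va out)) (subst (s <_) (≡-sym (eq w)) (above-elim G₀ hw))))
    ... | y , wy , out′ , y≢a = false≢true (switch-nonadj max sw (outsideʳ (low G va out)) (W-off w≢v y≢v) (W-v hw w≢v) n) (Switched.newpq sw)
      where
      y≢v : y ≢ v
      y≢v refl = false≢true n (adj-sym G wy)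
      nay : NonAdj G a y
      nay = ≢true⇒false (λ h → false≢true out′ (∧-intro wy h))
      sw : Switched G v a w y
      sw = switch G v a w y va wy n nay (λ e → w≢v (≡-sym e)) (λ e → y≢a (≡-sym e))

  dominating : (∀ G → G ~ G₀ → (∀ w → hi w ≡ true → w ≢ v → Adj G v w) → ⊥) → ⊥
  dominating k = maximise G₀ λ G eq max → k G eq (λ w hw ne → ≢false⇒true (no-gap G eq max w hw ne))

module Strip {N : ℕ} (s : ℕ) (G₀ : Graph N) (v : Fin N) (v-high : suc s < degree G₀ v)
  (enough : suc s + 4 ≤ count (above (suc s) G₀)) (G : Graph N) (eq : G ~ G₀)
  (dom : ∀ w → above (suc s) G₀ w ≡ true → w ≢ v → Adj G v w) where

  open Apex v

  G′ : Graph N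
  G′ = isolate G

  private
    P hi : Fin N → Bool
    P = adj G v
    hi = above (suc s) G₀

  module _ {F : Graph k} (t : Target s F) where

    -- Targets have no isolated vertices, whereas `v` is isolated in every realisation of the
    -- degrees of `G′`.
    copy-≢v : ∀ H → H ~ G′ → (c : ContainsSubgraph H F) → ∀ i → proj₁ c i ≢ v
    copy-≢v H eqH (f , inj , h) i e = <⇒≱
      (≤-trans (≤-trans (s≤s z≤n) (target-degree t i)) (count-injective f inj (adj F i) (adj H (f i)) (h i)))
      (≤-reflexive (trans (eqH (f i)) (trans (cong (degree G′) e) (isolate-v G))))

    copy-low : ∀ H → H ~ G′ → (c : ContainsSubgraph H F) → ∀ i → P (proj₁ c i) ≡ false → hi (proj₁ c i) ≡ false
    copy-low H eqH c i n = ≢true⇒false (λ q → false≢true n (dom (proj₁ c i) q (copy-≢v H eqH c i)))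

    -- A copy vertex outside the neighbourhood of `v` has degree at most `s + 1`, because `v` sees
    -- all higher vertices. The copy has only `s + 4` vertices, so some higher vertex `x` other than
    -- `v` is not in it; having lost just the edge to `v`, it still has degree at least `s + 1` and
    -- can take over by `exchange-copy`. Each round leaves fewer copy vertices outside.
    pull : ∀ fuel H → H ~ G′ → (c : ContainsSubgraph H F) → count (λ i → not (P (proj₁ c i))) ≤ fuel →
      Σ (Graph N) λ H′ → H′ ~ G′ × Σ (ContainsSubgraph H′ F) λ c′ → ∀ i → P (proj₁ c′ i) ≡ true
    pull fuel H eqH c le with all-or-counterexample (λ i → P (proj₁ c i))
    ... | inj₁ h = H , eqH , c , h
    pull zero H eqH c le | inj₂ (i₀ , n) = ⊥-elim (<⇒≱ (subst (0 <_) (count-remove (λ i → not (P (proj₁ c i))) i₀ (not-intro n)) (s≤s z≤n)) le)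
    pull (suc fuel) H eqH c@(f , inj , h) le | inj₂ (i₀ , n) with excess-≢ (λ i → hi i ∧ member f i) hi v few
      where
      y = f i₀
      few : suc (count (λ i → hi i ∧ member f i)) < count hi
      few = ≤-<-trans (count-mono-< {Q = member f} (λ i q → ∧-elimʳ {hi i} q) y (member-intro f i₀) (cong (_∧ member f y) (copy-low H eqH c i₀ n)))
              (≤-<-trans (≤-trans (count-member f) (≤-reflexive (target-size t))) enough)
    ... | x , hx , out , x≢v with exchange-copy H {F} c i₀ x x∉ xy
      where
      y = f i₀
      x∉ : ∀ i → f i ≢ x
      x∉ i refl = false≢true out (∧-intro hx (member-intro f i))
      xy : degree H y ≤ degree H x
      xy = ≤-trans (≤-reflexive (eqH y)) (≤-trans (m≤m+n _ _) (≤-trans (≤-reflexive (trans (≡-sym (isolate-degree G (copy-≢v H eqH c i₀))) (eq y)))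
             (≤-trans (above-false G₀ (copy-low H eqH c i₀ n)) (≤-trans (≤-pred (≤-trans (above-elim G₀ hx) (≤-reflexive (trans (≡-sym (eq x)) (trans (isolate-degree G x≢v)
               (trans (cong (λ b → degree G′ x + weight b 1) (dom x hx x≢v)) (+-comm _ 1))))))) (≤-reflexive (≡-sym (eqH x)))))))
    ... | H′ , eqH′ , c′ , same = pull fuel H′ (λ i → trans (eqH′ i) (eqH i)) c′ (≤-pred (≤-trans (count-mono-< sub i₀ (not-intro n) at) le))
      where
      at : not (P (proj₁ c′ i₀)) ≡ false
      at = trans (cong (λ z → not (P z)) (trans (same i₀) (cong (λ b → if b then x else f i₀) (==-refl i₀)))) (cong not (dom x hx x≢v))
      sub : (λ i → not (P (proj₁ c′ i))) ⊑ (λ i → not (P (f i)))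
      sub i q with i ≟ i₀
      ... | yes refl = false≢true at q
      ... | no ne = trans (cong (λ z → not (P z)) (≡-sym (trans (same i) (cong (λ b → if b then x else f i) (≢⇒== ne))))) q

    -- Once the copy lies inside the old neighbourhood of `v`, reconnecting `v` makes it the apex of
    -- a cone over the copy and brings back the original degrees.
    restore : ∀ H → H ~ G′ → (c : ContainsSubgraph H F) → (∀ i → P (proj₁ c i) ≡ true) → Σ (Graph N) λ K → K ~ G₀ × Good (suc s) K
    restore H eqH (f , inj , h) fP = K , eqK , _ , _ , cone t , cone-copy K v (f , inj , λ i j e → attach-keep H P Pv (h i j e)) (λ i → attach-new H P Pv (fP i))
      where
      Pv : P v ≡ false
      Pv = irrefl G v
      K : Graph N
      K = attach H P Pv
      alone : degree H v ≡ 0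
      alone = trans (eqH v) (isolate-v G)
      eqK : K ~ G₀
      eqK i = trans (case (i ≟ v)) (eq i)
        where
        case : Dec (i ≡ v) → degree K i ≡ degree G i
        case (yes refl) = attach-v H P Pv alone
        case (no ne) = trans (attach-degree H P Pv alone ne) (trans (cong (_+ weight (P i) 1) (eqH i)) (≡-sym (isolate-degree G ne)))

  strip : NoGood (suc s) G₀ → NoGood s G′
  strip bad H eqH (k , F , t , c) =
    let (H′ , eqH′ , c′ , inP) = pull t _ H eqH c ≤-refl
        (K , eqK , good) = restore t H′ eqH′ c′ inP
    in bad K eqK good

-- The upper bound

medium-outside : ∀ s m {N} (G : Graph N) → count (above 0 G) ≤ s + m → s * s + 2 * (s * m) + m + 2 ≤ sumF (degree G) + s →
  45 ≤ m → count (above (s + 2) G) ≤ s → 2 ≤ count (λ i → above (s + 1) G i ∧ not (above (s + 2) G i))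
medium-outside s m G act dense m₁ τ≤ = +-cancelˡ-≤ (count (above (s + 2) G)) 2 _
  (≤-trans (Counting.medium-lower s m G act dense (≤-trans (m≤m+n 2 43) m₁) τ≤)
    (≤-trans (≤-reflexive (count-split (above (s + 1) G) (above (s + 2) G))) (+-monoˡ-≤ _ (count-mono (λ i h → ∧-elimʳ {above (s + 1) G i} h)))))

few-large : ∀ s m {N} (G : Graph N) → count (above 0 G) ≤ s + m → s * s + 2 * (s * m) + m + 2 ≤ sumF (degree G) + s →
  4 * s + 33 ≤ m → 45 ≤ m → NoGood s G → count (above (s + 2) G) ≤ s + 3 → ⊥
few-large s m {N} G act dense m₂ m₁ bad le with s ≤? count (above (s + 2) G)
... | no ¬p = FewLarge.τ+1=s s G bad (Counting.high-lower-pred s m G act dense m₂ e) (medium-outside s m G act dense m₁ (≤-trans (m≤m+n τ 1) (≤-reflexive e))) e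
  where
  τ = count (above (s + 2) G)
  e : τ + 1 ≡ s
  e = ≤-antisym (≤-trans (≤-reflexive (+-comm τ 1)) (≰⇒> ¬p)) (Counting.large-lower s m G act dense (≤-trans (m≤m+n 5 40) m₁))
... | yes p with m≤n⇒∃[o]m+o≡n p
... | i , e = case i e i≤3
  where
  τ = count (above (s + 2) G)
  i≤3 : i ≤ 3
  i≤3 = +-cancelˡ-≤ s i 3 (≤-trans (≤-reflexive e) le)
  open FewLarge s G bad (Counting.high-lower s m G act dense m₂ i i≤3 (≡-sym e))
  case : ∀ i → s + i ≡ τ → i ≤ 3 → ⊥
  case 0 e _ = τ=s (medium-outside s m G act dense m₁ (≤-reflexive e′)) e′
    where e′ : τ ≡ s
          e′ = trans (≡-sym e) (+-identityʳ s)
  case 1 e _ = τ=s+1 (≡-sym e)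
  case 2 e _ = τ=s+2 (≡-sym e)
  case 3 e _ = τ=s+3 (≡-sym e)
  case (suc (suc (suc (suc i)))) e (s≤s (s≤s (s≤s ())))

claw : ∀ {N} (G : Graph N) x → 2 < degree G x → Good 0 G
claw G x lt with enumerate 3 (adj G x) lt
... | y , inj , y∈ = good-star G 0 x (y zero) (y (suc zero)) (y (suc (suc zero))) (λ ())
  (λ q → FP.0≢1+n (inj q)) (λ q → FP.0≢1+n (inj q)) (λ q → FP.0≢1+n (FP.suc-injective (inj q)))
  (y∈ zero) (y∈ (suc zero)) (y∈ (suc (suc zero))) (λ ()) (λ ()) (λ ()) (λ ()) (λ ())

upper-bound : ∀ s m {N} (G : Graph N) → count (above 0 G) ≤ s + m → s * s + 2 * (s * m) + m + 2 ≤ sumF (degree G) + s →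
  4 * s + 33 ≤ m → 45 ≤ m → NoGood s G → ⊥
upper-bound s m G act dense m₂ m₁ bad with count (above (s + 2) G) ≤? s + 3
... | yes le = few-large s m G act dense m₂ m₁ bad le
upper-bound zero m {N} G act dense m₂ m₁ bad | no ¬le with excess (λ _ → false) (above 2 G) (≤-<-trans (≤-trans (≤-reflexive (sum-0 {N})) z≤n) (≰⇒> ¬le))
... | x , hx , _ = bad G (λ _ → refl) (claw G x (above-elim G hx))
upper-bound s@(suc s′) m {N} G act dense m₂ m₁ bad | no ¬le with all-or-counterexample (λ v → suc (degree G v) <ᵇ count (above s G))
... | inj₁ spread = case (D ≤? 2 * s + 4)
  where
  ts = topSet s G (≤-trans (≤-reflexive (+-suc s 3)) (≰⇒> ¬le))
  open TopSet ts
  open Counting s m G act dense using (high-many)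
  S⊑ : S ⊑ above s G
  S⊑ i h = above-intro G (≤-trans (≤-trans (≤-trans (s≤s (m≤m+n s 2)) (≤-reflexive (≡-sym (+-suc s 2)))) low) (top i h))
  case : Dec (D ≤ 2 * s + 4) → ⊥
  case (yes d) = Top.spread s G bad ts (high-many m₁ m₂ (s≤s z≤n) (λ i → <ᵇ-elim (spread i)) D S d size S⊑ out)
  case (no d)  = Top.concentrated s G bad ts (≤-trans (≤-reflexive (+-suc (2 * s) 4)) (≰⇒> d))
... | inj₂ (v , no-spread) = HavelHakimi.dominating s G v v-high sees λ H eq dom →
    upper-bound s′ m (Apex.isolate v H) (act′ H eq) (dense′ H eq) (≤-trans (+-monoˡ-≤ 33 (*-monoʳ-≤ 4 (n≤1+n s′))) m₂) m₁
      (Strip.strip s′ G v v-high enough H eq dom bad)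
  where
  enough : s + 4 ≤ count (above s G)
  enough = ≤-trans (≤-trans (≤-reflexive (+-suc s 3)) (≰⇒> ¬le)) (count-mono {P = above (s + 2) G} {Q = above s G} (λ i h → above-intro G (≤-<-trans (m≤m+n s 2) (above-elim G h))))
  sees : count (above s G) ≤ suc (degree G v)
  sees = ≮⇒≥ (λ lt → false≢true no-spread (<ᵇ-intro lt))
  v-high : s < degree G v
  v-high = ≤-pred (≤-trans (≤-trans (m≤m+n (suc (suc s)) 2) (≤-reflexive (+-comm (suc (suc s)) 2))) (≤-trans (≤-reflexive (+-comm 4 s)) (≤-trans enough sees)))
  act′ : ∀ H → H ~ G → count (above 0 (Apex.isolate v H)) ≤ s′ + m
  act′ H eq = ≤-pred (≤-trans (count-mono-< sub v (above-intro G (≤-<-trans z≤n v-high)) gone) act)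
    where
    sub : above 0 (Apex.isolate v H) ⊑ above 0 G
    sub i h = above-intro G (≤-trans (above-elim (Apex.isolate v H) h) (≤-trans (count-mono {P = adj (Apex.isolate v H) i} {Q = adj H i} (λ j e → ∧-elimˡ e)) (≤-reflexive (eq i))))
    gone : above 0 (Apex.isolate v H) v ≡ false
    gone = cong (0 <ᵇ_) (Apex.isolate-v v H)
  -- The vertex `v` has at most `s′ + m` neighbours, so the degree sum falls by at most `2(s′ + m)`,
  -- exactly the difference between the thresholds for `s` and `s′`.
  dense′ : ∀ H → H ~ G → s′ * s′ + 2 * (s′ * m) + m + 2 ≤ sumF (degree (Apex.isolate v H)) + s′
  dense′ H eq = +-cancelʳ-≤ (2 * s′ + 1 + 2 * m) _ _ (≤-trans (≤-reflexive
      (solve 2 (λ t m → t :* t :+ con 2 :* (t :* m) :+ m :+ con 2 :+ (con 2 :* t :+ con 1 :+ con 2 :* m) := (con 1 :+ t) :* (con 1 :+ t) :+ con 2 :* ((con 1 :+ t) :* m) :+ m :+ con 2) refl s′ m))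
      (≤-trans dense (≤-trans (≤-reflexive (cong (_+ s) (trans (sum-cong (λ i → ≡-sym (eq i))) (Apex.isolate-sum v H))))
      (≤-trans (+-monoˡ-≤ s (+-monoʳ-≤ (sumF (degree (Apex.isolate v H))) (*-monoʳ-≤ 2 (≤-trans (≤-reflexive (eq v)) (≤-pred (Counting.degree-< s m G act dense v (above-intro G (≤-<-trans z≤n v-high))))))))
        (≤-reflexive (solve 3 (λ σ t m → σ :+ con 2 :* (t :+ m) :+ (con 1 :+ t) := σ :+ t :+ (con 2 :* t :+ con 1 :+ con 2 :* m)) refl (sumF (degree (Apex.isolate v H))) s′ m))))))
    where open +-*-Solver

-- The lower bound

coneN : ∀ s → Graph k → Graph (s + k)
coneN zero    F = F
coneN (suc s) F = Cone (coneN s F)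

degree-<-size : (G : Graph n) (i : Fin n) → degree G i < n
degree-<-size {n} G i = ≤-trans (count-mono-< {Q = λ _ → true} (λ _ _ → refl) i refl (irrefl G i)) (≤-reflexive (count-true n))

cone-nonIncreasing : (F : Graph k) → NonIncreasing (degree F) → NonIncreasing (degree (Cone F))
cone-nonIncreasing F h zero    zero    le = ≤-refl
cone-nonIncreasing {k} F h zero (suc j) le = ≤-trans (degree-<-size F j) (≤-reflexive (≡-sym (count-true k)))
cone-nonIncreasing F h (suc i) (suc j) le = s≤s (h i j (≤-pred le))

coneN-nonIncreasing : ∀ s (F : Graph k) → NonIncreasing (degree F) → NonIncreasing (degree (coneN s F))
coneN-nonIncreasing zero    F h = h
coneN-nonIncreasing (suc s) F h = cone-nonIncreasing (coneN s F) (coneN-nonIncreasing s F h)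

cone-sum : (F : Graph k) → sumF (degree (Cone F)) ≡ k + (k + sumF (degree F))
cone-sum {k} F = cong₂ _+_ (count-true k) (trans (sum-+ (λ _ → 1) (degree F)) (cong (_+ sumF (degree F)) (count-true k)))

coneN-sum : ∀ s {m} (R : Graph m) → sumF (degree (coneN s R)) + s ≡ s * s + 2 * (s * m) + sumF (degree R)
coneN-sum zero R = +-identityʳ _
coneN-sum (suc s) {m} R = trans (cong (_+ suc s) (cone-sum (coneN s R)))
  (trans (solve 3 (λ s m t → s :+ m :+ (s :+ m :+ t) :+ (con 1 :+ s) := (t :+ s) :+ (con 2 :* s :+ con 2 :* m :+ con 1)) refl s m (sumF (degree (coneN s R))))
  (trans (cong (_+ (2 * s + 2 * m + 1)) (coneN-sum s R))
    (solve 3 (λ s m t → s :* s :+ con 2 :* (s :* m) :+ t :+ (con 2 :* s :+ con 2 :* m :+ con 1) := (con 1 :+ s) :* (con 1 :+ s) :+ con 2 :* ((con 1 :+ s) :* m) :+ t) refl s m (sumF (degree R)))))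
  where open +-*-Solver

coneN-hub : ∀ s {m} (R : Graph m) (i : Fin s) → suc (degree (coneN s R) (i ↑ˡ m)) ≡ s + m
coneN-hub (suc s) {m} R zero    = cong suc (count-true (s + m))
coneN-hub (suc s) R (suc i) = cong suc (coneN-hub s R i)

coneN-rest : ∀ s {m} (R : Graph m) (j : Fin m) → degree (coneN s R) (s ↑ʳ j) ≡ s + degree R j
coneN-rest zero    R j = refl
coneN-rest (suc s) R j = cong suc (coneN-rest s R j)

-- Perfect and near-perfect matchings

addEdgeAdj : Graph k → Fin (2 + k) → Fin (2 + k) → Bool
addEdgeAdj F zero (suc zero) = true
addEdgeAdj F (suc zero) zero = true
addEdgeAdj F (suc (suc i)) (suc (suc j)) = adj F i j
addEdgeAdj F _ _ = false

addEdge : Graph k → Graph (2 + k)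
addEdge F = record { adj = addEdgeAdj F ; sym = sy ; irrefl = ir }
  where
  sy : ∀ i j → addEdgeAdj F i j ≡ addEdgeAdj F j i
  sy zero zero = refl
  sy zero (suc zero) = refl
  sy zero (suc (suc j)) = refl
  sy (suc zero) zero = refl
  sy (suc zero) (suc zero) = refl
  sy (suc zero) (suc (suc j)) = refl
  sy (suc (suc i)) zero = refl
  sy (suc (suc i)) (suc zero) = refl
  sy (suc (suc i)) (suc (suc j)) = sym F i j
  ir : ∀ i → addEdgeAdj F i i ≡ false
  ir zero = refl
  ir (suc zero) = refl
  ir (suc (suc i)) = irrefl F i

matching : ∀ q → Graph (q * 2)
matching zero    = Edgeless 0
matching (suc q) = addEdge (matching q)

matching-degree : ∀ q i → degree (matching q) i ≡ 1
matching-degree (suc q) zero = cong suc (sum-0 {q * 2})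
matching-degree (suc q) (suc zero) = cong suc (sum-0 {q * 2})
matching-degree (suc q) (suc (suc i)) = matching-degree q i

cherryAdj : Graph k → Fin (3 + k) → Fin (3 + k) → Bool
cherryAdj F zero (suc zero) = true
cherryAdj F zero (suc (suc zero)) = true
cherryAdj F (suc zero) zero = true
cherryAdj F (suc (suc zero)) zero = true
cherryAdj F (suc (suc (suc i))) (suc (suc (suc j))) = adj F i j
cherryAdj F _ _ = false

addCherry : Graph k → Graph (3 + k)
addCherry F = record { adj = cherryAdj F ; sym = sy ; irrefl = ir }
  where
  sy : ∀ i j → cherryAdj F i j ≡ cherryAdj F j i
  sy zero zero = refl
  sy zero (suc zero) = refl
  sy zero (suc (suc zero)) = refl
  sy zero (suc (suc (suc j))) = refl
  sy (suc zero) zero = refl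
  sy (suc zero) (suc zero) = refl
  sy (suc zero) (suc (suc zero)) = refl
  sy (suc zero) (suc (suc (suc j))) = refl
  sy (suc (suc zero)) zero = refl
  sy (suc (suc zero)) (suc zero) = refl
  sy (suc (suc zero)) (suc (suc zero)) = refl
  sy (suc (suc zero)) (suc (suc (suc j))) = refl
  sy (suc (suc (suc i))) zero = refl
  sy (suc (suc (suc i))) (suc zero) = refl
  sy (suc (suc (suc i))) (suc (suc zero)) = refl
  sy (suc (suc (suc i))) (suc (suc (suc j))) = sym F i j
  ir : ∀ i → cherryAdj F i i ≡ false
  ir zero = refl
  ir (suc zero) = refl
  ir (suc (suc zero)) = refl
  ir (suc (suc (suc i))) = irrefl F i

-- At most one vertex has degree two, so any four degrees add up to at most five. For a perfect
-- matching the choice of `centre` is arbitrary.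
record Sparse {m : ℕ} (R : Graph m) : Set where
  field
    centre : Fin m
    bound  : ∀ j → degree R j ≤ 1 + weight (j == centre) 1
    sorted : NonIncreasing (degree R)

matching-sparse : ∀ q → Sparse (matching (suc q))
matching-sparse q = record { centre = zero ; bound = λ j → ≤-trans (≤-reflexive (matching-degree (suc q) j)) (m≤m+n 1 _)
  ; sorted = λ i j _ → ≤-reflexive (trans (matching-degree (suc q) j) (≡-sym (matching-degree (suc q) i))) }

matching-sum : ∀ q → sumF (degree (matching q)) ≡ q * 2
matching-sum q = trans (sum-cong (matching-degree q)) (count-true (q * 2))

cherry-degree : ∀ q i → degree (addCherry (matching q)) (suc i) ≡ 1
cherry-degree q zero = cong suc (sum-0 {q * 2})
cherry-degree q (suc zero) = cong suc (sum-0 {q * 2})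
cherry-degree q (suc (suc i)) = matching-degree q i

cherry-centre : ∀ q → degree (addCherry (matching q)) zero ≡ 2
cherry-centre q = cong (λ z → suc (suc z)) (sum-0 {q * 2})

cherry-sparse : ∀ q → Sparse (addCherry (matching q))
cherry-sparse q = record { centre = zero ; bound = bd ; sorted = so }
  where
  bd : ∀ j → degree (addCherry (matching q)) j ≤ 1 + weight (j == zero) 1
  bd zero    = ≤-reflexive (cherry-centre q)
  bd (suc j) = ≤-reflexive (cherry-degree q j)
  so : NonIncreasing (degree (addCherry (matching q)))
  so zero    zero    _ = ≤-refl
  so zero    (suc j) _ = ≤-trans (≤-reflexive (cherry-degree q j)) (≤-trans (s≤s z≤n) (≤-reflexive (≡-sym (cherry-centre q))))
  so (suc i) (suc j) _ = ≤-reflexive (trans (cherry-degree q j) (≡-sym (cherry-degree q i)))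

cherry-sum : ∀ q → sumF (degree (addCherry (matching q))) ≡ 4 + q * 2
cherry-sum q = cong₂ _+_ (cherry-centre q) (trans (sum-cong (cherry-degree q)) (count-true (2 + q * 2)))

-- Any four vertices of `H` span at least three edges

removedEdge-large : ∀ a b → removedEdge a (7 + b) ≡ false
removedEdge-large 0 b = refl
removedEdge-large 1 b = refl
removedEdge-large 2 b = refl
removedEdge-large 3 b = refl
removedEdge-large 4 b = refl
removedEdge-large 5 b = refl
removedEdge-large (suc (suc (suc (suc (suc (suc a)))))) b = refl

-- No edge is removed at a vertex from 7 onwards. Truncating indices at 7 therefore makes the
-- statement independent of `s`, and it can be settled by evaluation.
removedEdge-cap : ∀ a b → removedEdge a b ≡ removedEdge (a ⊓ 7) (b ⊓ 7)
removedEdge-cap a b with a ≤? 7 | b ≤? 7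
... | yes p | yes q = cong₂ removedEdge (≡-sym (m≤n⇒m⊓n≡m p)) (≡-sym (m≤n⇒m⊓n≡m q))
... | no p  | _ with m≤n⇒∃[o]m+o≡n (<⇒≤ (≰⇒> p))
...   | _ , refl = refl
removedEdge-cap a b | yes p | no q with m≤n⇒∃[o]m+o≡n (<⇒≤ (≰⇒> q))
...   | o , refl = trans (removedEdge-large a o) (≡-sym (removedEdge-large (a ⊓ 7) (o ⊓ 0)))

cap : ℕ → Fin 8
cap a = fromℕ< {a ⊓ 7} (s≤s (m⊓n≤n a 7))

kept : Fin 8 → Fin 8 → Bool
kept a b = not (removed (toℕ a) (toℕ b))

kept-cap : ∀ a b → not (removed a b) ≡ kept (cap a) (cap b)
kept-cap a b = cong not (cong₂ _∨_ (step a b) (step b a))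
  where step : ∀ a b → removedEdge a b ≡ removedEdge (toℕ (cap a)) (toℕ (cap b))
        step a b = trans (removedEdge-cap a b) (cong₂ removedEdge (≡-sym (FP.toℕ-fromℕ< _)) (≡-sym (FP.toℕ-fromℕ< _)))

-- the value 7 stands for all vertices outside K₃ ∪ P₃
distinct : Fin 8 → Fin 8 → Bool
distinct a b = not (a == b) ∨ (6 <ᵇ toℕ a)

distinct-cap : ∀ {a b} → a ≢ b → distinct (cap a) (cap b) ≡ true
distinct-cap {a} {b} ne with a ≤? 6
... | no p = ∨-introʳ {not (cap a == cap b)} (cong (6 <ᵇ_) (trans (FP.toℕ-fromℕ< _) (m≥n⇒m⊓n≡n (≰⇒> p))))
... | yes p = ∨-introˡ (not-intro (≢⇒== (λ e → ne (eq (trans (≡-sym (FP.toℕ-fromℕ< _)) (trans (cong toℕ e) (FP.toℕ-fromℕ< _)))))))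
  where
  eq : a ⊓ 7 ≡ b ⊓ 7 → a ≡ b
  eq e with b ≤? 7
  ... | yes q = trans (≡-sym (m≤n⇒m⊓n≡m (m≤n⇒m≤1+n p))) (trans e (m≤n⇒m⊓n≡m q))
  ... | no q = ⊥-elim (<⇒≢ (s≤s p) (trans (≡-sym (m≤n⇒m⊓n≡m (m≤n⇒m≤1+n p))) (trans e (m≥n⇒m⊓n≡n (<⇒≤ (≰⇒> q))))))

pairs : Fin 8 → Fin 8 → Fin 8 → Fin 8 → ℕ
pairs a b c d = weight (kept a b) 1 + (weight (kept a c) 1 + (weight (kept a d) 1 + (weight (kept b c) 1 + (weight (kept b d) 1 + weight (kept c d) 1))))

violation : Fin 8 → Fin 8 → Fin 8 → Fin 8 → Bool
violation a b c d = distinct a d ∧ (distinct b d ∧ (distinct c d ∧ (pairs a b c d <ᵇ 3)))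

-- distinctness is tested early to prune the search over all quadruples
violation₃ : Fin 8 → Fin 8 → Fin 8 → Bool
violation₃ a b c = distinct a c ∧ (distinct b c ∧ any (violation a b c))

violation₂ : Fin 8 → Fin 8 → Bool
violation₂ a b = distinct a b ∧ any (violation₃ a b)

-- Four vertices contain at most three edges of K₃ ∪ P₃, out of six pairs; all cases are evaluated.
no-violation : any (λ a → any (violation₂ a)) ≡ false
no-violation = refl

four-span-three : ∀ {a b c d} → distinct a b ≡ true → distinct a c ≡ true → distinct a d ≡ true → distinct b c ≡ true → distinct b d ≡ true → distinct c d ≡ true →
  3 ≤ pairs a b c d
four-span-three {a} {b} {c} {d} ab ac ad bc bd cd = ≮⇒≥ λ lt → false≢true no-violation
  (any-intro (λ a → any (violation₂ a)) a (any-intro (violation₂ a) b (∧-intro ab (any-intro (violation₃ a b) c (∧-intro ac (∧-intro bc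
    (any-intro (violation a b c) d (∧-intro ad (∧-intro bd (∧-intro cd (<ᵇ-intro lt)))))))))))

half : (Fin 4 → Fin 4 → ℕ) → ℕ
half w = w zero (suc zero) + (w zero (suc (suc zero)) + (w zero (suc (suc (suc zero))) + (w (suc zero) (suc (suc zero)) + (w (suc zero) (suc (suc (suc zero))) + w (suc (suc zero)) (suc (suc (suc zero)))))))

double-half : (w : Fin 4 → Fin 4 → ℕ) → (∀ i j → w i j ≡ w j i) → 2 * half w ≤ sumF (λ i → sumF (w i))
double-half w w-sym = ≤-trans (m≤m+n (2 * half w) diag) (≤-reflexive alg)
  where
  diag : ℕ
  diag = w zero zero + (w (suc zero) (suc zero) + (w (suc (suc zero)) (suc (suc zero)) + w (suc (suc (suc zero))) (suc (suc (suc zero)))))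
  alg : 2 * half w + diag ≡ sumF (λ i → sumF (w i))
  alg rewrite w-sym (suc zero) zero | w-sym (suc (suc zero)) zero | w-sym (suc (suc (suc zero))) zero | w-sym (suc (suc zero)) (suc zero)
            | w-sym (suc (suc (suc zero))) (suc zero) | w-sym (suc (suc (suc zero))) (suc (suc zero)) =
    solve 10 (λ d₀ d₁ d₂ d₃ a b c d e f → con 2 :* (a :+ (b :+ (c :+ (d :+ (e :+ f))))) :+ (d₀ :+ (d₁ :+ (d₂ :+ d₃)))
        := (d₀ :+ (a :+ (b :+ (c :+ con 0)))) :+ ((a :+ (d₁ :+ (d :+ (e :+ con 0)))) :+ ((b :+ (d :+ (d₂ :+ (f :+ con 0)))) :+ ((c :+ (e :+ (f :+ (d₃ :+ con 0)))) :+ con 0)))) refl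
      (w zero zero) (w (suc zero) (suc zero)) (w (suc (suc zero)) (suc (suc zero))) (w (suc (suc (suc zero))) (suc (suc (suc zero))))
      (w zero (suc zero)) (w zero (suc (suc zero))) (w zero (suc (suc (suc zero)))) (w (suc zero) (suc (suc zero))) (w (suc zero) (suc (suc (suc zero)))) (w (suc (suc zero)) (suc (suc (suc zero))))
    where open +-*-Solver

-- Excluding `H` from every realisation

module _ {s m : ℕ} {R : Graph m} (sparse : Sparse R) where
  open Sparse sparse

  private
    d : Seq (s + m)
    d = degree (coneN s R)

    hub : Fin (s + m) → Bool
    hub i with splitAt s i
    ... | inj₁ _ = true
    ... | inj₂ _ = false

    hub-elim : ∀ i → hub i ≡ true → suc (d i) ≡ s + m
    hub-elim i h with splitAt s i in e
    ... | inj₁ j = trans (cong (λ i → suc (d i)) (≡-sym (FP.splitAt⁻¹-↑ˡ e))) (coneN-hub s R j)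

    rest-elim : ∀ i → hub i ≡ false → d i ≤ s + (1 + weight (i == s ↑ʳ centre) 1)
    rest-elim i h with splitAt s i in e
    ... | inj₂ j rewrite ≡-sym (FP.splitAt⁻¹-↑ʳ {s} e) = ≤-trans (≤-reflexive (coneN-rest s R j)) (+-monoʳ-≤ s (≤-trans (bound j) (s≤s (bool-≤ {j == centre} (λ q → subst (λ c → (s ↑ʳ j == s ↑ʳ c) ≡ true) (==⇒≡ q) (==-refl (s ↑ʳ j)))))))

    count-hub : count hub ≡ s
    count-hub = ≤-antisym upper lower
      where
      ↑ˡ-hub : ∀ i → hub (i ↑ˡ m) ≡ true
      ↑ˡ-hub i rewrite FP.splitAt-↑ˡ s i m = refl
      ↑ʳ-hub : ∀ j → hub (s ↑ʳ j) ≡ false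
      ↑ʳ-hub j rewrite FP.splitAt-↑ʳ s m j = refl
      lower : s ≤ count hub
      lower = ≤-trans (≤-reflexive (≡-sym (count-true s))) (count-injective (_↑ˡ m) (λ {i} {j} → FP.↑ˡ-injective m i j) (λ _ → true) hub (λ i _ → ↑ˡ-hub i))
      upper : count hub ≤ s
      upper = +-cancelʳ-≤ m _ _ (≤-trans (+-monoʳ-≤ (count hub) (≤-trans (≤-reflexive (≡-sym (count-true m)))
                (count-injective (s ↑ʳ_) (λ {i} {j} → FP.↑ʳ-injective s i j) (λ _ → true) (λ i → not (hub i)) (λ j _ → not-intro (↑ʳ-hub j)))))
              (≤-reflexive (trans (≡-sym (count-split (λ _ → true) hub)) (count-true (s + m)))))

  not-potential : ¬ PotentiallyGraphic (KminusK3P3 (3 + s)) d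
  not-potential (G , real , f , f-inj , f-hom) = <⇒≱ (s≤s (≤-reflexive refl)) (≤-trans six (≤-trans (sum-mono at-most) five))
    where
    H = KminusK3P3 (3 + s)

    -- The degree of a hub is one less than the number of vertices, so it dominates in any
    -- realisation `G`, not only in `coneN s R`.
    hub-adj : ∀ {i j} → hub i ≡ true → i ≢ j → Adj G i j
    hub-adj {i} {j} h ne = ≢false⇒true λ n → <⇒≱ (s≤s (≤-trans (s≤s (count-mono {Q = λ k → not (k == i) ∧ not (k == j)} (λ k e →
          ∧-intro (not-intro {k == i} (≢⇒== (λ { refl → adj⇒≢ G e refl }))) (not-intro {k == j} (≢⇒== (λ { refl → false≢true n e })))))) ≤-refl))
        (≤-trans (≤-reflexive (trans (cong suc (count-remove (λ k → not (k == i)) j (not-intro (≢⇒== (λ q → ne (≡-sym q)))))) (trans (count-remove (λ _ → true) i refl) (trans (count-true (s + m)) (≡-sym (hub-elim i h))))))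
          (s≤s (≤-reflexive (≡-sym (real i)))))

    outside : 4 ≤ count (λ a → not (hub (f a)))
    outside = +-cancelˡ-≤ s 4 _ (≤-trans (≤-reflexive (trans (+-comm s 4) (trans (≡-sym (count-true (4 + s))) (count-split (λ _ → true) (λ a → hub (f a))))))
      (+-monoˡ-≤ _ (≤-trans (count-injective f f-inj (λ a → hub (f a)) hub (λ _ h → h)) (≤-reflexive count-hub))))

    listing = enumerate 4 (λ a → not (hub (f a))) outside
    e : Fin 4 → Fin (4 + s)
    e = proj₁ listing
    e-inj : Injective _≡_ _≡_ e
    e-inj = proj₁ (proj₂ listing)
    e-out : ∀ i → hub (f (e i)) ≡ false
    e-out i = not-elim (proj₂ (proj₂ listing) i)

    -- All `s` hubs are neighbours of `f (e i)`; what is left of its degree bounds its neighbours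
    -- among the four vertices.
    at-most : ∀ i → count (λ j → adj H (e i) (e j)) ≤ 1 + weight (f (e i) == s ↑ʳ centre) 1
    at-most i = +-cancelˡ-≤ s _ _ (≤-trans (+-mono-≤ hubs others) (≤-trans (≤-reflexive (≡-sym (count-split (adj G x) hub))) (≤-trans (≤-reflexive (real x)) (rest-elim x (e-out i)))))
      where
      x = f (e i)
      hubs : s ≤ count (λ j → adj G x j ∧ hub j)
      hubs = ≤-trans (≤-reflexive (≡-sym count-hub)) (count-mono {P = hub} {Q = λ j → adj G x j ∧ hub j} (λ j h → ∧-intro (adj-sym G {j} {x} (hub-adj h (λ { refl → false≢true (e-out i) h }))) h))
      others : count (λ j → adj H (e i) (e j)) ≤ count (λ j → adj G x j ∧ not (hub j))
      others = count-injective (λ j → f (e j)) (λ q → e-inj (f-inj q)) _ _ (λ j h → ∧-intro (f-hom (e i) (e j) h) (not-intro (e-out j)))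

    five : sumF (λ i → 1 + weight (f (e i) == s ↑ʳ centre) 1) ≤ 5
    five = ≤-trans (≤-reflexive (sum-+ {4} (λ _ → 1) (λ i → weight (f (e i) == s ↑ʳ centre) 1))) (+-monoʳ-≤ 4
      (≤-trans (count-injective (λ i → f (e i)) (λ q → e-inj (f-inj q)) _ (λ x → x == s ↑ʳ centre) (λ _ h → h)) (≤-reflexive (count-single (s ↑ʳ centre)))))

    w : Fin 4 → Fin 4 → ℕ
    w i j = weight (adj H (e i) (e j)) 1

    w-sym : ∀ i j → w i j ≡ w j i
    w-sym i j = cong (λ b → weight b 1) (sym H (e i) (e j))

    w-kept : ∀ i j → i ≢ j → w i j ≡ weight (kept (cap (toℕ (e i))) (cap (toℕ (e j)))) 1
    w-kept i j ne = cong (λ b → weight b 1) (trans (cong (λ b → not b ∧ not (removed (toℕ (e i)) (toℕ (e j)))) (≢⇒== (λ q → ne (e-inj q)))) (kept-cap (toℕ (e i)) (toℕ (e j))))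

    apart : ∀ i j → i ≢ j → distinct (cap (toℕ (e i))) (cap (toℕ (e j))) ≡ true
    apart i j ne = distinct-cap (λ q → ne (e-inj (FP.toℕ-injective q)))

    three : 3 ≤ half w
    three = ≤-trans (four-span-three {cap (toℕ (e zero))} {cap (toℕ (e (suc zero)))} {cap (toℕ (e (suc (suc zero))))} {cap (toℕ (e (suc (suc (suc zero)))))} (apart zero (suc zero) (λ ())) (apart zero (suc (suc zero)) (λ ())) (apart zero (suc (suc (suc zero))) (λ ()))
        (apart (suc zero) (suc (suc zero)) (λ ())) (apart (suc zero) (suc (suc (suc zero))) (λ ())) (apart (suc (suc zero)) (suc (suc (suc zero))) (λ ())))
      (≤-reflexive (≡-sym (cong₂ _+_ (w-kept _ _ (λ ())) (cong₂ _+_ (w-kept _ _ (λ ())) (cong₂ _+_ (w-kept _ _ (λ ())) (cong₂ _+_ (w-kept _ _ (λ ())) (cong₂ _+_ (w-kept _ _ (λ ())) (w-kept _ _ (λ ())))))))))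

    six : 6 ≤ sumF (λ i → count (λ j → adj H (e i) (e j)))
    six = ≤-trans (*-monoʳ-≤ 2 three) (double-half w w-sym)

  sigma-lower : ∀ l′ → SigmaProperty (KminusK3P3 (3 + s)) (s + m) l′ → sumF d < l′
  sigma-lower l′ prop = ≰⇒> λ le → not-potential (prop d (coneN-nonIncreasing s R sorted , coneN s R , λ _ → refl) le)

-- The theorem

contains-trans : {k l : ℕ} {G : Graph n} {F : Graph k} {H : Graph l} → ContainsSubgraph G F → ContainsSubgraph F H → ContainsSubgraph G H
contains-trans (f , f-inj , f-hom) (g , g-inj , g-hom) = (λ i → f (g i)) , (λ e → g-inj (f-inj e)) , λ i j e → f-hom (g i) (g j) (g-hom i j e)

cone-contains : {l : ℕ} {F : Graph k} {H : Graph l} → ContainsSubgraph F H → ContainsSubgraph (Cone F) (Cone H)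
cone-contains {k} {l} {F} {H} (f , inj , hom) = f′ , inj′ , hom′
  where
  f′ : Fin (suc l) → Fin (suc k)
  f′ zero    = zero
  f′ (suc i) = suc (f i)
  inj′ : Injective _≡_ _≡_ f′
  inj′ {zero}  {zero}  e = refl
  inj′ {suc i} {suc j} e = cong suc (inj (FP.suc-injective e))
  hom′ : ∀ i j → coneAdj H i j ≡ true → coneAdj F (f′ i) (f′ j) ≡ true
  hom′ zero    (suc j) e = refl
  hom′ (suc i) zero    e = refl
  hom′ (suc i) (suc j) e = hom i j e

-- K₃ ∪ P₃ occupies the first seven vertices, so the vertex gained from `r` to `suc r` is the last
-- one, while the apex of a cone is `zero`. The map sends the last vertex to `zero` and shifts the
-- others.
cone-KminusK3P3 : ∀ r → ContainsSubgraph (Cone (KminusK3P3 r)) (KminusK3P3 (suc r))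
cone-KminusK3P3 r = f , inj , hom
  where
  f : Fin (suc (suc r)) → Fin (suc (suc r))
  f i with view i
  ... | ‵fromℕ     = zero
  ... | ‵inject₁ j = suc j
  inj : Injective _≡_ _≡_ f
  inj {i} {j} e with view i | view j
  ... | ‵fromℕ     | ‵fromℕ     = refl
  ... | ‵inject₁ a | ‵inject₁ b = cong inject₁ (FP.suc-injective e)
  hom : ∀ i j → adj (KminusK3P3 (suc r)) i j ≡ true → coneAdj (KminusK3P3 r) (f i) (f j) ≡ true
  hom i j e with view i | view j
  ... | ‵fromℕ     | ‵fromℕ     = false≢true (irrefl (KminusK3P3 (suc r)) (fromℕ (suc r))) e
  ... | ‵fromℕ     | ‵inject₁ b = refl
  ... | ‵inject₁ a | ‵fromℕ     = refl
  ... | ‵inject₁ a | ‵inject₁ b = ∧-intro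
    (not-intro (≢⇒== (λ { refl → false≢true (irrefl (KminusK3P3 (suc r)) (inject₁ a)) e })))
    (trans (≡-sym (cong₂ (λ x y → not (removed x y)) (FP.toℕ-inject₁ a) (FP.toℕ-inject₁ b))) (∧-elimʳ {not (inject₁ a == inject₁ b)} e))

check-contains : {l : ℕ} (F : Graph k) (H : Graph l) (f : Fin l → Fin k) →
  any (λ i → any (λ j → not (i == j) ∧ (f i == f j))) ≡ false →
  any (λ i → any (λ j → adj H i j ∧ not (adj F (f i) (f j)))) ≡ false → ContainsSubgraph F H
check-contains F H f c₁ c₂ = f , inj , hom
  where
  inj : Injective _≡_ _≡_ f
  inj {i} {j} e with i ≟ j
  ... | yes q = q
  ... | no ne = false≢true (any-false (λ j → not (i == j) ∧ (f i == f j)) (any-false (λ i → any (λ j → not (i == j) ∧ (f i == f j))) c₁ i) j)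
                  (∧-intro (not-intro (≢⇒== ne)) (subst (λ x → (f i == x) ≡ true) e (==-refl (f i))))
  hom : ∀ i j → Adj H i j → Adj F (f i) (f j)
  hom i j e = ≢false⇒true λ n → false≢true
    (any-false (λ j → adj H i j ∧ not (adj F (f i) (f j))) (any-false (λ i → any (λ j → adj H i j ∧ not (adj F (f i) (f j)))) c₂ i) j) (∧-intro e (not-intro n))

target-contains : ∀ s {F : Graph k} → Target (3 + s) F → ContainsSubgraph F (KminusK3P3 (6 + s))
-- Vertices 0 to 2 carry the removed triangle and 3 to 6 the removed path. The triangle goes to the
-- leaves of the star, the path to the complement of `P₃`, and for `K₂₃` the triangle goes to the
-- larger side and the path edge 34 to the smaller.
target-contains zero (cone (cone (cone star))) = check-contains (Cone (Cone (Cone (Cone (Edgeless 3))))) (KminusK3P3 6) (lookup (# 4 ∷ # 5 ∷ # 6 ∷ # 0 ∷ # 1 ∷ # 2 ∷ # 3 ∷ [])) refl refl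
target-contains zero (cone (cone (cone path))) = check-contains (Cone (Cone (Cone P₃))) (KminusK3P3 6) (lookup (# 0 ∷ # 1 ∷ # 2 ∷ # 4 ∷ # 5 ∷ # 6 ∷ # 3 ∷ [])) refl refl
target-contains zero (cone (cone k23))         = check-contains (Cone (Cone K₂₃)) (KminusK3P3 6) (lookup (# 4 ∷ # 5 ∷ # 6 ∷ # 2 ∷ # 3 ∷ # 0 ∷ # 1 ∷ [])) refl refl
target-contains (suc s) {F = F} (cone {F = F′} t) =
  contains-trans {G = F} {F = Cone (KminusK3P3 (6 + s))} {H = KminusK3P3 (7 + s)} (cone-contains {F = F′} {H = KminusK3P3 (6 + s)} (target-contains s t)) (cone-KminusK3P3 (6 + s))

-- Deciding potential graphicness by finite search

Searchable : Set → Set₁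
Searchable A = {P : A → Set} → (∀ a → Dec (P a)) → Dec (∃ P)

search-Bool : Searchable Bool
search-Bool P? with P? true | P? false
... | yes p | _     = yes (true , p)
... | no _  | yes q = yes (false , q)
... | no ¬p | no ¬q = no λ { (true , p) → ¬p p ; (false , q) → ¬q q }

search-Vec : {A : Set} → Searchable A → ∀ n → Searchable (Vec A n)
search-Vec S zero    P? = map′ (λ p → [] , p) (λ { ([] , p) → p }) (P? [])
search-Vec S (suc n) P? = map′ (λ { (a , v , p) → a ∷ v , p }) (λ { (a ∷ v , p) → a , v , p })
  (S (λ a → search-Vec S n (λ v → P? (a ∷ v))))

contains? : (G : Graph n) (H : Graph k) → Dec (ContainsSubgraph G H)
contains? {n} {k} G H = map′
  (λ { (v , inj , hom) → lookup v , (λ {i} {j} → inj i j) , hom })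
  (λ { (f , inj , hom) → tabulate f
     , (λ i j e → inj (trans (≡-sym (lookup∘tabulate f i)) (trans e (lookup∘tabulate f j))))
     , (λ i j e → subst₂ (Adj G) (≡-sym (lookup∘tabulate f i)) (≡-sym (lookup∘tabulate f j)) (hom i j e)) })
  (search-Vec FP.any? k (λ v →
    (FP.all? λ i → FP.all? λ j → (lookup v i ≟ lookup v j) →-dec (i ≟ j)) ×-dec
    (FP.all? λ i → FP.all? λ j → (adj H i j BP.≟ true) →-dec (adj G (lookup v i) (lookup v j) BP.≟ true))))

-- `upper-bound` only refutes the absence of a good realisation; this decision procedure removes the
-- double negation. Graphs are searched through their adjacency matrices.
potentiallyGraphic? : (H : Graph k) (d : Seq n) → Dec (PotentiallyGraphic H d)
potentiallyGraphic? {k} {n} H d = map′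
  (λ { (M , (sy , ir) , real , c) → graph M sy ir , real , c })
  (λ { (G , real , f , inj , hom) →
       let e = λ i j → trans (cong (λ row → lookup row j) (lookup∘tabulate (λ i → tabulate (adj G i)) i)) (lookup∘tabulate (adj G i) j) in
       tabulate (λ i → tabulate (adj G i))
       , ((λ i j → trans (e i j) (trans (sym G i j) (≡-sym (e j i)))) , (λ i → trans (e i i) (irrefl G i)))
       , (λ i → trans (count-cong (e i)) (real i))
       , f , (λ {i} {j} → inj {i} {j}) , (λ i j a → trans (e (f i) (f j)) (hom i j a)) })
  (search-Vec (search-Vec search-Bool n) n λ M → decide M)
  where
  Sym Irr : Vec (Vec Bool n) n → Set
  Sym M = ∀ i j → lookup (lookup M i) j ≡ lookup (lookup M j) i
  Irr M = ∀ i → lookup (lookup M i) i ≡ false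
  graph : ∀ M → Sym M → Irr M → Graph n
  graph M sy ir = record { adj = λ i j → lookup (lookup M i) j ; sym = sy ; irrefl = ir }
  Hom : Vec (Vec Bool n) n → (Fin k → Fin n) → Set
  Hom M f = ∀ i j → adj H i j ≡ true → lookup (lookup M (f i)) (f j) ≡ true
  Good′ : Vec (Vec Bool n) n → Set
  Good′ M = (Sym M × Irr M) × (∀ i → count (lookup (lookup M i)) ≡ d i) × Σ (Fin k → Fin n) λ f → Injective _≡_ _≡_ f × Hom M f
  decide : ∀ M → Dec (Good′ M)
  decide M with (FP.all? λ i → FP.all? λ j → lookup (lookup M i) j BP.≟ lookup (lookup M j) i) | (FP.all? λ i → lookup (lookup M i) i BP.≟ false)
  ... | no ¬p | _ = no λ { ((p , _) , _) → ¬p p }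
  ... | yes _ | no ¬p = no λ { ((_ , p) , _) → ¬p p }
  ... | yes sy | yes ir = map′ (λ { (r , c) → (sy , ir) , r , c }) (λ { (_ , r , c) → r , c })
          ((FP.all? λ i → count (lookup (lookup M i)) NP.≟ d i) ×-dec contains? (graph M sy ir) H)

-- Parity and the exact value

parity : ∀ q → (∃ λ p → q ≡ p * 2) ⊎ (∃ λ p → q ≡ suc (p * 2))
parity zero = inj₁ (0 , refl)
parity (suc q) with parity q
... | inj₁ (p , refl) = inj₂ (p , refl)
... | inj₂ (p , refl) = inj₁ (suc p , refl)

2∣consecutive : ∀ x → 2 ∣ x * suc x
2∣consecutive zero    = divides 0 refl
2∣consecutive (suc x) = subst (2 ∣_) (solve 1 (λ x → x :* (con 1 :+ x) :+ con 2 :* (con 1 :+ x) := (con 1 :+ x) :* (con 2 :+ x)) refl x)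
  (∣m∣n⇒∣m+n (2∣consecutive x) (m∣m*n (suc x)))
  where open +-*-Solver

-- the degree sum of K_s joined to m isolated vertices, plus m, for s = 3 + t and m = 3 + q
threshold₀ : ℕ → ℕ → ℕ
threshold₀ t q = (2 + t) * (3 + t) + 2 * ((3 + t) * (3 + q)) + (3 + q)

-- With `r = s + 3` and `n = s + m`, the bound `n ≥ 5r + 18` reads `m ≥ 4s + 33`, and `s ≥ 3` then
-- gives `m ≥ 45`.
sigma-upper : ∀ t q → 5 * (6 + t) + 18 ≤ 6 + t + q → ∀ l → threshold₀ t q + 2 ≤ l → SigmaProperty (KminusK3P3 (6 + t)) (3 + t + (3 + q)) l
sigma-upper t q big l le d (_ , G , real) ld = decidable-stable (potentiallyGraphic? (KminusK3P3 (6 + t)) d) λ np →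
  upper-bound s m G (count-≤ (above 0 G)) dense
    (+-cancelˡ-≤ (3 + t) _ _ (≤-trans (≤-reflexive (solve 1 (λ t → con 3 :+ t :+ (con 4 :* (con 3 :+ t) :+ con 33) := con 5 :* (con 6 :+ t) :+ con 18) refl t))
      (≤-trans big (≤-reflexive (solve 2 (λ t q → con 6 :+ t :+ q := con 3 :+ t :+ (con 3 :+ q)) refl t q)))))
    (+-cancelˡ-≤ (3 + t) _ _ (≤-trans (≤-trans (m≤m+n _ (4 * t)) (≤-reflexive (solve 1 (λ t → con 3 :+ t :+ con 45 :+ con 4 :* t := con 5 :* (con 6 :+ t) :+ con 18) refl t)))
      (≤-trans big (≤-reflexive (solve 2 (λ t q → con 6 :+ t :+ q := con 3 :+ t :+ (con 3 :+ q)) refl t q)))))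
    λ H eq (k , F , tg , c) → np (H , (λ i → trans (eq i) (real i)) , contains-trans {G = H} {F = F} {H = KminusK3P3 (6 + t)} c (target-contains t tg))
  where
  open +-*-Solver
  s m : ℕ
  s = 3 + t
  m = 3 + q
  dense : s * s + 2 * (s * m) + m + 2 ≤ sumF (degree G) + s
  dense = ≤-trans (≤-reflexive (solve 2 (λ t q → let s = con 3 :+ t ; m = con 3 :+ q in
      s :* s :+ con 2 :* (s :* m) :+ m :+ con 2 := (con 2 :+ t) :* s :+ con 2 :* (s :* m) :+ m :+ con 2 :+ s) refl t q))
    (+-monoˡ-≤ s (≤-trans le (≤-trans ld (≤-reflexive (sum-cong (λ i → ≡-sym (real i)))))))

-- The constant `c` makes the claimed value exceed the degree sum of the extremal graph by two.
-- Smaller values up to that sum are excluded by `sigma-lower`, and the single number in between is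
-- odd.
sigma-exact : ∀ t q (R : Graph (3 + q)) → Sparse R → 5 * (6 + t) + 18 ≤ 6 + t + q → ∀ c → sumF (degree R) + 2 ≡ 3 + q + c → 2 ≤ c → 2 ∣ threshold₀ t q + c →
  IsSigma (KminusK3P3 (6 + t)) (3 + t + (3 + q)) (threshold₀ t q + c)
sigma-exact t q R sparse big c sum 2≤c even = even , sigma-upper t q big _ (+-monoʳ-≤ (threshold₀ t q) 2≤c) , minimal
  where
  open +-*-Solver
  l = threshold₀ t q + c
  σ = sumF (degree (coneN (3 + t) R))
  l≡ : l ≡ suc (suc σ)
  l≡ = +-cancelʳ-≡ (3 + t) l (suc (suc σ)) (trans (solve 3 (λ t q c → let s = con 3 :+ t ; m = con 3 :+ q in
        (con 2 :+ t) :* s :+ con 2 :* (s :* m) :+ m :+ c :+ s := s :* s :+ con 2 :* (s :* m) :+ (m :+ c)) refl t q c)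
      (trans (cong ((3 + t) * (3 + t) + 2 * ((3 + t) * (3 + q)) +_) (≡-sym sum))
      (trans (≡-sym (+-assoc ((3 + t) * (3 + t) + 2 * ((3 + t) * (3 + q))) (sumF (degree R)) 2))
      (trans (cong (_+ 2) (≡-sym (coneN-sum (3 + t) R))) (solve 2 (λ a b → a :+ b :+ con 2 := con 2 :+ a :+ b) refl σ (3 + t))))))
  minimal : ∀ l′ → 2 ∣ l′ → SigmaProperty (KminusK3P3 (6 + t)) (3 + t + (3 + q)) l′ → l ≤ l′
  minimal l′ even′ prop = ≮⇒≥ λ lt → odd (≤-antisym lt (≤-trans (≤-reflexive l≡) (s≤s (sigma-lower {3 + t} sparse l′ prop))))
    where
    odd : suc l′ ≡ l → ⊥
    odd e with ∣1⇒≡1 (∣m+n∣m⇒∣n (subst (2 ∣_) (trans (≡-sym e) (+-comm 1 l′)) even) even′)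
    ... | ()

theorem1p1 : (r n : ℕ) → 6 ≤ r → 5 * r + 18 ≤ n →
    (¬ (2 ∣ (n ∸ r)) → IsSigma (KminusK3P3 r) n ((r ∸ 1) * (2 * n ∸ r) ∸ 3 * (n ∸ r) ∸ 1))
    × (2 ∣ (n ∸ r) → IsSigma (KminusK3P3 r) n ((r ∸ 1) * (2 * n ∸ r) ∸ 3 * (n ∸ r)))
theorem1p1 r n 6≤r big with m≤n⇒∃[o]m+o≡n 6≤r | m≤n⇒∃[o]m+o≡n (≤-trans (≤-trans (m≤n*m r 5) (m≤m+n (5 * r) 18)) big)
... | t , refl | q , refl = odd , even
  where
  open +-*-Solver
  N = 6 + t + q
  n≡ : 3 + t + (3 + q) ≡ N
  n≡ = solve 2 (λ t q → con 3 :+ t :+ (con 3 :+ q) := con 6 :+ t :+ q) refl t q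
  q≡ : N ∸ (6 + t) ≡ q
  q≡ = m+n∸m≡n (6 + t) q
  -- In terms of `t` and `q` all truncated subtractions are exact: `(r - 1)(2n - r)` equals
  -- `threshold₀ t q + 3 + 3q`.
  value : (5 + t) * (2 * N ∸ (6 + t)) ∸ 3 * (N ∸ (6 + t)) ≡ threshold₀ t q + 3
  value = trans (cong₂ (λ x y → (5 + t) * x ∸ 3 * y) two q≡) (trans (cong (_∸ 3 * q)
      (solve 2 (λ t q → (con 5 :+ t) :* (con 6 :+ t :+ con 2 :* q) := (con 2 :+ t) :* (con 3 :+ t) :+ con 2 :* ((con 3 :+ t) :* (con 3 :+ q)) :+ (con 3 :+ q) :+ con 3 :+ con 3 :* q) refl t q))
      (m+n∸n≡m (threshold₀ t q + 3) (3 * q)))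
    where
    two : 2 * N ∸ (6 + t) ≡ 6 + t + 2 * q
    two = trans (cong (_∸ (6 + t)) (solve 2 (λ t q → con 2 :* (con 6 :+ t :+ q) := con 6 :+ t :+ con 2 :* q :+ (con 6 :+ t)) refl t q)) (m+n∸n≡m (6 + t + 2 * q) (6 + t))
  base : ℕ
  base = (2 + t) * (3 + t) + 2 * ((3 + t) * (3 + q))
  base-even : 2 ∣ base
  base-even = ∣m∣n⇒∣m+n (2∣consecutive (2 + t)) (m∣m*n ((3 + t) * (3 + q)))
  -- Since `m = (n - r) + 3`, an even `n - r` means an odd `m`: no perfect matching exists, and a
  -- path with two edges takes up the three remaining vertices.
  even : 2 ∣ (N ∸ (6 + t)) → IsSigma (KminusK3P3 (6 + t)) N ((5 + t) * (2 * N ∸ (6 + t)) ∸ 3 * (N ∸ (6 + t)))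
  even h with subst (2 ∣_) q≡ h
  ... | divides p refl = subst₂ (IsSigma (KminusK3P3 (6 + t))) n≡ (≡-sym value)
        (sigma-exact t q (addCherry (matching p)) (cherry-sparse p) big 3
          (trans (cong (_+ 2) (cherry-sum p)) (solve 1 (λ x → con 4 :+ x :+ con 2 := con 3 :+ x :+ con 3) refl (p * 2))) (s≤s (s≤s z≤n))
          (subst (2 ∣_) (≡-sym (+-assoc base (3 + q) 3)) (∣m∣n⇒∣m+n base-even (divides (3 + p) (solve 1 (λ p → con 3 :+ p :* con 2 :+ con 3 := (con 3 :+ p) :* con 2) refl p)))))
  odd : ¬ (2 ∣ (N ∸ (6 + t))) → IsSigma (KminusK3P3 (6 + t)) N ((5 + t) * (2 * N ∸ (6 + t)) ∸ 3 * (N ∸ (6 + t)) ∸ 1)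
  odd h with parity q
  ... | inj₁ (p , e) = ⊥-elim (h (divides p (trans q≡ e)))
  ... | inj₂ (p , refl) = subst₂ (IsSigma (KminusK3P3 (6 + t))) n≡ (≡-sym (trans (cong (_∸ 1) value) (trans (cong (_∸ 1) (≡-sym (+-assoc (threshold₀ t q) 2 1))) (m+n∸n≡m (threshold₀ t q + 2) 1))))
        (sigma-exact t q (matching (2 + p)) (matching-sparse (1 + p)) big 2 (cong (_+ 2) (matching-sum (2 + p))) (s≤s (s≤s z≤n))
          (subst (2 ∣_) (≡-sym (+-assoc base (3 + q) 2)) (∣m∣n⇒∣m+n base-even (divides (3 + p) (solve 1 (λ p → con 3 :+ (con 1 :+ p :* con 2) :+ con 2 := (con 3 :+ p) :* con 2) refl p)))))
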